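{- Any $n$-variate branching program $\mathcal{P}$ of length $T$ and size $2^S$ over domain $D\times D$, with $|D|\ge 2n^2$, which computes the element bidistinctness function $EB$, requires $T=\Omega\!\left(n\sqrt{\log(n/S)/\log\log(n/S)}\right)$.
   Context: Two elements $x=(x_1,x_2)$, $y=(y_1,y_2)$ of $D\times D$ are bidistinct if $x_1\ne y_2$ and $x_2\ne y_1$. $EB:(D\times D)^n\to\{0,1\}$ equals $1$ iff for all $1\le i,j\le n$ the $i$-th and $j$-th pairs are bidistinct. An $n$-variate branching program over a domain $D'$ is a directed acyclic graph with a unique source, two sinks labelled $0$ and $1$, each non-sink node $v$ assigned a variable index $i(v)\in[1,n]$ and having exactly $|D'|$ outgoing arcs labelled by distinct elements of $D'$; on input $x\in D'^n$ it starts at the source, repeatedly follows the arc labelled $x_{i(v)}$ from the current node $v$, and outputs the label of the sink reached. Its size is the number of nodes and its length is the length of the longest path from the source to a sink. -}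

module Defs where

open import Algebra.Definitions.RawSemiring using () renaming (_^_ to pow)
open import Data.Bool.Base using (Bool)
open import Data.Fin.Base using (Fin)
open import Data.Fin.Properties using (all?; _≟_)
import Data.Integer.Base as ℤ
open import Data.Nat.Base as ℕ using (ℕ; suc)
open import Data.Product.Base using (_×_; _,_; ∃-syntax; Σ-syntax)
open import Data.Rational.Base as ℚ using (ℚ; 0ℚ; 1ℚ; ½; ↥_; ↧ₙ_; +-*-rawSemiring)
open import Data.Sum.Base using (_⊎_)
open import Data.Vec.Functional using (Vector)
open import Relation.Binary.Construct.Closure.ReflexiveTransitive using (Star; ε; _◅_)
open import Relation.Binary.Construct.Closure.Transitive using (TransClosure)
open import Relation.Binary.PropositionalEquality using (_≡_; _≢_)
open import Relation.Nullary.Decidable using (Dec; ⌊_⌋; ¬?; _×-dec_)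
open import Relation.Nullary.Negation using (¬_)

------------------------------------------------------------------------
-- Branching programs

data Node (size n : ℕ) (A : Set) : Set where
  sink  : Bool → Node size n A
  query : Fin n → (A → Fin size) → Node size n A

-- The targets of the arcs out of a node, and the target of the arc followed
-- on input x.

data _↝_ {size n : ℕ} {A : Set} : Node size n A → Fin size → Set where
  arc : ∀ {i next} (a : A) → query i next ↝ next a

data _⊢_↝_ {size n : ℕ} {A : Set} (x : Vector A n) :
           Node size n A → Fin size → Set where
  step : ∀ {i next} → x ⊢ query i next ↝ next (x i)

-- The nodes are Fin size.  A querying node has one outgoing arc for each
-- element of A; arcs with different labels may have the same target.

record BranchingProgram (n : ℕ) (A : Set) : Set where
  field
    size : ℕ
    node : Fin size → Node size n A

  Arc : Fin size → Fin size → Set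
  Arc u v = node u ↝ v

  field
    acyclic        : ∀ v → ¬ TransClosure Arc v v
    source         : Fin size
    source-initial : ∀ u → ¬ Arc u source
    source-unique  : ∀ v → (∀ u → ¬ Arc u v) → v ≡ source
    sinkNode       : Bool → Fin size
    sink-label     : ∀ b → node (sinkNode b) ≡ sink b
    sink-unique    : ∀ b v → node v ≡ sink b → v ≡ sinkNode b

  Path : Fin size → Fin size → Set
  Path = Star Arc

  length : ∀ {u v} → Path u v → ℕ
  length ε       = 0
  length (_ ◅ p) = suc (length p)

  HasLength : ℕ → Set
  HasLength T =
    (∃[ b ] Σ[ p ∈ Path source (sinkNode b) ] length p ≡ T) ×
    (∀ b (p : Path source (sinkNode b)) → length p ℕ.≤ T)

  Outputs : Vector A n → Bool → Set
  Outputs x b = Star (λ u v → x ⊢ node u ↝ v) source (sinkNode b)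

  Computes : (Vector A n → Bool) → Set
  Computes f = ∀ x → Outputs x (f x)

------------------------------------------------------------------------
-- Element bidistinctness

Bidistinct : {D : Set} → D × D → D × D → Set
Bidistinct (x₁ , x₂) (y₁ , y₂) = x₁ ≢ y₂ × x₂ ≢ y₁

bidistinct? : ∀ {d} (x y : Fin d × Fin d) → Dec (Bidistinct x y)
bidistinct? (x₁ , x₂) (y₁ , y₂) = ¬? (x₁ ≟ y₂) ×-dec ¬? (x₂ ≟ y₁)

-- The case i = j is included: it says that the two components of the
-- i-th pair differ.

EB : ∀ {n d} → Vector (Fin d × Fin d) n → Bool
EB x = ⌊ all? (λ i → all? (λ j → bidistinct? (x i) (x j))) ⌋

------------------------------------------------------------------------
-- Real numbers

-- A real x is given by its Dedekind cut: Below r means r < x and Above r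
-- means x < r.  The cut laws are not part of the record.

record Cut : Set₁ where
  field
    Below : ℚ → Set
    Above : ℚ → Set

open Cut public

infix 4 _≼_

_≼_ : Cut → Cut → Set
x ≼ y = ∀ r → Below x r → Below y r

fromℚ : ℚ → Cut
fromℚ q .Below r = r ℚ.< q
fromℚ q .Above r = q ℚ.< r

fromℕ : ℕ → Cut
fromℕ n = fromℚ (ℤ.+ n ℚ./ 1)

infixl 7 _⊗_ _⊘_

-- Correct for positive x and y.

_⊗_ : Cut → Cut → Cut
(x ⊗ y) .Below r = ∃[ a ] ∃[ b ]
  0ℚ ℚ.< a × Below x a × 0ℚ ℚ.< b × Below y b × r ℚ.≤ a ℚ.* b
(x ⊗ y) .Above r = ∃[ a ] ∃[ b ] Above x a × Above y b × a ℚ.* b ℚ.≤ r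

-- Correct for positive x and y.

_⊘_ : Cut → Cut → Cut
(x ⊘ y) .Below r = ∃[ a ] ∃[ b ]
  0ℚ ℚ.< a × Below x a × Above y b × r ℚ.* b ℚ.≤ a
(x ⊘ y) .Above r = ∃[ a ] ∃[ b ]
  Above x a × 0ℚ ℚ.< b × Below y b × a ℚ.≤ r ℚ.* b

-- Correct for nonnegative x.

√ : Cut → Cut
√ x .Below r = r ℚ.< 0ℚ ⊎ (∃[ a ] Below x a × r ℚ.* r ℚ.≤ a)
√ x .Above r = 0ℚ ℚ.< r × (∃[ a ] Above x a × a ℚ.≤ r ℚ.* r)

infixr 8 _^_

_^_ : ℚ → ℕ → ℚ
_^_ = pow +-*-rawSemiring

2^ : ℤ.ℤ → ℚ
2^ (ℤ.+ k)    = (1ℚ ℚ.+ 1ℚ) ^ k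
2^ ℤ.-[1+ k ] = ½ ^ suc k

-- Correct for positive x.  For r = p / q and s > 0, 2^r ≤ s is expressed
-- as 2^p ≤ s^q, and s ≤ 2^r as s^q ≤ 2^p.

log₂ : Cut → Cut
log₂ x .Below r = ∃[ s ] 0ℚ ℚ.< s × Below x s × 2^ (↥ r) ℚ.≤ s ^ (↧ₙ r)
log₂ x .Above r = ∃[ s ] 0ℚ ℚ.< s × Above x s × s ^ (↧ₙ r) ℚ.≤ 2^ (↥ r)

{-# OPTIONS --safe #-}
module Submission where

-- Cut a computation of length T ≤ K n into r segments of equal length; the
-- nodes at the cuts take one of size ^ (r + 1) values.  Colour some segments
-- true, some false, and leave the others uncoloured.  For an accepted input x
-- let A_s be the set of variables read only in segments coloured s.  Accepted
-- inputs with the same cut nodes, the same A_true and A_false and the same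
-- values elsewhere form a rectangle.  Bidistinctness forces the first (second)
-- components occurring on A_s and the second (first) components occurring on
-- A_(not s) to be disjoint, so for one s the coordinates in A_s range over at
-- most a quarter of all pairs.
--
-- The segments not coloured s partition the inputs into subcubes, with A_s as
-- the free coordinates.  On such a subcube A_(not s) is known up to its
-- exceptional set: its symmetric difference with the set of variables that are
-- read exactly t times in segments coloured not s and otherwise only in
-- segments coloured s.  So, summing over the possible exceptional sets, few
-- inputs have large A_s and a small exceptional set, which contradicts that
-- half of all inputs are accepted.
--
-- The colouring is chosen by averaging, each colour having probability 1 / Q.
-- If the number of variables read s times, divided by Q ^ s, has a sharp peak
-- at s = t, then the exceptional sets are small in comparison with both A_true
-- and A_false.  Some Q among B, B ^ 2, …, B ^ O(K) has such a peak, since the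
-- maximizing t decreases with Q and is O(K) initially.  With B = K ^ O(1) this
-- gives n / S ≤ K ^ O(K²).

-- One of the two legs is narrow, but bidistinctness does not say which. So, for each accepted
-- input, the colouring must make each core large compared with the exceptional set of the other
-- colour. Both inequalities come from one average: the product of the two core sizes is compared
-- with the sum of the costs `ζ s * (m₀ + w * ξ s)`.
--
-- Exceptional sets arise because membership in A_(not s) also depends on the segments coloured s,
-- which vary on the subcube. Ignoring these segments leaves an approximation that is fixed there,
-- and its error E is guessed. There are up to 2 ^ n guesses, so the union bound relies on the
-- factor 4 ^ (-w |E|) gained from |A_s| ≥ m₀ + w |E|. The total is 4 ^ (-m₀) (1 + 4 ^ (-w)) ^ n,
-- and w makes the last factor at most 2 ^ m₀.
--
-- The colouring depends on the input and is guessed together with the cut nodes. This costs about r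
-- S bits against the m₀ bits gained, which bounds n. The number r must be so large that few pairs
-- of variables share a segment, as only the other pairs behave independently.

open import Defs renaming (_^_ to _^ℚ_)
open import Algebra.Bundles using (CommutativeRing)
import Algebra.Properties.Semiring.Exp as Exp
open import Data.Bool.Base using (Bool; true; false; not; _∧_; _∨_; _xor_; if_then_else_)
import Data.Bool.Properties as Bool
open import Data.Empty using (⊥; ⊥-elim)
open import Data.Fin.Base using (Fin; zero; suc; toℕ; fromℕ<; inject₁) renaming (fromℕ to last)
open import Data.Fin.Induction using (<-weakInduction)
import Data.Fin.Properties as Fin
open import Data.Integer.Base as ℤ using (-[1+_]) renaming (+_ to int)
import Data.Integer.Properties as ℤ
open import Data.List.Base using (List; []; _∷_; map; _++_; length; allFin; cartesianProduct; cartesianProductWith)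
open import Data.List.Membership.Propositional using (_∈_; lose; find)
open import Data.List.Membership.Propositional.Properties using (∈-allFin; ∈-cartesianProduct⁺; ∈-cartesianProductWith⁺)
import Data.List.Properties as List
open import Data.List.Relation.Unary.All using (All; []; _∷_)
open import Data.List.Relation.Unary.Any using (any?; here; there)
open import Data.List.Relation.Unary.Unique.Propositional using (Unique; []; _∷_)
import Data.List.Relation.Unary.Unique.Propositional.Properties as Unique
open import Data.Maybe.Base using (Maybe; just; nothing)
import Data.Maybe.Properties as Maybe
open import Data.Nat.Base
open import Data.Nat.Base using () renaming (_^_ to _^ℕ_)
open import Data.Nat.DivMod using (m≡m%n+[m/n]*n; m%n<n; m/n*n≤m)
open import Data.Nat.ListAction using (sum)
open import Data.Nat.ListAction.Properties using (sum-++)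
open import Data.Nat.Properties
open import Data.Nat.Tactic.RingSolver using (solve-∀)
open import Data.Product.Base using (_×_; _,_; proj₁; proj₂; ∃-syntax; Σ-syntax)
open import Data.Product.Properties using (≡-dec)
open import Data.Rational.Base as ℚ using (ℚ; mkℚ; 0ℚ; 1ℚ; ½; ↥_; ↧ₙ_; toℚᵘ) renaming (_<_ to _<ℚ_)
import Data.Rational.Properties as ℚ
open import Data.Rational.Unnormalised.Base as ℚᵘ using (mkℚᵘ; *≡*; *<*; *≤*)
import Data.Rational.Unnormalised.Properties as ℚᵘ
open import Data.Sum.Base using (_⊎_; inj₁; inj₂; [_,_]′)
open import Data.Vec.Base using (Vec; []; _∷_; lookup; tabulate; _[_]≔_)
open import Data.Vec.Properties using (lookup∘tabulate; lookup∘update; lookup∘update′) renaming (≡-dec to ≡-decᵛ)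
open import Function.Base using (_∘_; id)
open import Relation.Binary.Construct.Closure.ReflexiveTransitive using (Star; ε; _◅_)
open import Relation.Binary.Definitions using (tri<; tri≈; tri>)
open import Relation.Binary.PropositionalEquality hiding (J)
open import Relation.Nullary.Decidable using (Dec; yes; no; ⌊_⌋; map′; _×-dec_; _→-dec_)
open import Relation.Nullary.Negation using (¬_; contradiction)

-- Finite sums and products

∑ : {A : Set} → List A → (A → ℕ) → ℕ
∑ xs f = sum (map f xs)

⟦_⟧ : Bool → ℕ
⟦ b ⟧ = if b then 1 else 0

𝟙 : {P : Set} → Dec P → ℕ
𝟙 (yes _) = 1
𝟙 (no _)  = 0

𝟙≤1 : ∀ {P : Set} (P? : Dec P) → 𝟙 P? ≤ 1
𝟙≤1 (yes _) = ≤-refl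
𝟙≤1 (no _)  = z≤n

𝟙-yes : ∀ {P : Set} (P? : Dec P) → P → 𝟙 P? ≡ 1
𝟙-yes (yes _) _ = refl
𝟙-yes (no ¬p) p = contradiction p ¬p

𝟙-no : ∀ {P : Set} (P? : Dec P) → ¬ P → 𝟙 P? ≡ 0
𝟙-no (yes p) ¬p = contradiction p ¬p
𝟙-no (no _)  _  = refl

𝟙-mono : ∀ {P Q : Set} (P? : Dec P) (Q? : Dec Q) → (P → Q) → 𝟙 P? ≤ 𝟙 Q?
𝟙-mono (yes p) Q? f = ≤-reflexive (sym (𝟙-yes Q? (f p)))
𝟙-mono (no _)  Q? f = z≤n

𝟙-cong : ∀ {P Q : Set} (P? : Dec P) (Q? : Dec Q) → (P → Q) → (Q → P) → 𝟙 P? ≡ 𝟙 Q?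
𝟙-cong P? Q? f g = ≤-antisym (𝟙-mono P? Q? f) (𝟙-mono Q? P? g)

⟦⟧≤1 : ∀ b → ⟦ b ⟧ ≤ 1
⟦⟧≤1 true  = ≤-refl
⟦⟧≤1 false = z≤n

module _ {A : Set} where

  ∑-cong : ∀ xs {f g : A → ℕ} → (∀ a → f a ≡ g a) → ∑ xs f ≡ ∑ xs g
  ∑-cong xs e = cong sum (List.map-cong e xs)

  ∑-mono : ∀ xs {f g : A → ℕ} → (∀ a → f a ≤ g a) → ∑ xs f ≤ ∑ xs g
  ∑-mono []       h = z≤n
  ∑-mono (x ∷ xs) h = +-mono-≤ (h x) (∑-mono xs h)

  ∑-zero : ∀ (xs : List A) → ∑ xs (λ _ → 0) ≡ 0
  ∑-zero []       = refl
  ∑-zero (x ∷ xs) = ∑-zero xs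

  ∑-+ : ∀ xs (f g : A → ℕ) → ∑ xs (λ a → f a + g a) ≡ ∑ xs f + ∑ xs g
  ∑-+ []       f g = refl
  ∑-+ (x ∷ xs) f g = trans (cong (f x + g x +_) (∑-+ xs f g)) (+-+-swap (f x) (g x) _ _)
    where
    +-+-swap : ∀ a b c d → a + b + (c + d) ≡ a + c + (b + d)
    +-+-swap = solve-∀

  ∑-*ˡ : ∀ xs k (f : A → ℕ) → ∑ xs (λ a → k * f a) ≡ k * ∑ xs f
  ∑-*ˡ []       k f = sym (*-zeroʳ k)
  ∑-*ˡ (x ∷ xs) k f = trans (cong (k * f x +_) (∑-*ˡ xs k f)) (sym (*-distribˡ-+ k (f x) _))

  ∑-*ʳ : ∀ xs (f : A → ℕ) k → ∑ xs (λ a → f a * k) ≡ ∑ xs f * k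
  ∑-*ʳ xs f k = trans (∑-cong xs (λ a → *-comm (f a) k)) (trans (∑-*ˡ xs k f) (*-comm k _))

  ∑-const : ∀ (xs : List A) k → ∑ xs (λ _ → k) ≡ length xs * k
  ∑-const []       k = refl
  ∑-const (x ∷ xs) k = cong (k +_) (∑-const xs k)

  ∑-++ : ∀ xs ys (f : A → ℕ) → ∑ (xs ++ ys) f ≡ ∑ xs f + ∑ ys f
  ∑-++ xs ys f = trans (cong sum (List.map-++ f xs ys)) (sum-++ (map f xs) (map f ys))

  ∑-map : ∀ {B : Set} (h : B → A) ys (f : A → ℕ) → ∑ (map h ys) f ≡ ∑ ys (f ∘ h)
  ∑-map h ys f = cong sum (sym (List.map-∘ ys))

  ∈⇒≤∑ : ∀ {xs} {a : A} (f : A → ℕ) → a ∈ xs → f a ≤ ∑ xs f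
  ∈⇒≤∑ f (here refl) = m≤m+n _ _
  ∈⇒≤∑ f (there p)   = ≤-trans (∈⇒≤∑ f p) (m≤n+m _ _)

  ∑-unique≤1 : ∀ {xs} (_≟_ : (a b : A) → Dec (a ≡ b)) → Unique xs → ∀ b → ∑ xs (λ a → 𝟙 (a ≟ b)) ≤ 1
  ∑-unique≤1 _≟_ []       b = z≤n
  ∑-unique≤1 {x ∷ xs} _≟_ (px ∷ u) b with x ≟ b
  ... | no  _    = ∑-unique≤1 _≟_ u b
  ... | yes refl = s≤s (≤-reflexive (absent px))
    where
    absent : ∀ {ys} → All (x ≢_) ys → ∑ ys (λ a → 𝟙 (a ≟ x)) ≡ 0
    absent []                  = refl
    absent {y ∷ _} (x≢y ∷ all) = cong₂ _+_ (𝟙-no (y ≟ x) (x≢y ∘ sym)) (absent all)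

∑-swap : ∀ {A B : Set} xs ys (f : A → B → ℕ) →
         ∑ xs (λ a → ∑ ys (f a)) ≡ ∑ ys (λ b → ∑ xs (λ a → f a b))
∑-swap []       ys f = sym (∑-zero ys)
∑-swap (x ∷ xs) ys f = trans (cong (∑ ys (f x) +_) (∑-swap xs ys f)) (sym (∑-+ ys (f x) _))

∑-cartesianProductWith : ∀ {A B C : Set} (h : A → B → C) xs ys (f : C → ℕ) →
                         ∑ (cartesianProductWith h xs ys) f ≡ ∑ xs (λ a → ∑ ys (λ b → f (h a b)))
∑-cartesianProductWith h []       ys f = refl
∑-cartesianProductWith h (x ∷ xs) ys f =
  trans (∑-++ (map (h x) ys) _ f) (cong₂ _+_ (∑-map (h x) ys f) (∑-cartesianProductWith h xs ys f))

length-cartesianProductWith : ∀ {A B C : Set} (h : A → B → C) xs ys → length (cartesianProductWith h xs ys) ≡ length xs * length ys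
length-cartesianProductWith h xs ys = begin
  length (cartesianProductWith h xs ys) ≡⟨ trans (sym (*-identityʳ _)) (sym (∑-const (cartesianProductWith h xs ys) 1)) ⟩
  ∑ (cartesianProductWith h xs ys) (λ _ → 1) ≡⟨ ∑-cartesianProductWith h xs ys (λ _ → 1) ⟩
  ∑ xs (λ _ → ∑ ys (λ _ → 1)) ≡⟨ ∑-const xs _ ⟩
  length xs * ∑ ys (λ _ → 1) ≡⟨ cong (length xs *_) (trans (∑-const ys 1) (*-identityʳ _)) ⟩
  length xs * length ys ∎
  where open ≡-Reasoning

∏ : ∀ {n} → (Fin n → ℕ) → ℕ
∏ {zero}  f = 1
∏ {suc n} f = f zero * ∏ (f ∘ suc)

∏-cong : ∀ {n} {f g : Fin n → ℕ} → (∀ i → f i ≡ g i) → ∏ f ≡ ∏ g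
∏-cong {zero}  e = refl
∏-cong {suc n} e = cong₂ _*_ (e zero) (∏-cong (e ∘ suc))

∏-mono : ∀ {n} {f g : Fin n → ℕ} → (∀ i → f i ≤ g i) → ∏ f ≤ ∏ g
∏-mono {zero}  h = ≤-refl
∏-mono {suc n} h = *-mono-≤ (h zero) (∏-mono (h ∘ suc))

∏-* : ∀ {n} (f g : Fin n → ℕ) → ∏ (λ i → f i * g i) ≡ ∏ f * ∏ g
∏-* {zero}  f g = refl
∏-* {suc n} f g = trans (cong (f zero * g zero *_) (∏-* (f ∘ suc) (g ∘ suc))) (*-*-swap (f zero) (g zero) _ _)
  where
  *-*-swap : ∀ a b c d → a * b * (c * d) ≡ a * c * (b * d)
  *-*-swap = solve-∀

∏-const : ∀ n k → ∏ {n} (λ _ → k) ≡ k ^ n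
∏-const zero    k = refl
∏-const (suc n) k = cong (k *_) (∏-const n k)

∏-one : ∀ {n} (f : Fin n → ℕ) → (∀ i → f i ≡ 1) → ∏ f ≡ 1
∏-one {n} f e = trans (∏-cong e) (trans (∏-const n 1) (^-zeroˡ n))

∏-if : ∀ {n} (b : Fin n → Bool) k → ∏ (λ i → if b i then k else 1) ≡ k ^ ∑ (allFin n) (⟦_⟧ ∘ b)
∑-allFin-suc : ∀ n (f : Fin (suc n) → ℕ) → ∑ (allFin (suc n)) f ≡ f zero + ∑ (allFin n) (f ∘ suc)

∑-allFin-suc n f = cong (f zero +_) (trans (cong (λ xs → ∑ xs f) (sym (List.map-tabulate id suc))) (∑-map suc (allFin n) f))

∏-if {zero}  b k = refl
∏-if {suc n} b k = trans (cong₂ _*_ (head (b zero)) (∏-if (b ∘ suc) k))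
  (trans (sym (^-distribˡ-+-* k ⟦ b zero ⟧ _)) (cong (k ^_) (sym (∑-allFin-suc n (⟦_⟧ ∘ b)))))
  where
  head : ∀ c → (if c then k else 1) ≡ k ^ ⟦ c ⟧
  head true  = sym (^-identityʳ k)
  head false = refl

vecs : ∀ {A : Set} → List A → ∀ n → List (Vec A n)
vecs xs zero    = [] ∷ []
vecs xs (suc n) = cartesianProductWith _∷_ xs (vecs xs n)

module _ {A : Set} (xs : List A) where

  ∑-vecs-suc : ∀ n (f : Vec A (suc n) → ℕ) →
               ∑ (vecs xs (suc n)) f ≡ ∑ xs (λ a → ∑ (vecs xs n) (λ v → f (a ∷ v)))
  ∑-vecs-suc n f = ∑-cartesianProductWith _∷_ xs (vecs xs n) f

  ∈-vecs : (∀ a → a ∈ xs) → ∀ {n} (v : Vec A n) → v ∈ vecs xs n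
  ∈-vecs all []      = here refl
  ∈-vecs all (a ∷ v) = ∈-cartesianProductWith⁺ _∷_ (all a) (∈-vecs all v)

  -- Independence of the coordinates of a uniform vector. Boxes, subcubes and the sum over all
  -- exceptional sets are counted through it.
  ∑-vecs-∏ : ∀ n (f : Fin n → A → ℕ) →
             ∑ (vecs xs n) (λ v → ∏ (λ i → f i (lookup v i))) ≡ ∏ (λ i → ∑ xs (f i))
  ∑-vecs-∏ zero    f = refl
  ∑-vecs-∏ (suc n) f = begin
    ∑ (vecs xs (suc n)) (λ v → ∏ (λ i → f i (lookup v i)))
      ≡⟨ ∑-vecs-suc n _ ⟩
    ∑ xs (λ a → ∑ (vecs xs n) (λ v → f zero a * ∏ (λ i → f (suc i) (lookup v i))))
      ≡⟨ ∑-cong xs (λ a → trans (∑-*ˡ (vecs xs n) (f zero a) _) (cong (f zero a *_) (∑-vecs-∏ n (f ∘ suc)))) ⟩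
    ∑ xs (λ a → f zero a * ∏ (λ i → ∑ xs (f (suc i))))
      ≡⟨ ∑-*ʳ xs (f zero) _ ⟩
    ∑ xs (f zero) * ∏ (λ i → ∑ xs (f (suc i))) ∎
    where open ≡-Reasoning

  length-vecs : ∀ n → length (vecs xs n) ≡ length xs ^ n
  length-vecs zero    = refl
  length-vecs (suc n) = trans (length-cartesianProductWith _∷_ xs (vecs xs n)) (cong (length xs *_) (length-vecs n))

^-distribʳ-* : ∀ k a b → (a * b) ^ k ≡ a ^ k * b ^ k
^-distribʳ-* k a b = trans (sym (∏-const k (a * b))) (trans (∏-* {k} (λ _ → a) (λ _ → b)) (cong₂ _*_ (∏-const k a) (∏-const k b)))

-- Colourings of the segments

Colour : Set
Colour = Maybe Bool

same : Bool → Bool → Bool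
same s s′ = not (s xor s′)

same-refl : ∀ s → same s s ≡ true
same-refl true  = refl
same-refl false = refl

same-not : ∀ s → same s (not s) ≡ false
same-not true  = refl
same-not false = refl

count : ∀ {r} → Vec Bool r → ℕ
count []          = 0
count (true  ∷ b) = suc (count b)
count (false ∷ b) = count b

-- b marks the segments that read a given variable.

only : ∀ {r} → Bool → Vec Colour r → Vec Bool r → Bool
only s []             []          = true
only s (_       ∷ F)  (false ∷ b) = only s F b
only s (nothing ∷ F)  (true  ∷ b) = false
only s (just s′ ∷ F)  (true  ∷ b) = same s s′ ∧ only s F b

-- An approximation to `only s` that ignores the reads in segments coloured `not s` (see
-- `exact-cong`): no read in an uncoloured segment, and t reads in segments coloured s. It agrees
-- with `only s` on a variable read t times in all.
exact : ∀ {r} → Bool → ℕ → Vec Colour r → Vec Bool r → Bool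
exact s t       []            []          = t ≡ᵇ 0
exact s t       (_       ∷ F) (false ∷ b) = exact s t F b
exact s t       (nothing ∷ F) (true  ∷ b) = false
exact s zero    (just s′ ∷ F) (true  ∷ b) = not (same s s′) ∧ exact s zero F b
exact s (suc t) (just s′ ∷ F) (true  ∷ b) = if same s s′ then exact s t F b else exact s (suc t) F b

exceptional : ∀ {r} → Bool → ℕ → Vec Colour r → Vec Bool r → Bool
exceptional s t F b = only s F b xor exact s t F b

exact-large : ∀ {r} s t (F : Vec Colour r) b → count b < t → exact s t F b ≡ false
exact-large s (suc t) []            []          _       = refl
exact-large s t       (_       ∷ F) (false ∷ b) lt      = exact-large s t F b lt
exact-large s t       (nothing ∷ F) (true  ∷ b) lt      = refl
exact-large s (suc t) (just s′ ∷ F) (true  ∷ b) (s≤s lt) with same s s′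
... | true  = exact-large s t F b lt
... | false = exact-large s (suc t) F b (m<n⇒m<1+n lt)

exact-count : ∀ {r} s (F : Vec Colour r) b → exact s (count b) F b ≡ only s F b
exact-count s []            []          = refl
exact-count s (_       ∷ F) (false ∷ b) = exact-count s F b
exact-count s (nothing ∷ F) (true  ∷ b) = refl
exact-count s (just s′ ∷ F) (true  ∷ b) with same s s′
... | true  = exact-count s F b
... | false = exact-large s (suc (count b)) F b ≤-refl

-- Inductive, so that expectations can be computed segment by segment. Without a common segment the
-- events for the two variables are independent.
data Disjoint : ∀ {r} → Vec Bool r → Vec Bool r → Set where
  []      : Disjoint [] []
  neither : ∀ {r} {b b′ : Vec Bool r} → Disjoint b b′ → Disjoint (false ∷ b) (false ∷ b′)
  left    : ∀ {r} {b b′ : Vec Bool r} → Disjoint b b′ → Disjoint (true  ∷ b) (false ∷ b′)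
  right   : ∀ {r} {b b′ : Vec Bool r} → Disjoint b b′ → Disjoint (false ∷ b) (true  ∷ b′)

-- (2 + q) ^ r times the expectation of h, where just false and just true have
-- probability 1 / (2 + q) each.

𝔼 : ℕ → ∀ r → (Vec Colour r → ℕ) → ℕ
𝔼 q zero    h = h []
𝔼 q (suc r) h = q * 𝔼 q r (h ∘ (nothing ∷_)) + (𝔼 q r (h ∘ (just false ∷_)) + 𝔼 q r (h ∘ (just true ∷_)))

module _ (q : ℕ) where

  𝔼-cong : ∀ r {f g : Vec Colour r → ℕ} → (∀ F → f F ≡ g F) → 𝔼 q r f ≡ 𝔼 q r g
  𝔼-cong zero    e = e []
  𝔼-cong (suc r) e = cong₂ _+_ (cong (q *_) (𝔼-cong r (e ∘ _))) (cong₂ _+_ (𝔼-cong r (e ∘ _)) (𝔼-cong r (e ∘ _)))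

  𝔼-mono : ∀ r {f g : Vec Colour r → ℕ} → (∀ F → f F ≤ g F) → 𝔼 q r f ≤ 𝔼 q r g
  𝔼-mono zero    h = h []
  𝔼-mono (suc r) h = +-mono-≤ (*-monoʳ-≤ q (𝔼-mono r (h ∘ _))) (+-mono-≤ (𝔼-mono r (h ∘ _)) (𝔼-mono r (h ∘ _)))

  𝔼-+ : ∀ r (f g : Vec Colour r → ℕ) → 𝔼 q r (λ F → f F + g F) ≡ 𝔼 q r f + 𝔼 q r g
  𝔼-+ zero    f g = refl
  𝔼-+ (suc r) f g = trans
    (cong₂ _+_ (cong (q *_) (𝔼-+ r (f ∘ _) (g ∘ _))) (cong₂ _+_ (𝔼-+ r (f ∘ _) (g ∘ _)) (𝔼-+ r (f ∘ _) (g ∘ _))))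
    (rearrange q (𝔼 q r (f ∘ _)) (𝔼 q r (g ∘ _)) (𝔼 q r (f ∘ _)) (𝔼 q r (g ∘ _)) (𝔼 q r (f ∘ _)) (𝔼 q r (g ∘ _)))
    where
    rearrange : ∀ q a b c d e f → q * (a + b) + ((c + d) + (e + f)) ≡ (q * a + (c + e)) + (q * b + (d + f))
    rearrange = solve-∀

  𝔼-*ˡ : ∀ r k (f : Vec Colour r → ℕ) → 𝔼 q r (λ F → k * f F) ≡ k * 𝔼 q r f
  𝔼-*ˡ zero    k f = refl
  𝔼-*ˡ (suc r) k f = trans
    (cong₂ _+_ (cong (q *_) (𝔼-*ˡ r k (f ∘ _))) (cong₂ _+_ (𝔼-*ˡ r k (f ∘ _)) (𝔼-*ˡ r k (f ∘ _))))
    (rearrange q k (𝔼 q r (f ∘ _)) (𝔼 q r (f ∘ _)) (𝔼 q r (f ∘ _)))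
    where
    rearrange : ∀ q k a b c → q * (k * a) + (k * b + k * c) ≡ k * (q * a + (b + c))
    rearrange = solve-∀

  𝔼-zero : ∀ r → 𝔼 q r (λ _ → 0) ≡ 0
  𝔼-zero r = 𝔼-*ˡ r 0 (λ _ → 0)

  𝔼-const : ∀ r k → 𝔼 q r (λ _ → k) ≡ k * (2 + q) ^ r
  𝔼-const zero    k = sym (*-identityʳ k)
  𝔼-const (suc r) k = trans (cong (λ x → q * x + (x + x)) (𝔼-const r k)) (rearrange q k ((2 + q) ^ r))
    where
    rearrange : ∀ q k x → q * (k * x) + (k * x + k * x) ≡ k * ((2 + q) * x)
    rearrange = solve-∀

  𝔼-∑ : ∀ r {A : Set} (xs : List A) (f : A → Vec Colour r → ℕ) →
        𝔼 q r (λ F → ∑ xs (λ a → f a F)) ≡ ∑ xs (λ a → 𝔼 q r (f a))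
  𝔼-∑ r []       f = 𝔼-zero r
  𝔼-∑ r (x ∷ xs) f = trans (𝔼-+ r (f x) _) (cong (𝔼 q r (f x) +_) (𝔼-∑ r xs f))

  𝔼-∃ : ∀ r {f g : Vec Colour r → ℕ} → 𝔼 q r f < 𝔼 q r g → ∃[ F ] f F < g F
  𝔼-∃ zero            lt = [] , lt
  𝔼-∃ (suc r) {f} {g} lt
    with 𝔼 q r (f ∘ (nothing ∷_)) <? 𝔼 q r (g ∘ (nothing ∷_))
       | 𝔼 q r (f ∘ (just false ∷_)) <? 𝔼 q r (g ∘ (just false ∷_))
       | 𝔼 q r (f ∘ (just true ∷_)) <? 𝔼 q r (g ∘ (just true ∷_))
  ... | yes p | _     | _     = let F , h = 𝔼-∃ r p in _ , h
  ... | no _  | yes p | _     = let F , h = 𝔼-∃ r p in _ , h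
  ... | no _  | no _  | yes p = let F , h = 𝔼-∃ r p in _ , h
  ... | no a  | no b  | no c  = contradiction lt (≤⇒≯
        (+-mono-≤ (*-monoʳ-≤ q (≮⇒≥ a)) (+-mono-≤ (≮⇒≥ b) (≮⇒≥ c))))

  𝔼-split : ∀ r s (h : Vec Colour (suc r) → ℕ) →
            𝔼 q (suc r) h ≡ q * 𝔼 q r (h ∘ (nothing ∷_)) + (𝔼 q r (h ∘ (just s ∷_)) + 𝔼 q r (h ∘ (just (not s) ∷_)))
  𝔼-split r false h = refl
  𝔼-split r true  h = cong (q * 𝔼 q r (h ∘ (nothing ∷_)) +_) (+-comm (𝔼 q r (h ∘ (just false ∷_))) _)

  Q = 2 + q

  only₂ : ∀ {r} → Bool → Bool → Vec Bool r → Vec Bool r → Vec Colour r → ℕ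
  only₂ s s′ b b′ F = ⟦ only s F b ∧ only s′ F b′ ⟧

  only-exact : ∀ {r} → Bool → ℕ → Vec Bool r → Vec Bool r → Vec Colour r → ℕ
  only-exact s t b b′ F = ⟦ only s F b ∧ exact s t F b′ ⟧

  tripled : ∀ r (h : Vec Colour r → ℕ) → q * 𝔼 q r h + (𝔼 q r h + 𝔼 q r h) ≡ Q * 𝔼 q r h
  tripled r h = lemma q (𝔼 q r h)
    where
    lemma : ∀ q x → q * x + (x + x) ≡ (2 + q) * x
    lemma = solve-∀

  vanishing : ∀ r {h : Vec Colour r → ℕ} → (∀ F → h F ≡ 0) → 𝔼 q r h ≡ 0
  vanishing r e = trans (𝔼-cong r e) (𝔼-zero r)

  ∧-false : ∀ {x y} → y ≡ false → ⟦ x ∧ y ⟧ ≡ 0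
  ∧-false {x} refl = cong ⟦_⟧ (Bool.∧-zeroʳ x)

  concentrated : ∀ r s (h : Vec Colour (suc r) → ℕ) (g : Vec Colour r → ℕ) →
                 (∀ F → h (nothing ∷ F) ≡ 0) → (∀ F → h (just s ∷ F) ≡ g F) →
                 (∀ F → h (just (not s) ∷ F) ≡ 0) → 𝔼 q (suc r) h ≡ 𝔼 q r g
  concentrated r s h g e₀ e₁ e₂ = begin
    𝔼 q (suc r) h ≡⟨ 𝔼-split r s h ⟩
    q * 𝔼 q r (h ∘ (nothing ∷_)) + (𝔼 q r (h ∘ (just s ∷_)) + 𝔼 q r (h ∘ (just (not s) ∷_)))
      ≡⟨ cong₂ _+_ (cong (q *_) (vanishing r e₀)) (cong₂ _+_ (𝔼-cong r e₁) (vanishing r e₂)) ⟩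
    q * 0 + (𝔼 q r g + 0) ≡⟨ cong₂ _+_ (*-zeroʳ q) (+-identityʳ _) ⟩
    𝔼 q r g ∎
    where open ≡-Reasoning

  -- Each segment read by one of the two variables is forced to a single colour, of probability 1 /
  -- Q; the other segments are unconstrained.
  𝔼-only₂ : ∀ {r} s s′ {b b′ : Vec Bool r} → Disjoint b b′ →
            𝔼 q r (only₂ s s′ b b′) * Q ^ (count b + count b′) ≡ Q ^ r
  𝔼-only₂ s s′ [] = refl
  𝔼-only₂ {suc r} s s′ {_ ∷ b} {_ ∷ b′} (neither dis) = begin
    𝔼 q (suc r) (only₂ s s′ (false ∷ b) (false ∷ b′)) * Q ^ (count b + count b′)
      ≡⟨ cong (_* Q ^ (count b + count b′)) (tripled r (only₂ s s′ b b′)) ⟩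
    Q * 𝔼 q r (only₂ s s′ b b′) * Q ^ (count b + count b′) ≡⟨ *-assoc Q (𝔼 q r (only₂ s s′ b b′)) (Q ^ (count b + count b′)) ⟩
    Q * (𝔼 q r (only₂ s s′ b b′) * Q ^ (count b + count b′)) ≡⟨ cong (Q *_) (𝔼-only₂ s s′ dis) ⟩
    Q * Q ^ r ∎
    where open ≡-Reasoning
  𝔼-only₂ {suc r} s s′ {_ ∷ b} {_ ∷ b′} (left dis) = begin
    𝔼 q (suc r) (only₂ s s′ (true ∷ b) (false ∷ b′)) * Q ^ suc (count b + count b′)
      ≡⟨ cong (_* Q ^ suc (count b + count b′)) (concentrated r s (only₂ s s′ (true ∷ b) (false ∷ b′)) (only₂ s s′ b b′) (λ _ → refl)
           (λ F → cong (λ z → ⟦ (z ∧ only s F b) ∧ only s′ F b′ ⟧) (same-refl s))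
           (λ F → cong (λ z → ⟦ (z ∧ only s F b) ∧ only s′ F b′ ⟧) (same-not s))) ⟩
    𝔼 q r (only₂ s s′ b b′) * (Q * Q ^ (count b + count b′)) ≡⟨ rearrange (𝔼 q r (only₂ s s′ b b′)) Q _ ⟩
    Q * (𝔼 q r (only₂ s s′ b b′) * Q ^ (count b + count b′)) ≡⟨ cong (Q *_) (𝔼-only₂ s s′ dis) ⟩
    Q * Q ^ r ∎
    where
    open ≡-Reasoning
    rearrange : ∀ a b c → a * (b * c) ≡ b * (a * c)
    rearrange = solve-∀
  𝔼-only₂ {suc r} s s′ {_ ∷ b} {_ ∷ b′} (right dis) = begin
    𝔼 q (suc r) (only₂ s s′ (false ∷ b) (true ∷ b′)) * Q ^ (count b + suc (count b′))
      ≡⟨ cong₂ _*_ (concentrated r s′ (only₂ s s′ (false ∷ b) (true ∷ b′)) (only₂ s s′ b b′) (λ F → ∧-false {only s F b} refl)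
           (λ F → cong (λ z → ⟦ only s F b ∧ (z ∧ only s′ F b′) ⟧) (same-refl s′))
           (λ F → ∧-false {only s F b} (cong (_∧ only s′ F b′) (same-not s′))))
         (cong (Q ^_) (+-suc (count b) (count b′))) ⟩
    𝔼 q r (only₂ s s′ b b′) * (Q * Q ^ (count b + count b′)) ≡⟨ rearrange (𝔼 q r (only₂ s s′ b b′)) Q _ ⟩
    Q * (𝔼 q r (only₂ s s′ b b′) * Q ^ (count b + count b′)) ≡⟨ cong (Q *_) (𝔼-only₂ s s′ dis) ⟩
    Q * Q ^ r ∎
    where
    open ≡-Reasoning
    rearrange : ∀ a b c → a * (b * c) ≡ b * (a * c)
    rearrange = solve-∀

  -- Pascal's rule: the number of ways to place t of t + u colours is at most (1 + t) ^ u.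
  𝔼-only-exact : ∀ {r} s t u {b b′ : Vec Bool r} → Disjoint b b′ → count b′ ≡ t + u →
                 𝔼 q r (only-exact s t b b′) * Q ^ (count b + count b′) ≤ Q ^ r * suc t ^ u
  𝔼-only-exact s zero zero [] refl = ≤-refl
  𝔼-only-exact {suc r} s t u {_ ∷ b} {_ ∷ b′} (neither dis) e = begin
    𝔼 q (suc r) (only-exact s t (false ∷ b) (false ∷ b′)) * Q ^ (count b + count b′)
      ≡⟨ cong (_* Q ^ (count b + count b′)) (tripled r (only-exact s t b b′)) ⟩
    Q * 𝔼 q r (only-exact s t b b′) * Q ^ (count b + count b′) ≡⟨ *-assoc Q (𝔼 q r (only-exact s t b b′)) (Q ^ (count b + count b′)) ⟩
    Q * (𝔼 q r (only-exact s t b b′) * Q ^ (count b + count b′)) ≤⟨ *-monoʳ-≤ Q (𝔼-only-exact s t u dis e) ⟩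
    Q * (Q ^ r * suc t ^ u) ≡⟨ *-assoc Q (Q ^ r) (suc t ^ u) ⟨
    Q * Q ^ r * suc t ^ u ∎
    where open ≤-Reasoning
  𝔼-only-exact {suc r} s t u {_ ∷ b} {_ ∷ b′} (left dis) e = begin
    𝔼 q (suc r) (only-exact s t (true ∷ b) (false ∷ b′)) * Q ^ suc (count b + count b′)
      ≡⟨ cong (_* Q ^ suc (count b + count b′)) (concentrated r s (only-exact s t (true ∷ b) (false ∷ b′)) (only-exact s t b b′) (λ _ → refl)
           (λ F → cong (λ z → ⟦ (z ∧ only s F b) ∧ exact s t F b′ ⟧) (same-refl s))
           (λ F → cong (λ z → ⟦ (z ∧ only s F b) ∧ exact s t F b′ ⟧) (same-not s))) ⟩
    𝔼 q r (only-exact s t b b′) * (Q * Q ^ (count b + count b′)) ≡⟨ rearrange (𝔼 q r (only-exact s t b b′)) Q _ ⟩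
    Q * (𝔼 q r (only-exact s t b b′) * Q ^ (count b + count b′)) ≤⟨ *-monoʳ-≤ Q (𝔼-only-exact s t u dis e) ⟩
    Q * (Q ^ r * suc t ^ u) ≡⟨ *-assoc Q (Q ^ r) (suc t ^ u) ⟨
    Q * Q ^ r * suc t ^ u ∎
    where
    open ≤-Reasoning
    rearrange : ∀ a b c → a * (b * c) ≡ b * (a * c)
    rearrange = solve-∀
  𝔼-only-exact {suc r} s t u {_ ∷ b} {_ ∷ b′} (right dis) e = begin
    𝔼 q (suc r) h * Q ^ (count b + suc (count b′))
      ≡⟨ cong₂ _*_ (𝔼-split r s h) (cong (Q ^_) (+-suc (count b) (count b′))) ⟩
    (q * 𝔼 q r (h ∘ (nothing ∷_)) + (hit + miss)) * (Q * W)
      ≡⟨ cong (λ z → (q * z + (hit + miss)) * (Q * W)) (vanishing r (λ F → ∧-false {only s F b} refl)) ⟩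
    (q * 0 + (hit + miss)) * (Q * W) ≡⟨ rearrange q hit miss Q W ⟩
    Q * (hit * W + miss * W) ≤⟨ *-monoʳ-≤ Q (bound t u e) ⟩
    Q * (Q ^ r * suc t ^ u) ≡⟨ *-assoc Q (Q ^ r) (suc t ^ u) ⟨
    Q * Q ^ r * suc t ^ u ∎
    where
    open ≤-Reasoning
    h = only-exact s t (false ∷ b) (true ∷ b′)
    hit = 𝔼 q r (h ∘ (just s ∷_))
    miss = 𝔼 q r (h ∘ (just (not s) ∷_))
    W = Q ^ (count b + count b′)
    rearrange : ∀ q x y Q W → (q * 0 + (x + y)) * (Q * W) ≡ Q * (x * W + y * W)
    rearrange = solve-∀
    -- In `hits` the segment gets colour s and takes one of the t places; in `misses` it gets
    -- `not s` and takes one of the u others.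
    hits misses : ℕ → ℕ
    hits t = 𝔼 q r (λ F → only-exact s t (false ∷ b) (true ∷ b′) (just s ∷ F))
    misses t = 𝔼 q r (λ F → only-exact s t (false ∷ b) (true ∷ b′) (just (not s) ∷ F))
    hits-zero : hits zero ≡ 0
    hits-zero = vanishing r (λ F → ∧-false {only s F b} (cong (λ z → not z ∧ exact s 0 F b′) (same-refl s)))
    hits-suc : ∀ t → hits (suc t) ≡ 𝔼 q r (only-exact s t b b′)
    hits-suc t = 𝔼-cong r (λ F → cong (λ z → ⟦ only s F b ∧ (if z then exact s t F b′ else exact s (suc t) F b′) ⟧) (same-refl s))
    misses-eq : ∀ t → misses t ≡ 𝔼 q r (only-exact s t b b′)
    misses-eq zero = 𝔼-cong r (λ F → cong (λ z → ⟦ only s F b ∧ (not z ∧ exact s 0 F b′) ⟧) (same-not s))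
    misses-eq (suc t) = 𝔼-cong r (λ F → cong (λ z → ⟦ only s F b ∧ (if z then exact s t F b′ else exact s (suc t) F b′) ⟧) (same-not s))
    exact-zero : ∀ t → count b′ < t → 𝔼 q r (only-exact s t b b′) ≡ 0
    exact-zero t lt = vanishing r (λ F → ∧-false {only s F b} (exact-large s t F b′ lt))
    pascal : ∀ t u → suc t ^ suc u + suc (suc t) ^ u ≤ suc (suc t) ^ suc u
    pascal t u = begin
      suc t * suc t ^ u + suc (suc t) ^ u ≤⟨ +-monoˡ-≤ _ (*-monoʳ-≤ (suc t) (^-monoˡ-≤ u (n≤1+n (suc t)))) ⟩
      suc t * suc (suc t) ^ u + suc (suc t) ^ u ≡⟨ +-comm (suc t * suc (suc t) ^ u) _ ⟩
      suc (suc t) ^ suc u ∎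
    bound : ∀ t u → suc (count b′) ≡ t + u → hits t * W + misses t * W ≤ Q ^ r * suc t ^ u
    bound zero (suc u) e = begin
      hits 0 * W + misses 0 * W ≡⟨ cong₂ (λ x y → x * W + y * W) hits-zero (misses-eq 0) ⟩
      𝔼 q r (only-exact s 0 b b′) * W ≤⟨ 𝔼-only-exact s 0 u dis (suc-injective e) ⟩
      Q ^ r * 1 ^ u ≡⟨ cong (Q ^ r *_) (sym (*-identityˡ (1 ^ u))) ⟩
      Q ^ r * 1 ^ suc u ∎
    bound (suc t) zero e = begin
      hits (suc t) * W + misses (suc t) * W ≡⟨ cong₂ (λ x y → x * W + y * W) (hits-suc t)
        (trans (misses-eq (suc t)) (exact-zero (suc t) (≤-reflexive (trans e (+-identityʳ _))))) ⟩
      𝔼 q r (only-exact s t b b′) * W + 0 ≡⟨ +-identityʳ _ ⟩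
      𝔼 q r (only-exact s t b b′) * W ≤⟨ 𝔼-only-exact s t 0 dis (suc-injective e) ⟩
      Q ^ r * 1 ∎
    bound (suc t) (suc u) e = begin
      hits (suc t) * W + misses (suc t) * W ≡⟨ cong₂ (λ x y → x * W + y * W) (hits-suc t) (misses-eq (suc t)) ⟩
      𝔼 q r (only-exact s t b b′) * W + 𝔼 q r (only-exact s (suc t) b b′) * W
        ≤⟨ +-mono-≤ (𝔼-only-exact s t (suc u) dis (suc-injective e))
                    (𝔼-only-exact s (suc t) u dis (suc-injective (trans e (+-suc (suc t) u)))) ⟩
      Q ^ r * suc t ^ suc u + Q ^ r * suc (suc t) ^ u ≡⟨ *-distribˡ-+ (Q ^ r) _ _ ⟨
      Q ^ r * (suc t ^ suc u + suc (suc t) ^ u) ≤⟨ *-monoʳ-≤ (Q ^ r) (pascal t u) ⟩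
      Q ^ r * suc (suc t) ^ suc u ∎

meets : ∀ {r} → Vec Bool r → Vec Bool r → Bool
meets []      []       = false
meets (x ∷ b) (y ∷ b′) = (x ∧ y) ∨ meets b b′

¬meets⇒disjoint : ∀ {r} (b b′ : Vec Bool r) → meets b b′ ≡ false → Disjoint b b′
¬meets⇒disjoint []          []           _ = []
¬meets⇒disjoint (false ∷ b) (false ∷ b′) e = neither (¬meets⇒disjoint b b′ e)
¬meets⇒disjoint (true  ∷ b) (false ∷ b′) e = left (¬meets⇒disjoint b b′ e)
¬meets⇒disjoint (false ∷ b) (true  ∷ b′) e = right (¬meets⇒disjoint b b′ e)

count≤ : ∀ {r} (b : Vec Bool r) → count b ≤ r
count≤ []          = z≤n
count≤ (true  ∷ b) = s≤s (count≤ b)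
count≤ (false ∷ b) = m≤n⇒m≤1+n (count≤ b)

⟦∧⟧ : ∀ x y → ⟦ x ∧ y ⟧ ≡ ⟦ x ⟧ * ⟦ y ⟧
⟦∧⟧ true  y = sym (+-identityʳ _)
⟦∧⟧ false y = refl

∑-∑-* : ∀ {A B : Set} xs ys (f : A → ℕ) (g : B → ℕ) → ∑ xs f * ∑ ys g ≡ ∑ xs (λ a → ∑ ys (λ b → f a * g b))
∑-∑-* xs ys f g = trans (sym (∑-*ʳ xs f (∑ ys g))) (∑-cong xs (λ a → sym (∑-*ˡ ys (f a) g)))

geometric₁ : ∀ R c Z (f : ℕ → ℕ) → (∀ s → f s * (c * 2 ^ s) ≤ Z) → c * ∑ (allFin R) (f ∘ toℕ) ≤ 2 * Z
geometric₁ zero    c Z f h = ≤-trans (≤-reflexive (*-zeroʳ c)) z≤n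
geometric₁ (suc R) c Z f h = begin
  c * ∑ (allFin (suc R)) (f ∘ toℕ) ≡⟨ cong (c *_) (∑-allFin-suc R (f ∘ toℕ)) ⟩
  c * (f 0 + S) ≡⟨ *-distribˡ-+ c (f 0) S ⟩
  c * f 0 + c * S ≤⟨ +-mono-≤ (≤-trans (≤-reflexive (first c (f 0))) (h 0)) rest ⟩
  Z + Z ≡⟨ cong (Z +_) (sym (+-identityʳ Z)) ⟩
  2 * Z ∎
  where
  open ≤-Reasoning
  S = ∑ (allFin R) (f ∘ suc ∘ toℕ)
  first : ∀ c x → c * x ≡ x * (c * 1)
  first = solve-∀
  double : ∀ c x → c * x + c * x ≡ (c * 2) * x
  double = solve-∀
  shift : ∀ c x y → x * (c * 2 * y) ≡ x * (c * (2 * y))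
  shift = solve-∀
  rest : c * S ≤ Z
  rest = *-cancelˡ-≤ 2 (begin
    2 * (c * S) ≡⟨ trans (sym (*-assoc 2 c S)) (cong (_* S) (*-comm 2 c)) ⟩
    c * 2 * S ≤⟨ geometric₁ R (c * 2) Z (f ∘ suc) (λ s → ≤-trans (≤-reflexive (shift c (f (suc s)) (2 ^ s))) (h (suc s))) ⟩
    2 * Z ∎)

-- The sum of 2 ^ (- ∣ s - t ∣) over all s ≥ 0 is 3 - 2 ^ (- t). The summand Z on the left carries
-- the correction 2 ^ (- t), without which the induction on t would not close.
geometric₂ : ∀ t R Z (f : ℕ → ℕ) → (∀ s → f s * 2 ^ ∣ s - t ∣ ≤ Z) →
             2 ^ t * ∑ (allFin R) (f ∘ toℕ) + Z ≤ 2 ^ t * (3 * Z)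
geometric₂ zero R Z f h = begin
  1 * S + Z ≤⟨ +-monoˡ-≤ Z (geometric₁ R 1 Z f (λ s → ≤-trans (≤-reflexive (trans (cong (f s *_) (*-identityˡ (2 ^ s)))
                  (cong (λ k → f s * 2 ^ k) (sym (∣-∣-identityʳ s))))) (h s))) ⟩
  2 * Z + Z ≡⟨ arith Z ⟩
  1 * (3 * Z) ∎
  where
  open ≤-Reasoning
  S = ∑ (allFin R) (f ∘ toℕ)
  arith : ∀ Z → 2 * Z + Z ≡ 1 * (3 * Z)
  arith = solve-∀
geometric₂ (suc t) zero Z f h = begin
  2 ^ suc t * 0 + Z ≡⟨ cong (_+ Z) (*-zeroʳ (2 ^ suc t)) ⟩
  Z ≤⟨ m≤m+n Z (2 * Z) ⟩
  3 * Z ≤⟨ m≤n*m (3 * Z) (2 ^ suc t) {{m^n≢0 2 (suc t)}} ⟩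
  2 ^ suc t * (3 * Z) ∎
  where open ≤-Reasoning
geometric₂ (suc t) (suc R) Z f h = begin
  2 ^ suc t * ∑ (allFin (suc R)) (f ∘ toℕ) + Z ≡⟨ cong (λ x → 2 ^ suc t * x + Z) (∑-allFin-suc R (f ∘ toℕ)) ⟩
  2 ^ suc t * (f 0 + S) + Z ≡⟨ expand (2 ^ t) (f 0) S Z ⟩
  f 0 * (2 * 2 ^ t) + (2 * (2 ^ t * S) + Z) ≤⟨ +-monoˡ-≤ _ (h 0) ⟩
  Z + (2 * (2 ^ t * S) + Z) ≡⟨ collect (2 ^ t * S) Z ⟩
  2 * (2 ^ t * S + Z) ≤⟨ *-monoʳ-≤ 2 (geometric₂ t R Z (f ∘ suc) (h ∘ suc)) ⟩
  2 * (2 ^ t * (3 * Z)) ≡⟨ sym (*-assoc 2 (2 ^ t) (3 * Z)) ⟩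
  2 ^ suc t * (3 * Z) ∎
  where
  open ≤-Reasoning
  S = ∑ (allFin R) (f ∘ suc ∘ toℕ)
  expand : ∀ w x s z → 2 * w * (x + s) + z ≡ x * (2 * w) + (2 * (w * s) + z)
  expand = solve-∀
  collect : ∀ x z → z + (2 * x + z) ≡ 2 * (x + z)
  collect = solve-∀

two-sided-geometric : ∀ t R Z (f : ℕ → ℕ) → (∀ s → f s * 2 ^ ∣ s - t ∣ ≤ Z) → ∑ (allFin R) (f ∘ toℕ) ≤ 3 * Z
two-sided-geometric t R Z f h =
  *-cancelˡ-≤ (2 ^ t) {{m^n≢0 2 t}} (≤-trans (m≤m+n _ Z) (geometric₂ t R Z f h))

module _ (q Q : ℕ) (Q≡ : Q ≡ 2 + q) where

  Q-nonZero : NonZero Q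
  Q-nonZero = subst NonZero (sym Q≡) _

  𝔼-const′ : ∀ r k → 𝔼 q r (λ _ → k) ≡ k * Q ^ r
  𝔼-const′ r k = subst (λ Q → 𝔼 q r (λ _ → k) ≡ k * Q ^ r) (sym Q≡) (𝔼-const q r k)

  𝔼-only : ∀ {r} s s′ {b b′ : Vec Bool r} → Disjoint b b′ →
           𝔼 q r (λ F → ⟦ only s F b ∧ only s′ F b′ ⟧) * Q ^ (count b + count b′) ≡ Q ^ r
  𝔼-only {r} s s′ {b} {b′} dis = subst
    (λ Q → 𝔼 q r (λ F → ⟦ only s F b ∧ only s′ F b′ ⟧) * Q ^ (count b + count b′) ≡ Q ^ r)
    (sym Q≡) (𝔼-only₂ q s s′ dis)

  𝔼-exact : ∀ {r} s t u {b b′ : Vec Bool r} → Disjoint b b′ → count b′ ≡ t + u →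
            𝔼 q r (λ F → ⟦ only s F b ∧ exact s t F b′ ⟧) * Q ^ (count b + count b′) ≤ Q ^ r * suc t ^ u
  𝔼-exact {r} s t u {b} {b′} dis e = subst
    (λ Q → 𝔼 q r (λ F → ⟦ only s F b ∧ exact s t F b′ ⟧) * Q ^ (count b + count b′) ≤ Q ^ r * suc t ^ u)
    (sym Q≡) (𝔼-only-exact q s t u dis e)

  -- With fewer than t reads `exact` fails, so being exceptional means lying in the core. With t
  -- reads it is impossible. With more, the core event and the `exact` event are simply added, and
  -- the number of placements counted for the second dominates.
  𝔼-exceptional : ∀ {r} s t {b b′ : Vec Bool r} → Disjoint b b′ →
                  𝔼 q r (λ F → ⟦ only s F b ∧ exceptional s t F b′ ⟧) * Q ^ (count b + count b′)
                    ≤ Q ^ r * (2 * suc t ^ ∣ count b′ - t ∣)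
  𝔼-exceptional {r} s t {b} {b′} dis = helper (<-cmp (count b′) t)
    where
    open ≤-Reasoning
    X = 𝔼 q r (λ F → ⟦ only s F b ∧ exceptional s t F b′ ⟧)
    W = Q ^ (count b + count b′)
    xor-≤ : ∀ a x y → ⟦ a ∧ (x xor y) ⟧ ≤ ⟦ a ∧ x ⟧ + ⟦ a ∧ y ⟧
    xor-≤ false x     y     = z≤n
    xor-≤ true  false false = z≤n
    xor-≤ true  false true  = ≤-refl
    xor-≤ true  true  false = ≤-refl
    xor-≤ true  true  true  = z≤n
    1≤pow : ∀ u → 1 ≤ suc t ^ u
    1≤pow u = m^n>0 (suc t) u
    helper : _ → X * W ≤ Q ^ r * (2 * suc t ^ ∣ count b′ - t ∣)
    helper (tri< lt _ _) = begin
      X * W ≡⟨ cong (_* W) (𝔼-cong q r (λ F → cong (λ y → ⟦ only s F b ∧ y ⟧)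
                 (trans (cong (only s F b′ xor_) (exact-large s t F b′ lt)) (Bool.xor-identityʳ (only s F b′))))) ⟩
      𝔼 q r (λ F → ⟦ only s F b ∧ only s F b′ ⟧) * W ≡⟨ 𝔼-only s s dis ⟩
      Q ^ r ≡⟨ sym (*-identityʳ (Q ^ r)) ⟩
      Q ^ r * 1 ≤⟨ *-monoʳ-≤ (Q ^ r) (≤-trans (1≤pow ∣ count b′ - t ∣) (m≤n*m _ 2)) ⟩
      Q ^ r * (2 * suc t ^ ∣ count b′ - t ∣) ∎
    helper (tri≈ _ refl _) = begin
      X * W ≡⟨ cong (_* W) (vanishing q r (λ F → ∧-false q {only s F b}
                 (trans (cong (only s F b′ xor_) (exact-count s F b′)) (Bool.xor-same (only s F b′))))) ⟩
      0 ≤⟨ z≤n ⟩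
      Q ^ r * (2 * suc t ^ ∣ count b′ - t ∣) ∎
    helper (tri> _ _ gt) = begin
      X * W ≤⟨ *-monoˡ-≤ W (𝔼-mono q r (λ F → xor-≤ (only s F b) (only s F b′) (exact s t F b′))) ⟩
      𝔼 q r (λ F → ⟦ only s F b ∧ only s F b′ ⟧ + ⟦ only s F b ∧ exact s t F b′ ⟧) * W
        ≡⟨ trans (cong (_* W) (𝔼-+ q r _ _)) (*-distribʳ-+ W (𝔼 q r (λ F → ⟦ only s F b ∧ only s F b′ ⟧)) _) ⟩
      𝔼 q r (λ F → ⟦ only s F b ∧ only s F b′ ⟧) * W + 𝔼 q r (λ F → ⟦ only s F b ∧ exact s t F b′ ⟧) * W
        ≤⟨ +-mono-≤ (≤-reflexive (𝔼-only s s dis)) (𝔼-exact s t (count b′ ∸ t) dis (sym (m+[n∸m]≡n (<⇒≤ gt)))) ⟩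
      Q ^ r + Q ^ r * suc t ^ (count b′ ∸ t) ≡⟨ cong (λ k → Q ^ r + Q ^ r * suc t ^ k) (sym (trans (∣-∣-comm (count b′) t) (m≤n⇒∣m-n∣≡n∸m (<⇒≤ gt)))) ⟩
      Q ^ r + Q ^ r * P ≤⟨ +-monoˡ-≤ (Q ^ r * P) (m≤m*n (Q ^ r) P {{m^n≢0 (suc t) ∣ count b′ - t ∣}}) ⟩
      Q ^ r * P + Q ^ r * P ≡⟨ double (Q ^ r) P ⟩
      Q ^ r * (2 * P) ∎
      where
      P = suc t ^ ∣ count b′ - t ∣
      double : ∀ x y → x * y + x * y ≡ x * (2 * y)
      double = solve-∀

  𝔼-exceptional₀ : ∀ {r} s (b b′ : Vec Bool r) → 𝔼 q r (λ F → ⟦ only s F b ∧ exceptional s (count b′) F b′ ⟧) ≡ 0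
  𝔼-exceptional₀ {r} s b b′ = vanishing q r (λ F → ∧-false q {only s F b}
    (trans (cong (only s F b′ xor_) (exact-count s F b′)) (Bool.xor-same (only s F b′))))

-- Choosing a colouring by second moments

number : ∀ {n} → (Fin n → ℕ) → ℕ → ℕ
number {n} size s = ∑ (allFin n) (λ i → 𝟙 (size i ≟ s))

∑-by-size : ∀ {n} (size f : Fin n → ℕ) R → (∀ i → size i ≤ R) →
            ∑ (allFin n) f ≤ ∑ (allFin (suc R)) (λ s → ∑ (allFin n) (λ i → 𝟙 (size i ≟ toℕ s) * f i))
∑-by-size {n} size f R size≤R = begin
  ∑ (allFin n) f
    ≤⟨ ∑-mono (allFin n) (λ i → ≤-trans (≤-reflexive (sym (trans (cong (_* f i) (𝟙-yes (size i ≟ _) (sym (Fin.toℕ-fromℕ< (s≤s (size≤R i)))))) (+-identityʳ _))))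
                                        (∈⇒≤∑ (λ s → 𝟙 (size i ≟ toℕ s) * f i) (∈-allFin (fromℕ< (s≤s (size≤R i)))))) ⟩
  ∑ (allFin n) (λ i → ∑ (allFin (suc R)) (λ s → 𝟙 (size i ≟ toℕ s) * f i))
    ≡⟨ ∑-swap (allFin n) (allFin (suc R)) (λ i s → 𝟙 (size i ≟ toℕ s) * f i) ⟩
  ∑ (allFin (suc R)) (λ s → ∑ (allFin n) (λ i → 𝟙 (size i ≟ toℕ s) * f i)) ∎
  where open ≤-Reasoning

intersections : ∀ {n r} → (Fin n → Vec Bool r) → ℕ
intersections {n} col = ∑ (allFin n) (λ i → ∑ (allFin n) (λ j → ⟦ meets (col i) (col j) ⟧))

-- In real terms G ≤ L + I ≤ R₁ + R₂ + J ≤ G / 2 + 3 J ≤ 3 G / 4.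
averaging : ∀ L R₁ R₂ G I J → G ≤ L + I → 8 * R₁ ≤ 2 * G + 8 * J → 8 * R₂ ≤ 2 * G + 8 * J →
            I ≤ J → 12 * J ≤ G → L ≤ R₁ + R₂ → G ≤ 0
averaging L R₁ R₂ G I J hL h₁ h₂ hI hJ bad = *-cancelˡ-≤ 2 (+-cancelˡ-≤ (6 * G) (2 * G) (2 * 0) (begin
  6 * G + 2 * G ≡⟨ l₁ G ⟩
  8 * G ≤⟨ *-monoʳ-≤ 8 (≤-trans hL (+-mono-≤ bad hI)) ⟩
  8 * (R₁ + R₂ + J) ≡⟨ l₂ R₁ R₂ J ⟩
  8 * R₁ + 8 * R₂ + 8 * J ≤⟨ +-monoˡ-≤ (8 * J) (+-mono-≤ h₁ h₂) ⟩
  (2 * G + 8 * J) + (2 * G + 8 * J) + 8 * J ≡⟨ l₃ G J ⟩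
  4 * G + 2 * (12 * J) ≤⟨ +-monoʳ-≤ (4 * G) (*-monoʳ-≤ 2 hJ) ⟩
  4 * G + 2 * G ≡⟨ l₄ G ⟩
  6 * G + 2 * 0 ∎))
  where
  open ≤-Reasoning
  l₁ : ∀ G → 6 * G + 2 * G ≡ 8 * G
  l₁ = solve-∀
  l₂ : ∀ a b d → 8 * (a + b + d) ≡ 8 * a + 8 * b + 8 * d
  l₂ = solve-∀
  l₃ : ∀ G J → (2 * G + 8 * J) + (2 * G + 8 * J) + 8 * J ≡ 4 * G + 2 * (12 * J)
  l₃ = solve-∀
  l₄ : ∀ G → 4 * G + 2 * G ≡ 6 * G + 2 * 0
  l₄ = solve-∀

-- One averaged inequality yields two: with a and b the sizes of the cores and x, y the required
-- sizes, each core exceeds the requirement set by the other colour.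
cancel-< : ∀ a b x y → a * x + b * y < a * b → x < b × y < a
cancel-< a b x y lt =
  *-cancelˡ-< a x b (≤-<-trans (m≤m+n (a * x) (b * y)) lt) ,
  *-cancelˡ-< b y a (≤-<-trans (m≤n+m (b * y) (a * x)) (<-≤-trans lt (≤-reflexive (*-comm a b))))

-- `few-intersections` makes dependent pairs negligible, `dominant` makes exceptional variables
-- rare, and `m₀-small` makes m₀ at most an eighth of M / Q ^ t, the expected number of core
-- variables that are read t times.
module Choice {n r : ℕ} (col : Fin n → Vec Bool r) (q Q : ℕ) (Q≡ : Q ≡ 2 + q) (t B w m₀ : ℕ)
  (w>0 : 1 ≤ w)
  (B-large : suc t * (96 * w) ≤ B)
  (dominant : ∀ s → number (count ∘ col) s * (Q ^ t * B ^ ∣ s - t ∣) ≤ number (count ∘ col) t * Q ^ s)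
  (few-intersections : 12 * w * (intersections col * (Q ^ t * Q ^ t)) ≤ number (count ∘ col) t * number (count ∘ col) t)
  (m₀-small : 8 * (m₀ * Q ^ t) ≤ number (count ∘ col) t)
  (nonempty : 1 ≤ number (count ∘ col) t)
  where

  open ≤-Reasoning

  N : ℕ → ℕ
  N = number (count ∘ col)

  M I QQ : ℕ
  M = N t
  I = intersections col
  QQ = Q ^ t * Q ^ t

  -- 96 = 8 · 12: `row-bound` loses a factor 12, and the averaging leaves an eighth of the main term
  -- for the exceptional variables of each colour.
  Λ : ℕ
  Λ = 96 * w

  instance
    Q≢0 : NonZero Q
    Q≢0 = Q-nonZero q Q Q≡

  sized : Fin n → ℕ
  sized i = 𝟙 (count (col i) ≟ t)

  ζ : Bool → Vec Colour r → ℕ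
  ζ s F = ∑ (allFin n) (λ i → sized i * ⟦ only s F (col i) ⟧)

  ξ : Bool → Vec Colour r → ℕ
  ξ s F = ∑ (allFin n) (λ i → ⟦ exceptional s t F (col i) ⟧)

  𝔼-product : ∀ (f g : Fin n → Vec Colour r → Bool) (c : Fin n → Fin n → ℕ) (h : Vec Colour r → ℕ) →
              (∀ F → h F ≡ ∑ (allFin n) (λ i → ∑ (allFin n) (λ j → c i j * ⟦ f i F ∧ g j F ⟧))) →
              𝔼 q r h ≡ ∑ (allFin n) (λ i → ∑ (allFin n) (λ j → c i j * 𝔼 q r (λ F → ⟦ f i F ∧ g j F ⟧)))
  𝔼-product f g c h e = trans (𝔼-cong q r e) (trans (𝔼-∑ q r (allFin n) _)
    (∑-cong (allFin n) (λ i → trans (𝔼-∑ q r (allFin n) _) (∑-cong (allFin n) (λ j → 𝔼-*ˡ q r (c i j) _)))))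

  -- A pair of variables without a common segment contributes Q ^ r / Q ^ (2 t) exactly; a pair
  -- sharing a segment is written off.
  𝔼-ζ-ζ : Q ^ r * (M * M) ≤ 𝔼 q r (λ F → ζ true F * ζ false F) * QQ + Q ^ r * I
  𝔼-ζ-ζ = begin
    Q ^ r * (M * M)
      ≡⟨ trans (cong (Q ^ r *_) (∑-∑-* (allFin n) (allFin n) sized sized)) (sym (∑∑-*ˡ (Q ^ r) (λ i j → sized i * sized j))) ⟩
    ∑∑ (λ i j → Q ^ r * (sized i * sized j)) ≤⟨ ∑-mono (allFin n) (λ i → ∑-mono (allFin n) (λ j → pointwise i j)) ⟩
    ∑∑ (λ i j → sized i * sized j * X i j * QQ + Q ^ r * ⟦ meets (col i) (col j) ⟧)
      ≡⟨ trans (∑-cong (allFin n) (λ i → ∑-+ (allFin n) _ _)) (∑-+ (allFin n) _ _) ⟩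
    ∑∑ (λ i j → sized i * sized j * X i j * QQ) + ∑∑ (λ i j → Q ^ r * ⟦ meets (col i) (col j) ⟧)
      ≡⟨ cong₂ _+_ (trans (∑-cong (allFin n) (λ i → ∑-*ʳ (allFin n) _ QQ)) (∑-*ʳ (allFin n) _ QQ))
                   (∑∑-*ˡ (Q ^ r) (λ i j → ⟦ meets (col i) (col j) ⟧)) ⟩
    ∑∑ (λ i j → sized i * sized j * X i j) * QQ + Q ^ r * I
      ≡⟨ cong (λ x → x * QQ + Q ^ r * I) (sym (𝔼-product (λ i F → only true F (col i)) (λ j F → only false F (col j)) (λ i j → sized i * sized j) (λ F → ζ true F * ζ false F) expand)) ⟩
    𝔼 q r (λ F → ζ true F * ζ false F) * QQ + Q ^ r * I ∎
    where
    ∑∑ : (Fin n → Fin n → ℕ) → ℕ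
    ∑∑ f = ∑ (allFin n) (λ i → ∑ (allFin n) (f i))
    ∑∑-*ˡ : ∀ k f → ∑∑ (λ i j → k * f i j) ≡ k * ∑∑ f
    ∑∑-*ˡ k f = trans (∑-cong (allFin n) (λ i → ∑-*ˡ (allFin n) k (f i))) (∑-*ˡ (allFin n) k _)
    X : Fin n → Fin n → ℕ
    X i j = 𝔼 q r (λ F → ⟦ only true F (col i) ∧ only false F (col j) ⟧)
    regroup : ∀ a b c d → a * b * (c * d) ≡ a * c * (b * d)
    regroup = solve-∀
    expand : ∀ F → ζ true F * ζ false F ≡ ∑∑ (λ i j → sized i * sized j * ⟦ only true F (col i) ∧ only false F (col j) ⟧)
    expand F = trans (∑-∑-* (allFin n) (allFin n) _ _) (∑-cong (allFin n) (λ i → ∑-cong (allFin n) (λ j →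
      trans (regroup (sized i) _ (sized j) _) (cong (sized i * sized j *_) (sym (⟦∧⟧ (only true F (col i)) (only false F (col j))))))))
    zero-case : ∀ {y} → Q ^ r * 0 ≤ y
    zero-case = ≤-trans (≤-reflexive (*-zeroʳ (Q ^ r))) z≤n
    pointwise : ∀ i j → Q ^ r * (sized i * sized j) ≤ sized i * sized j * X i j * QQ + Q ^ r * ⟦ meets (col i) (col j) ⟧
    pointwise i j with count (col i) ≟ t | count (col j) ≟ t | meets (col i) (col j) in e
    ... | no _  | _     | _ = zero-case
    ... | yes _ | no _  | _ = zero-case
    ... | yes _ | yes _ | true  = m≤n+m (Q ^ r * 1) (1 * X i j * QQ)
    ... | yes p | yes p′ | false = begin
      Q ^ r * 1 ≡⟨ *-identityʳ (Q ^ r) ⟩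
      Q ^ r ≡⟨ sym (𝔼-only q Q Q≡ true false (¬meets⇒disjoint (col i) (col j) e)) ⟩
      X i j * Q ^ (count (col i) + count (col j)) ≡⟨ cong (X i j *_) (trans (cong₂ (λ a b → Q ^ (a + b)) p p′) (^-distribˡ-+-* Q t t)) ⟩
      X i j * QQ ≡⟨ cong (_* QQ) (sym (+-identityʳ (X i j))) ⟩
      1 * X i j * QQ ≤⟨ m≤m+n _ _ ⟩
      1 * X i j * QQ + Q ^ r * 0 ∎

  𝔼-ζ : ∀ s → 𝔼 q r (ζ s) * Q ^ t ≡ Q ^ r * M
  𝔼-ζ s = trans (cong (_* Q ^ t) (trans (𝔼-∑ q r (allFin n) _) (∑-cong (allFin n) (λ i → 𝔼-*ˡ q r (sized i) _))))
    (trans (sym (∑-*ʳ (allFin n) _ (Q ^ t))) (trans (∑-cong (allFin n) pointwise) (∑-*ˡ (allFin n) (Q ^ r) sized)))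
    where
    -- A partner that is read nowhere lets the formula for two variables give the probability for
    -- one.
    disjoint-none : ∀ {r} (b : Vec Bool r) → Σ[ b′ ∈ Vec Bool r ] Disjoint b b′ × count b′ ≡ 0 × (∀ F → only s F b′ ≡ true)
    disjoint-none []          = [] , [] , refl , λ { [] → refl }
    disjoint-none (true ∷ b)  = let b′ , d , c , o = disjoint-none b in false ∷ b′ , left d , c , λ { (_ ∷ F) → o F }
    disjoint-none (false ∷ b) = let b′ , d , c , o = disjoint-none b in false ∷ b′ , neither d , c , λ { (_ ∷ F) → o F }
    ∧-true : ∀ x {y} → y ≡ true → ⟦ x ⟧ ≡ ⟦ x ∧ y ⟧
    ∧-true true  refl = refl
    ∧-true false refl = refl
    pointwise : ∀ i → sized i * 𝔼 q r (λ F → ⟦ only s F (col i) ⟧) * Q ^ t ≡ Q ^ r * sized i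
    pointwise i with count (col i) ≟ t
    ... | no _  = sym (*-zeroʳ (Q ^ r))
    ... | yes p = let b′ , d , c , o = disjoint-none (col i) in begin-equality
      (𝔼 q r (λ F → ⟦ only s F (col i) ⟧) + 0) * Q ^ t
        ≡⟨ cong₂ _*_ (trans (+-identityʳ _) (𝔼-cong q r (λ F → ∧-true (only s F (col i)) (o F))))
             (cong (Q ^_) (trans (sym p) (trans (sym (+-identityʳ _)) (cong (count (col i) +_) (sym c))))) ⟩
      𝔼 q r (λ F → ⟦ only s F (col i) ∧ only s F b′ ⟧) * Q ^ (count (col i) + count b′) ≡⟨ 𝔼-only q Q Q≡ s s d ⟩
      Q ^ r ≡⟨ sym (*-identityʳ (Q ^ r)) ⟩
      Q ^ r * 1 ∎

  E : Bool → Fin n → Fin n → ℕ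
  E s i j = 𝔼 q r (λ F → ⟦ only s F (col i) ∧ exceptional s t F (col j) ⟧)

  -- Dependent pairs are removed from `E` here; `E≤D` accounts for them with probability one.
  D : Bool → Fin n → Fin n → ℕ
  D s i j = if meets (col i) (col j) then 0 else E s i j * QQ

  E≤D : ∀ s i j → E s i j * QQ ≤ D s i j + Q ^ r * QQ * ⟦ meets (col i) (col j) ⟧
  E≤D s i j with meets (col i) (col j)
  ... | false = m≤m+n _ _
  ... | true  = begin
    E s i j * QQ ≤⟨ *-monoˡ-≤ QQ (𝔼-mono q r (λ F → ⟦⟧≤1 (only s F (col i) ∧ exceptional s t F (col j)))) ⟩
    𝔼 q r (λ _ → 1) * QQ ≡⟨ cong (_* QQ) (trans (𝔼-const′ q Q Q≡ r 1) (*-identityˡ (Q ^ r))) ⟩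
    Q ^ r * QQ ≡⟨ sym (*-identityʳ (Q ^ r * QQ)) ⟩
    Q ^ r * QQ * 1 ∎

  D-bound : ∀ s i j → count (col i) ≡ t → D s i j * Q ^ count (col j) ≤ Q ^ r * Q ^ t * (2 * suc t ^ ∣ count (col j) - t ∣)
  D-bound s i j refl with meets (col i) (col j) in e
  ... | true  = z≤n
  ... | false = begin
    E s i j * (Q ^ t * Q ^ t) * Q ^ c ≡⟨ regroup (E s i j) (Q ^ t) (Q ^ c) ⟩
    E s i j * (Q ^ t * Q ^ c) * Q ^ t ≡⟨ cong (λ x → E s i j * x * Q ^ t) (sym (^-distribˡ-+-* Q t c)) ⟩
    E s i j * Q ^ (t + c) * Q ^ t ≤⟨ *-monoˡ-≤ (Q ^ t) (𝔼-exceptional q Q Q≡ s t (¬meets⇒disjoint (col i) (col j) e)) ⟩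
    Q ^ r * (2 * suc t ^ ∣ c - t ∣) * Q ^ t ≡⟨ swap₂₃ (Q ^ r) _ (Q ^ t) ⟩
    Q ^ r * Q ^ t * (2 * suc t ^ ∣ c - t ∣) ∎
    where
    c = count (col j)
    regroup : ∀ a b c → a * (b * b) * c ≡ a * (b * c) * b
    regroup = solve-∀
    swap₂₃ : ∀ a b c → a * b * c ≡ a * c * b
    swap₂₃ = solve-∀

  D-zero : ∀ s i j → count (col j) ≡ t → D s i j ≡ 0
  D-zero s i j refl with meets (col i) (col j)
  ... | true  = refl
  ... | false = cong (_* QQ) (𝔼-exceptional₀ q Q Q≡ s (col i) (col j))

  Y : Bool → Fin n → ℕ → ℕ
  Y s i c = ∑ (allFin n) (λ j → 𝟙 (count (col j) ≟ c) * D s i j)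

  -- `dominant` gains a factor B per unit of distance from t. Of this, 1 + t pays for the placements
  -- counted in `𝔼-exceptional`, and Λ is left over.
  Y-bound : ∀ s i c → count (col i) ≡ t → Y s i c * Λ ^ ∣ c - t ∣ ≤ 2 * (Q ^ r * M)
  Y-bound s i c e = *-cancelʳ-≤ _ _ (suc t ^ δ * Q ^ c) {{m*n≢0 (suc t ^ δ) (Q ^ c) {{m^n≢0 (suc t) δ}} {{m^n≢0 Q c}}}} (begin
    Y s i c * Λ ^ δ * (suc t ^ δ * Q ^ c) ≡⟨ regroup₁ (Y s i c) (Λ ^ δ) (suc t ^ δ) (Q ^ c) ⟩
    Y s i c * Q ^ c * (suc t ^ δ * Λ ^ δ) ≤⟨ *-mono-≤ weighted (≤-trans (≤-reflexive (sym (^-distribʳ-* δ (suc t) Λ))) (^-monoˡ-≤ δ B-large)) ⟩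
    N c * (Q ^ r * Q ^ t * P) * B ^ δ ≡⟨ regroup₂ (N c) (Q ^ r) (Q ^ t) P (B ^ δ) ⟩
    N c * (Q ^ t * B ^ δ) * (Q ^ r * P) ≤⟨ *-monoˡ-≤ (Q ^ r * P) (dominant c) ⟩
    M * Q ^ c * (Q ^ r * P) ≡⟨ regroup₃ M (Q ^ c) (Q ^ r) (suc t ^ δ) ⟩
    2 * (Q ^ r * M) * (suc t ^ δ * Q ^ c) ∎)
    where
    δ = ∣ c - t ∣
    P = 2 * suc t ^ δ
    regroup₁ : ∀ a b c d → a * b * (c * d) ≡ a * d * (c * b)
    regroup₁ = solve-∀
    regroup₂ : ∀ a b c d e → a * (b * c * d) * e ≡ a * (c * e) * (b * d)
    regroup₂ = solve-∀
    regroup₃ : ∀ a b c d → a * b * (c * (2 * d)) ≡ 2 * (c * a) * (d * b)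
    regroup₃ = solve-∀
    pointwise : ∀ j → 𝟙 (count (col j) ≟ c) * D s i j * Q ^ c ≤ 𝟙 (count (col j) ≟ c) * (Q ^ r * Q ^ t * P)
    pointwise j with count (col j) ≟ c
    ... | no _     = z≤n
    ... | yes refl = begin
      (D s i j + 0) * Q ^ c ≡⟨ cong (_* Q ^ c) (+-identityʳ (D s i j)) ⟩
      D s i j * Q ^ c ≤⟨ D-bound s i j e ⟩
      Q ^ r * Q ^ t * P ≡⟨ sym (+-identityʳ _) ⟩
      1 * (Q ^ r * Q ^ t * P) ∎
    weighted : Y s i c * Q ^ c ≤ N c * (Q ^ r * Q ^ t * P)
    weighted = begin
      Y s i c * Q ^ c ≡⟨ sym (∑-*ʳ (allFin n) _ (Q ^ c)) ⟩
      ∑ (allFin n) (λ j → 𝟙 (count (col j) ≟ c) * D s i j * Q ^ c) ≤⟨ ∑-mono (allFin n) pointwise ⟩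
      ∑ (allFin n) (λ j → 𝟙 (count (col j) ≟ c) * (Q ^ r * Q ^ t * P)) ≡⟨ ∑-*ʳ (allFin n) _ _ ⟩
      N c * (Q ^ r * Q ^ t * P) ∎

  -- Variables read exactly t times are never exceptional, so one factor Λ can be taken out and the
  -- remaining ones weakened to 2.
  Y-geometric : ∀ s i c → count (col i) ≡ t → Λ * Y s i c * 2 ^ ∣ c - t ∣ ≤ 4 * (Q ^ r * M)
  Y-geometric s i c e with c ≟ t
  ... | yes refl = ≤-trans (≤-reflexive (cong (_* 2 ^ ∣ t - t ∣) (trans (cong (Λ *_) vanish) (*-zeroʳ Λ)))) z≤n
    where
    pointwise : ∀ j → 𝟙 (count (col j) ≟ t) * D s i j ≡ 0
    pointwise j with count (col j) ≟ t
    ... | no _  = refl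
    ... | yes p = cong (_+ 0) (D-zero s i j p)
    vanish : Y s i t ≡ 0
    vanish = trans (∑-cong (allFin n) pointwise) (∑-zero (allFin n))
  ... | no c≢t = begin
    Λ * Y s i c * 2 ^ δ ≡⟨ regroup Λ (Y s i c) (2 ^ δ) ⟩
    Y s i c * (Λ * 2 ^ δ) ≤⟨ *-monoʳ-≤ (Y s i c) (power δ (λ z → c≢t (∣m-n∣≡0⇒m≡n z))) ⟩
    Y s i c * (2 * Λ ^ δ) ≡⟨ regroup′ (Y s i c) (Λ ^ δ) ⟩
    2 * (Y s i c * Λ ^ δ) ≤⟨ *-monoʳ-≤ 2 (Y-bound s i c e) ⟩
    2 * (2 * (Q ^ r * M)) ≡⟨ sym (*-assoc 2 2 (Q ^ r * M)) ⟩
    4 * (Q ^ r * M) ∎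
    where
    δ = ∣ c - t ∣
    regroup : ∀ a b c → a * b * c ≡ b * (a * c)
    regroup = solve-∀
    regroup′ : ∀ a b → a * (2 * b) ≡ 2 * (a * b)
    regroup′ = solve-∀
    2≤Λ : 2 ≤ Λ
    2≤Λ = ≤-trans (s≤s (s≤s z≤n)) (*-monoʳ-≤ 96 w>0)
    power : ∀ δ → δ ≢ 0 → Λ * 2 ^ δ ≤ 2 * Λ ^ δ
    power zero    δ≢0 = contradiction refl δ≢0
    power (suc δ) _   = begin
      Λ * (2 * 2 ^ δ) ≤⟨ *-monoʳ-≤ Λ (*-monoʳ-≤ 2 (^-monoˡ-≤ δ 2≤Λ)) ⟩
      Λ * (2 * Λ ^ δ) ≡⟨ regroup′ Λ (Λ ^ δ) ⟩
      2 * (Λ * Λ ^ δ) ∎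

  row-bound : ∀ s i → count (col i) ≡ t → Λ * ∑ (allFin n) (D s i) ≤ 12 * (Q ^ r * M)
  row-bound s i e = begin
    Λ * ∑ (allFin n) (D s i) ≤⟨ *-monoʳ-≤ Λ (∑-by-size (count ∘ col) (D s i) r (count≤ ∘ col)) ⟩
    Λ * ∑ (allFin (suc r)) (Y s i ∘ toℕ) ≡⟨ sym (∑-*ˡ (allFin (suc r)) Λ _) ⟩
    ∑ (allFin (suc r)) (λ c → Λ * Y s i (toℕ c)) ≤⟨ two-sided-geometric t (suc r) _ (λ c → Λ * Y s i c) (λ c → Y-geometric s i c e) ⟩
    3 * (4 * (Q ^ r * M)) ≡⟨ sym (*-assoc 3 4 (Q ^ r * M)) ⟩
    12 * (Q ^ r * M) ∎

  𝔼-ζ-ξ : ∀ s → Λ * (𝔼 q r (λ F → ζ s F * ξ s F) * QQ) ≤ 12 * (Q ^ r * (M * M)) + Λ * (Q ^ r * QQ * I)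
  𝔼-ζ-ξ s = begin
    Λ * (𝔼 q r (λ F → ζ s F * ξ s F) * QQ)
      ≡⟨ cong (λ x → Λ * (x * QQ)) (𝔼-product (λ i F → only s F (col i)) (λ j F → exceptional s t F (col j)) (λ i _ → sized i) (λ F → ζ s F * ξ s F) expand) ⟩
    Λ * (∑∑ (λ i j → sized i * E s i j) * QQ)
      ≡⟨ cong (Λ *_) (trans (sym (∑-*ʳ (allFin n) _ QQ)) (∑-cong (allFin n) (λ i → sym (∑-*ʳ (allFin n) _ QQ)))) ⟩
    Λ * ∑∑ (λ i j → sized i * E s i j * QQ) ≤⟨ *-monoʳ-≤ Λ (∑-mono (allFin n) (λ i → ∑-mono (allFin n) (λ j → pointwise i j))) ⟩
    Λ * ∑∑ (λ i j → sized i * D s i j + Q ^ r * QQ * ⟦ meets (col i) (col j) ⟧)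
      ≡⟨ cong (Λ *_) (trans (∑-cong (allFin n) (λ i → ∑-+ (allFin n) _ _)) (∑-+ (allFin n) _ _)) ⟩
    Λ * (∑∑ (λ i j → sized i * D s i j) + ∑∑ (λ i j → Q ^ r * QQ * ⟦ meets (col i) (col j) ⟧))
      ≡⟨ cong (λ x → Λ * (∑∑ (λ i j → sized i * D s i j) + x)) (trans (∑-cong (allFin n) (λ i → ∑-*ˡ (allFin n) (Q ^ r * QQ) _)) (∑-*ˡ (allFin n) (Q ^ r * QQ) _)) ⟩
    Λ * (∑∑ (λ i j → sized i * D s i j) + Q ^ r * QQ * I)
      ≡⟨ *-distribˡ-+ Λ _ _ ⟩
    Λ * ∑∑ (λ i j → sized i * D s i j) + Λ * (Q ^ r * QQ * I)
      ≤⟨ +-monoˡ-≤ _ main ⟩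
    12 * (Q ^ r * (M * M)) + Λ * (Q ^ r * QQ * I) ∎
    where
    ∑∑ : (Fin n → Fin n → ℕ) → ℕ
    ∑∑ f = ∑ (allFin n) (λ i → ∑ (allFin n) (f i))
    expand : ∀ F → ζ s F * ξ s F ≡ ∑∑ (λ i j → sized i * ⟦ only s F (col i) ∧ exceptional s t F (col j) ⟧)
    expand F = trans (∑-∑-* (allFin n) (allFin n) _ _) (∑-cong (allFin n) (λ i → ∑-cong (allFin n) (λ j →
      trans (*-assoc (sized i) _ _) (cong (sized i *_) (sym (⟦∧⟧ (only s F (col i)) (exceptional s t F (col j))))))))
    pointwise : ∀ i j → sized i * E s i j * QQ ≤ sized i * D s i j + Q ^ r * QQ * ⟦ meets (col i) (col j) ⟧
    pointwise i j with count (col i) ≟ t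
    ... | no _  = z≤n
    ... | yes _ = begin
      (E s i j + 0) * QQ ≡⟨ cong (_* QQ) (+-identityʳ (E s i j)) ⟩
      E s i j * QQ ≤⟨ E≤D s i j ⟩
      D s i j + Q ^ r * QQ * ⟦ meets (col i) (col j) ⟧ ≡⟨ cong (_+ Q ^ r * QQ * ⟦ meets (col i) (col j) ⟧) (sym (+-identityʳ (D s i j))) ⟩
      D s i j + 0 + Q ^ r * QQ * ⟦ meets (col i) (col j) ⟧ ∎
    row : ∀ i → Λ * ∑ (allFin n) (λ j → sized i * D s i j) ≤ sized i * (12 * (Q ^ r * M))
    row i with count (col i) ≟ t
    ... | no _  = ≤-reflexive (trans (cong (Λ *_) (∑-zero (allFin n))) (*-zeroʳ Λ))
    ... | yes p = begin
      Λ * ∑ (allFin n) (λ j → D s i j + 0) ≡⟨ cong (Λ *_) (∑-cong (allFin n) (λ j → +-identityʳ (D s i j))) ⟩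
      Λ * ∑ (allFin n) (D s i) ≤⟨ row-bound s i p ⟩
      12 * (Q ^ r * M) ≡⟨ sym (+-identityʳ _) ⟩
      1 * (12 * (Q ^ r * M)) ∎
    main : Λ * ∑∑ (λ i j → sized i * D s i j) ≤ 12 * (Q ^ r * (M * M))
    main = begin
      Λ * ∑∑ (λ i j → sized i * D s i j) ≡⟨ sym (∑-*ˡ (allFin n) Λ _) ⟩
      ∑ (allFin n) (λ i → Λ * ∑ (allFin n) (λ j → sized i * D s i j)) ≤⟨ ∑-mono (allFin n) row ⟩
      ∑ (allFin n) (λ i → sized i * (12 * (Q ^ r * M))) ≡⟨ ∑-*ʳ (allFin n) sized _ ⟩
      M * (12 * (Q ^ r * M)) ≡⟨ regroup M (Q ^ r) ⟩
      12 * (Q ^ r * (M * M)) ∎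
      where
      regroup : ∀ a b → a * (12 * (b * a)) ≡ 12 * (b * (a * a))
      regroup = solve-∀

  cost : Bool → Vec Colour r → ℕ
  cost s F = ζ s F * (m₀ + w * ξ s F)

  𝔼-cost : ∀ s → 8 * (𝔼 q r (cost s) * QQ) ≤ 2 * (Q ^ r * (M * M)) + 8 * (w * (Q ^ r * QQ * I))
  𝔼-cost s = begin
    8 * (𝔼 q r (cost s) * QQ) ≡⟨ cong (λ x → 8 * (x * QQ)) (trans (𝔼-cong q r (λ F → split (ζ s F) m₀ w (ξ s F)))
        (trans (𝔼-+ q r _ _) (cong₂ _+_ (𝔼-*ˡ q r m₀ (ζ s)) (𝔼-*ˡ q r w (λ F → ζ s F * ξ s F))))) ⟩
    8 * ((m₀ * 𝔼 q r (ζ s) + w * X) * QQ) ≡⟨ regroup m₀ (𝔼 q r (ζ s)) w X (Q ^ t) ⟩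
    8 * (m₀ * Q ^ t) * (𝔼 q r (ζ s) * Q ^ t) + 8 * w * (X * QQ) ≤⟨ +-mono-≤ first second ⟩
    Q ^ r * (M * M) + (Q ^ r * (M * M) + 8 * (w * (Q ^ r * QQ * I))) ≡⟨ collect (Q ^ r * (M * M)) _ ⟩
    2 * (Q ^ r * (M * M)) + 8 * (w * (Q ^ r * QQ * I)) ∎
    where
    X = 𝔼 q r (λ F → ζ s F * ξ s F)
    split : ∀ z m w e → z * (m + w * e) ≡ m * z + w * (z * e)
    split = solve-∀
    regroup : ∀ m z w x p → 8 * ((m * z + w * x) * (p * p)) ≡ 8 * (m * p) * (z * p) + 8 * w * (x * (p * p))
    regroup = solve-∀
    collect : ∀ a b → a + (a + b) ≡ 2 * a + b
    collect = solve-∀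
    first : 8 * (m₀ * Q ^ t) * (𝔼 q r (ζ s) * Q ^ t) ≤ Q ^ r * (M * M)
    first = begin
      8 * (m₀ * Q ^ t) * (𝔼 q r (ζ s) * Q ^ t) ≤⟨ *-mono-≤ m₀-small (≤-reflexive (𝔼-ζ s)) ⟩
      M * (Q ^ r * M) ≡⟨ comm₁ M (Q ^ r) ⟩
      Q ^ r * (M * M) ∎
      where
      comm₁ : ∀ a b → a * (b * a) ≡ b * (a * a)
      comm₁ = solve-∀
    second : 8 * w * (X * QQ) ≤ Q ^ r * (M * M) + 8 * (w * (Q ^ r * QQ * I))
    second = *-cancelˡ-≤ 12 (begin
      12 * (8 * w * (X * QQ)) ≡⟨ l w (X * QQ) ⟩
      Λ * (X * QQ) ≤⟨ 𝔼-ζ-ξ s ⟩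
      12 * (Q ^ r * (M * M)) + Λ * (Q ^ r * QQ * I) ≡⟨ l′ (Q ^ r * (M * M)) w (Q ^ r * QQ * I) ⟩
      12 * (Q ^ r * (M * M) + 8 * (w * (Q ^ r * QQ * I))) ∎)
      where
      l : ∀ w x → 12 * (8 * w * x) ≡ 96 * w * x
      l = solve-∀
      l′ : ∀ a w x → 12 * a + 96 * w * x ≡ 12 * (a + 8 * (w * x))
      l′ = solve-∀

  average : 𝔼 q r (λ F → cost true F + cost false F) < 𝔼 q r (λ F → ζ true F * ζ false F)
  average = ≰⇒> λ bad → contradiction (impossible bad) (<⇒≱ G>0)
    where
    L R G J : ℕ
    L = 𝔼 q r (λ F → ζ true F * ζ false F)
    R = 𝔼 q r (λ F → cost true F + cost false F)
    G = Q ^ r * (M * M)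
    J = w * (Q ^ r * QQ * I)
    G>0 : 0 < G
    G>0 = *-mono-≤ (m^n>0 Q r) (*-mono-≤ nonempty nonempty)
    12J≤G : 12 * J ≤ G
    12J≤G = begin
      12 * (w * (Q ^ r * QQ * I)) ≡⟨ l w (Q ^ r) QQ I ⟩
      Q ^ r * (12 * w * (I * QQ)) ≤⟨ *-monoʳ-≤ (Q ^ r) few-intersections ⟩
      G ∎
      where
      l : ∀ w x y z → 12 * (w * (x * y * z)) ≡ x * (12 * w * (z * y))
      l = solve-∀
    QI≤J : Q ^ r * I ≤ J
    QI≤J = begin
      Q ^ r * I ≡⟨ l (Q ^ r) I ⟩
      1 * (Q ^ r * 1 * I) ≤⟨ *-mono-≤ w>0 (*-monoˡ-≤ I (*-monoʳ-≤ (Q ^ r) (*-mono-≤ (m^n>0 Q t) (m^n>0 Q t)))) ⟩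
      J ∎
      where
      l : ∀ a b → a * b ≡ 1 * (a * 1 * b)
      l = solve-∀
    impossible : L ≤ R → G ≤ 0
    impossible bad = averaging (L * QQ) (𝔼 q r (cost true) * QQ) (𝔼 q r (cost false) * QQ) G (Q ^ r * I) J
      𝔼-ζ-ζ (𝔼-cost true) (𝔼-cost false) QI≤J 12J≤G
      (≤-trans (*-monoˡ-≤ QQ bad) (≤-reflexive (trans (cong (_* QQ) (𝔼-+ q r (cost true) (cost false))) (*-distribʳ-+ QQ (𝔼 q r (cost true)) _))))

  ζ≤ : ∀ s F → ζ s F ≤ ∑ (allFin n) (λ i → ⟦ only s F (col i) ⟧)
  ζ≤ s F = ∑-mono (allFin n) (λ i → ≤-trans (*-monoˡ-≤ ⟦ only s F (col i) ⟧ (𝟙≤1 (count (col i) ≟ t))) (≤-reflexive (+-identityʳ _)))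

  choice : ∃[ F ] ∀ s → m₀ + w * ξ s F ≤ ∑ (allFin n) (λ i → ⟦ only (not s) F (col i) ⟧)
  choice = F , λ
    { true  → ≤-trans (<⇒≤ (proj₁ both)) (ζ≤ false F)
    ; false → ≤-trans (<⇒≤ (proj₂ both)) (ζ≤ true F) }
    where
    F = proj₁ (𝔼-∃ q r average)
    both = cancel-< (ζ true F) (ζ false F) (m₀ + w * ξ true F) (m₀ + w * ξ false F) (proj₂ (𝔼-∃ q r average))

-- The peak of the read counts

maximum : ∀ R (f : ℕ → ℕ) → ∃[ t ] t ≤ R × (∀ s → s ≤ R → f s ≤ f t)
maximum zero    f = 0 , z≤n , λ { zero _ → ≤-refl }
maximum (suc R) f with maximum R f
... | t , t≤R , max with f t ≤? f (suc R)
...   | yes le = suc R , ≤-refl , λ s s≤ → case s (m≤n⇒m<n∨m≡n s≤)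
  where
  case : ∀ s → s < suc R ⊎ s ≡ suc R → f s ≤ f (suc R)
  case s (inj₁ (s≤s s≤R)) = ≤-trans (max s s≤R) le
  case s (inj₂ refl)      = ≤-refl
...   | no  gt = t , m≤n⇒m≤1+n t≤R , λ s s≤ → case s (m≤n⇒m<n∨m≡n s≤)
  where
  case : ∀ s → s < suc R ⊎ s ≡ suc R → f s ≤ f t
  case s (inj₁ (s≤s s≤R)) = max s s≤R
  case s (inj₂ refl)      = <⇒≤ (≰⇒> gt)

∑-allFin-const : ∀ n k → ∑ (allFin n) (λ _ → k) ≡ n * k
∑-allFin-const n k = trans (∑-const (allFin n) k) (cong (_* k) (List.length-tabulate {n = n} id))

-- In Level below, size i is the number of segments reading variable i, and
-- dominates p t says that s ↦ number size s * B ^ (- p s) is maximal at t.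

module Level {n r : ℕ} (size : Fin n → ℕ) (K B : ℕ) (size>0 : ∀ i → 1 ≤ size i) (size≤r : ∀ i → size i ≤ r)
  (average : ∑ (allFin n) size ≤ K * n) (K>0 : 1 ≤ K) (n>0 : 1 ≤ n) (B-large : 2 * (2 * K + 1) ≤ B) where

  open ≤-Reasoning

  N : ℕ → ℕ
  N = number size

  instance
    B≢0 : NonZero B
    B≢0 = >-nonZero (≤-trans (≤-trans (s≤s z≤n) (≤-reflexive (l K))) B-large)
      where
      l : ∀ K → suc (1 + 4 * K) ≡ 2 * (2 * K + 1)
      l = solve-∀

  dominates : ℕ → ℕ → Set
  dominates p t = ∀ s → N s * B ^ (p * t) ≤ N t * B ^ (p * s)

  N-large : ∀ s → r < s → N s ≡ 0
  N-large s r<s = trans (∑-cong (allFin n) (λ i → 𝟙-no (size i ≟ s) (λ e → <⇒≱ r<s (≤-trans (≤-reflexive (sym e)) (size≤r i))))) (∑-zero (allFin n))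

  N≤n : ∀ s → N s ≤ n
  N≤n s = ≤-trans (∑-mono (allFin n) (λ i → 𝟙≤1 (size i ≟ s))) (≤-reflexive (trans (∑-allFin-const n 1) (*-identityʳ n)))

  -- The weights N s / B ^ (p s) are multiplied by B ^ (p r) to avoid division; beyond r all of them
  -- vanish.
  dominator : ∀ p → ∃[ t ] dominates p t
  dominator p with maximum r (λ s → N s * B ^ (p * (r ∸ s)))
  ... | t , t≤r , max = t , dominated
    where
    power : ∀ {a b} → a ≤ r → B ^ (p * (r ∸ a)) * B ^ (p * (a + b)) ≡ B ^ (p * r) * B ^ (p * b)
    power {a} {b} a≤r = trans (sym (^-distribˡ-+-* B (p * (r ∸ a)) _)) (trans (cong (B ^_)
      (trans (sym (*-distribˡ-+ p (r ∸ a) (a + b))) (trans (cong (p *_) (trans (sym (+-assoc (r ∸ a) a b)) (cong (_+ b) (m∸n+n≡m a≤r)))) (*-distribˡ-+ p r b))))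
      (^-distribˡ-+-* B (p * r) _))
    dominated : dominates p t
    dominated s with s ≤? r
    ... | no  s≰r = ≤-trans (≤-reflexive (cong (_* B ^ (p * t)) (N-large s (≰⇒> s≰r)))) z≤n
    ... | yes s≤r = *-cancelˡ-≤ (B ^ (p * r)) {{m^n≢0 B (p * r)}} (begin
      B ^ (p * r) * (N s * B ^ (p * t)) ≡⟨ swap₁₂ (B ^ (p * r)) (N s) _ ⟩
      N s * (B ^ (p * r) * B ^ (p * t)) ≡⟨ cong (N s *_) (sym (power {s} {t} s≤r)) ⟩
      N s * (B ^ (p * (r ∸ s)) * B ^ (p * (s + t))) ≡⟨ sym (*-assoc (N s) _ _) ⟩
      N s * B ^ (p * (r ∸ s)) * B ^ (p * (s + t)) ≤⟨ *-monoˡ-≤ (B ^ (p * (s + t))) (max s s≤r) ⟩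
      N t * B ^ (p * (r ∸ t)) * B ^ (p * (s + t)) ≡⟨ *-assoc (N t) _ _ ⟩
      N t * (B ^ (p * (r ∸ t)) * B ^ (p * (s + t))) ≡⟨ cong (λ k → N t * (B ^ (p * (r ∸ t)) * B ^ (p * k))) (+-comm s t) ⟩
      N t * (B ^ (p * (r ∸ t)) * B ^ (p * (t + s))) ≡⟨ cong (N t *_) (power {t} {s} t≤r) ⟩
      N t * (B ^ (p * r) * B ^ (p * s)) ≡⟨ swap₁₂ (N t) (B ^ (p * r)) _ ⟩
      B ^ (p * r) * (N t * B ^ (p * s)) ∎)
      where
      swap₁₂ : ∀ a b c → a * (b * c) ≡ b * (a * c)
      swap₁₂ = solve-∀

  few : ℕ
  few = ∑ (allFin n) (λ i → 𝟙 (size i ≤? 2 * K))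

  -- Markov's inequality for the number of reads, whose mean is at most K.
  n≤2few : n ≤ 2 * few
  n≤2few = *-cancelˡ-≤ K {{>-nonZero K>0}} (+-cancelʳ-≤ (K * n) _ _ (begin
    K * n + K * n ≡⟨ trans (l K n) (sym (∑-allFin-const n (2 * K + 0))) ⟩
    ∑ (allFin n) (λ _ → 2 * K + 0) ≤⟨ ∑-mono (allFin n) pointwise ⟩
    ∑ (allFin n) (λ i → 2 * K * 𝟙 (size i ≤? 2 * K) + size i) ≡⟨ trans (∑-+ (allFin n) _ size) (cong (_+ ∑ (allFin n) size) (∑-*ˡ (allFin n) (2 * K) _)) ⟩
    2 * K * few + ∑ (allFin n) size ≤⟨ +-mono-≤ (≤-reflexive (l′ K few)) average ⟩
    K * (2 * few) + K * n ∎))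
    where
    l : ∀ K n → K * n + K * n ≡ n * (2 * K + 0)
    l = solve-∀
    l′ : ∀ K n → 2 * K * n ≡ K * (2 * n)
    l′ = solve-∀
    pointwise : ∀ i → 2 * K + 0 ≤ 2 * K * 𝟙 (size i ≤? 2 * K) + size i
    pointwise i with size i ≤? 2 * K
    ... | yes _ = +-mono-≤ (≤-reflexive (sym (*-identityʳ (2 * K)))) z≤n
    ... | no gt = ≤-trans (≤-reflexive (+-identityʳ (2 * K))) (≤-trans (<⇒≤ (≰⇒> gt)) (m≤n+m (size i) (2 * K * 0)))

  few≤ : few ≤ ∑ (allFin (suc (2 * K))) (N ∘ toℕ)
  few≤ = ≤-trans (∑-mono (allFin n) pointwise) (≤-reflexive (∑-swap (allFin n) (allFin (suc (2 * K))) (λ i s → 𝟙 (size i ≟ toℕ s))))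
    where
    pointwise : ∀ i → 𝟙 (size i ≤? 2 * K) ≤ ∑ (allFin (suc (2 * K))) (λ s → 𝟙 (size i ≟ toℕ s))
    pointwise i with size i ≤? 2 * K
    ... | no  _  = z≤n
    ... | yes le = ≤-trans (≤-reflexive (sym (𝟙-yes (size i ≟ _) (sym (Fin.toℕ-fromℕ< (s≤s le))))))
                           (∈⇒≤∑ (λ s → 𝟙 (size i ≟ toℕ s)) (∈-allFin (fromℕ< (s≤s le))))

  -- At least half of the variables lie in the 2 K + 1 classes with s ≤ 2 K, and the dominating
  -- class is compared with each of these. The loss 2 (2 K + 1) is absorbed by one factor B.
  dominator-large : ∀ p t → dominates p t → n * B ^ (p * t) ≤ N t * B ^ suc (p * (2 * K))
  dominator-large p t dom = begin
    n * B ^ (p * t) ≤⟨ *-monoˡ-≤ (B ^ (p * t)) (≤-trans n≤2few (*-monoʳ-≤ 2 few≤)) ⟩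
    2 * ∑ (allFin (suc (2 * K))) (N ∘ toℕ) * B ^ (p * t) ≡⟨ *-assoc 2 (∑ (allFin (suc (2 * K))) (N ∘ toℕ)) (B ^ (p * t)) ⟩
    2 * (∑ (allFin (suc (2 * K))) (N ∘ toℕ) * B ^ (p * t)) ≡⟨ cong (2 *_) (sym (∑-*ʳ (allFin (suc (2 * K))) (N ∘ toℕ) (B ^ (p * t)))) ⟩
    2 * ∑ (allFin (suc (2 * K))) (λ s → N (toℕ s) * B ^ (p * t))
      ≤⟨ *-monoʳ-≤ 2 (∑-mono (allFin (suc (2 * K))) (λ s → ≤-trans (dom (toℕ s))
           (*-monoʳ-≤ (N t) (^-monoʳ-≤ B (*-monoʳ-≤ p (Fin.toℕ≤pred[n] s)))))) ⟩
    2 * ∑ (allFin (suc (2 * K))) (λ s → N t * B ^ (p * (2 * K))) ≡⟨ cong (2 *_) (∑-allFin-const (suc (2 * K)) (N t * B ^ (p * (2 * K)))) ⟩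
    2 * (suc (2 * K) * (N t * B ^ (p * (2 * K)))) ≡⟨ l K (N t) _ ⟩
    2 * (2 * K + 1) * (N t * B ^ (p * (2 * K))) ≤⟨ *-monoˡ-≤ (N t * B ^ (p * (2 * K))) B-large ⟩
    B * (N t * B ^ (p * (2 * K))) ≡⟨ l′ B (N t) _ ⟩
    N t * (B * B ^ (p * (2 * K))) ∎
    where
    l : ∀ K a b → 2 * (suc (2 * K) * (a * b)) ≡ 2 * (2 * K + 1) * (a * b)
    l = solve-∀
    l′ : ∀ a b c → a * (b * c) ≡ b * (a * c)
    l′ = solve-∀

  dominator-positive : ∀ p t → dominates p t → 1 ≤ N t
  dominator-positive p t dom with N t | dominator-large p t dom
  ... | zero  | le = contradiction (≤-trans (*-mono-≤ n>0 (m^n>0 B (p * t))) le) λ ()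
  ... | suc _ | _  = s≤s z≤n

  dominator>0 : ∀ p t → dominates p t → 1 ≤ t
  dominator>0 p (suc t) dom = s≤s z≤n
  dominator>0 p zero    dom = contradiction (subst (1 ≤_) N₀ (dominator-positive p 0 dom)) λ ()
    where
    N₀ : N 0 ≡ 0
    N₀ = trans (∑-cong (allFin n) (λ i → 𝟙-no (size i ≟ 0) (λ e → contradiction (subst (1 ≤_) e (size>0 i)) λ ()))) (∑-zero (allFin n))

  2≤B : 2 ≤ B
  2≤B = ≤-trans (≤-trans (m≤m+n 2 (4 * K)) (≤-reflexive (l K))) B-large
    where
    l : ∀ K → 2 + 4 * K ≡ 2 * (2 * K + 1)
    l = solve-∀

  first-dominator : ∀ t → dominates 1 t → t ≤ suc (2 * K)
  first-dominator t dom = ≮⇒≥ λ gt → <⇒≱ (^-monoʳ-< B 2≤B gt) (*-cancelˡ-≤ n {{>-nonZero n>0}} (begin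
    n * B ^ t ≡⟨ cong (λ k → n * B ^ k) (sym (*-identityˡ t)) ⟩
    n * B ^ (1 * t) ≤⟨ dominator-large 1 t dom ⟩
    N t * B ^ suc (1 * (2 * K)) ≤⟨ *-monoˡ-≤ _ (N≤n t) ⟩
    n * B ^ suc (1 * (2 * K)) ≡⟨ cong (λ k → n * B ^ suc k) (*-identityˡ (2 * K)) ⟩
    n * B ^ suc (2 * K) ∎))

  -- Dominators move down as p grows. If the dominator t′ at 2 + p is not below t, its inequality
  -- against s, chained with that of t against t′ at p, shows that t dominates at 2 + p as well.
  stays : ∀ p t t′ → dominates p t → dominates (2 + p) t′ → t ≤ t′ → dominates (2 + p) t
  stays p t t′ dom dom′ t≤t′ s = *-cancelʳ-≤ _ _ (B ^ (p * t′)) {{m^n≢0 B (p * t′)}} (begin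
    N s * B ^ ((2 + p) * t) * B ^ (p * t′) ≡⟨ trans (*-assoc (N s) _ _) (cong (N s *_) (sym (^-distribˡ-+-* B ((2 + p) * t) (p * t′)))) ⟩
    N s * B ^ ((2 + p) * t + p * t′) ≤⟨ *-monoʳ-≤ (N s) (^-monoʳ-≤ B exponent) ⟩
    N s * B ^ ((2 + p) * t′ + p * t) ≡⟨ trans (cong (N s *_) (^-distribˡ-+-* B ((2 + p) * t′) (p * t))) (sym (*-assoc (N s) _ _)) ⟩
    N s * B ^ ((2 + p) * t′) * B ^ (p * t) ≤⟨ *-monoˡ-≤ (B ^ (p * t)) (dom′ s) ⟩
    N t′ * B ^ ((2 + p) * s) * B ^ (p * t) ≡⟨ swap₂₃ (N t′) _ _ ⟩
    N t′ * B ^ (p * t) * B ^ ((2 + p) * s) ≤⟨ *-monoˡ-≤ (B ^ ((2 + p) * s)) (dom t′) ⟩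
    N t * B ^ (p * t′) * B ^ ((2 + p) * s) ≡⟨ swap₂₃ (N t) _ _ ⟩
    N t * B ^ ((2 + p) * s) * B ^ (p * t′) ∎)
    where
    swap₂₃ : ∀ a b c → a * b * c ≡ a * c * b
    swap₂₃ = solve-∀
    l₁ : ∀ p t u → (2 + p) * t + p * u ≡ 2 * t + (p * t + p * u)
    l₁ = solve-∀
    l₂ : ∀ p t u → 2 * u + (p * t + p * u) ≡ (2 + p) * u + p * t
    l₂ = solve-∀
    exponent : (2 + p) * t + p * t′ ≤ (2 + p) * t′ + p * t
    exponent = begin
      (2 + p) * t + p * t′ ≡⟨ l₁ p t t′ ⟩
      2 * t + (p * t + p * t′) ≤⟨ +-monoˡ-≤ _ (*-monoʳ-≤ 2 t≤t′) ⟩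
      2 * t′ + (p * t + p * t′) ≡⟨ l₂ p t t′ ⟩
      (2 + p) * t′ + p * t ∎

  -- The potential is p + 2 t: raising p by 2 either keeps t or lowers it by at least 1, and t stays
  -- positive because every variable is read.
  descend : ∀ fuel X p t → t ≤ fuel → dominates p t → p + 2 * t ≤ X →
            ∃[ p ] ∃[ t ] dominates p t × dominates (2 + p) t × p + 2 * t ≤ X
  descend zero X p t t≤0 dom le = contradiction (≤-trans (dominator>0 p t dom) t≤0) λ ()
  descend (suc fuel) X p t t≤ dom le with dominator (2 + p)
  ... | t′ , dom′ with t ≤? t′
  ...   | yes t≤t′ = p , t , dom , stays p t t′ dom dom′ t≤t′ , le
  ...   | no  t≰t′ = descend fuel X (2 + p) t′ (≤-pred (≤-trans (≰⇒> t≰t′) t≤)) dom′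
          (≤-trans (≤-trans (≤-reflexive (l p t′)) (+-monoʳ-≤ p (*-monoʳ-≤ 2 (≰⇒> t≰t′)))) le)
    where
    l : ∀ p t → 2 + p + 2 * t ≡ p + 2 * suc t
    l = solve-∀

  -- Q = B ^ (1 + p) lies between the two levels: domination at 2 + p gives the decay for s below t,
  -- domination at p the decay for s above t. This is why p advances in steps of two.
  strongly-dominates : ∀ p t → dominates p t → dominates (2 + p) t → let Q = B ^ suc p in
                       ∀ s → N s * (Q ^ t * B ^ ∣ s - t ∣) ≤ N t * Q ^ s
  strongly-dominates p t dom dom′ s =
    subst₂ (λ x y → N s * (x * B ^ ∣ s - t ∣) ≤ N t * y) (sym (^-*-assoc B (suc p) t)) (sym (^-*-assoc B (suc p) s)) main
    where
    P = suc p
    lower : ∀ u → t ≡ s + u → N s * (B ^ (P * t) * B ^ u) ≤ N t * B ^ (P * s)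
    lower u e = *-cancelʳ-≤ _ _ (B ^ s) {{m^n≢0 B s}} (begin
      N s * (B ^ (P * t) * B ^ u) * B ^ s ≡⟨ l (N s) (B ^ (P * t)) (B ^ u) (B ^ s) ⟩
      N s * (B ^ (P * t) * (B ^ s * B ^ u)) ≡⟨ cong (λ x → N s * (B ^ (P * t) * x)) (trans (sym (^-distribˡ-+-* B s u)) (cong (B ^_) (sym e))) ⟩
      N s * (B ^ (P * t) * B ^ t) ≡⟨ cong (N s *_) (trans (sym (^-distribˡ-+-* B (P * t) t)) (cong (B ^_) (+-comm (P * t) t))) ⟩
      N s * B ^ ((2 + p) * t) ≤⟨ dom′ s ⟩
      N t * B ^ ((2 + p) * s) ≡⟨ cong (N t *_) (trans (^-distribˡ-+-* B s (P * s)) (*-comm (B ^ s) _)) ⟩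
      N t * (B ^ (P * s) * B ^ s) ≡⟨ sym (*-assoc (N t) _ _) ⟩
      N t * B ^ (P * s) * B ^ s ∎)
      where
      l : ∀ a b c d → a * (b * c) * d ≡ a * (b * (d * c))
      l = solve-∀
    upper : ∀ u → s ≡ t + u → N s * (B ^ (P * t) * B ^ u) ≤ N t * B ^ (P * s)
    upper u e = begin
      N s * (B ^ (t + p * t) * B ^ u) ≡⟨ cong (λ x → N s * (x * B ^ u)) (^-distribˡ-+-* B t (p * t)) ⟩
      N s * (B ^ t * B ^ (p * t) * B ^ u) ≡⟨ l (N s) (B ^ t) (B ^ (p * t)) (B ^ u) ⟩
      N s * B ^ (p * t) * (B ^ t * B ^ u) ≤⟨ *-mono-≤ (dom s) (≤-reflexive (trans (sym (^-distribˡ-+-* B t u)) (cong (B ^_) (sym e)))) ⟩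
      N t * B ^ (p * s) * B ^ s ≡⟨ *-assoc (N t) _ _ ⟩
      N t * (B ^ (p * s) * B ^ s) ≡⟨ cong (N t *_) (trans (*-comm (B ^ (p * s)) _) (sym (^-distribˡ-+-* B s (p * s)))) ⟩
      N t * B ^ (P * s) ∎
      where
      l : ∀ a b c d → a * (b * c * d) ≡ a * c * (b * d)
      l = solve-∀
    main : N s * (B ^ (P * t) * B ^ ∣ s - t ∣) ≤ N t * B ^ (P * s)
    main with ≤-total s t
    ... | inj₁ s≤t = lower ∣ s - t ∣ (sym (trans (cong (s +_) (m≤n⇒∣m-n∣≡n∸m s≤t)) (m+[n∸m]≡n s≤t)))
    ... | inj₂ t≤s = upper ∣ s - t ∣ (sym (trans (cong (t +_) (trans (∣-∣-comm s t) (m≤n⇒∣m-n∣≡n∸m t≤s))) (m+[n∸m]≡n t≤s)))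

  level : ∃[ p ] ∃[ t ] (1 ≤ t) × (p + 2 * t ≤ 4 * K + 3) ×
          (let Q = B ^ suc p in ∀ s → N s * (Q ^ t * B ^ ∣ s - t ∣) ≤ N t * Q ^ s) ×
          (n * B ^ (p * t) ≤ N t * B ^ suc (p * (2 * K))) × (1 ≤ N t)
  level =
    let t₁ , dom₁ = dominator 1
        p , t , dom , dom′ , le = descend t₁ (4 * K + 3) 1 t₁ ≤-refl dom₁
          (≤-trans (+-monoʳ-≤ 1 (*-monoʳ-≤ 2 (first-dominator t₁ dom₁))) (≤-reflexive (l K)))
    in p , t , dominator>0 p t dom , le , strongly-dominates p t dom dom′ , dominator-large p t dom , dominator-positive p t dom
    where
    l : ∀ K → 1 + 2 * suc (2 * K) ≡ 4 * K + 3
    l = solve-∀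

-- Counting inputs in subcubes

∑-zero⊎positive : ∀ {A : Set} (xs : List A) (f : A → ℕ) → ∑ xs f ≡ 0 ⊎ ∃[ a ] 1 ≤ f a
∑-zero⊎positive []       f = inj₁ refl
∑-zero⊎positive (x ∷ xs) f with f x in e
... | zero  = ∑-zero⊎positive xs f
... | suc _ = inj₂ (x , subst (1 ≤_) (sym e) (s≤s z≤n))

∑-bound : ∀ {A : Set} (xs : List A) (f : A → ℕ) k → (∀ a → 1 ≤ f a → ∑ xs f ≤ k) → ∑ xs f ≤ k
∑-bound xs f k h = [ (λ e → ≤-trans (≤-reflexive e) z≤n) , (λ (a , p) → h a p) ]′ (∑-zero⊎positive xs f)

∏≥1 : ∀ {n} (f : Fin n → ℕ) → 1 ≤ ∏ f → ∀ i → 1 ≤ f i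
∏≥1 {suc n} f h zero with f zero
... | zero  = h
... | suc _ = s≤s z≤n
∏≥1 {suc n} f h (suc i) with f zero | ∏≥1 (f ∘ suc)
... | zero  | _   = contradiction h λ ()
... | suc k | ih with ∏ (f ∘ suc)
...   | suc _ = ih (s≤s z≤n) i
...   | zero  = contradiction (subst (1 ≤_) (*-zeroʳ k) h) λ ()

1≤𝟙 : ∀ {P : Set} (P? : Dec P) → 1 ≤ 𝟙 P? → P
1≤𝟙 (yes p) _ = p

∏≤1 : ∀ {n} (f : Fin n → ℕ) → (∀ i → f i ≤ 1) → ∏ f ≤ 1
∏≤1 {n} f h = ≤-trans (∏-mono h) (≤-reflexive (trans (∏-const n 1) (^-zeroˡ n)))

-- free x partitions the vectors into subcubes; each subcube meets G in a set
-- all of whose free coordinates lie in a quarter of the alphabet.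

module Blocks {A : Set} (_≟_ : (a b : A) → Dec (a ≡ b)) (xs : List A) (unique : Unique xs) (complete : ∀ a → a ∈ xs)
  {n : ℕ} (free : Vec A n → Fin n → Bool)
  (stable : ∀ x y → (∀ i → free x i ≡ false → lookup x i ≡ lookup y i) → ∀ i → free y i ≡ free x i)
  (G : Vec A n → Set) (G? : ∀ x → Dec (G x)) (Z : Vec A n → A → Set) (Z? : ∀ x a → Dec (Z x a)) (m : ℕ)
  (G⇒Z : ∀ x y → G y → (∀ i → free x i ≡ false → lookup x i ≡ lookup y i) → ∀ i → free x i ≡ true → Z x (lookup y i))
  (Z-small : ∀ x y → G y → (∀ i → free x i ≡ false → lookup x i ≡ lookup y i) → 4 * ∑ xs (λ a → 𝟙 (Z? x a)) ≤ length xs)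
  (G-free : ∀ y → G y → m ≤ ∑ (allFin n) (λ i → ⟦ free y i ⟧))
  (nonempty : 1 ≤ length xs)
  where

  open ≤-Reasoning

  N : ℕ
  N = length xs

  Agree : Vec A n → Vec A n → Set
  Agree x y = ∀ i → free x i ≡ false → lookup x i ≡ lookup y i

  Agree-sym : ∀ {x y} → Agree x y → Agree y x
  Agree-sym {x} {y} h i e = sym (h i (trans (sym (stable x y h i)) e))

  agreement : Vec A n → Fin n → A → ℕ
  agreement x i a = if free x i then 1 else 𝟙 (lookup x i ≟ a)

  R : Vec A n → Vec A n → ℕ
  R x y = ∏ (λ i → agreement x i (lookup y i))

  R⇒Agree : ∀ x y → 1 ≤ R x y → Agree x y
  R⇒Agree x y h i e = 1≤𝟙 (lookup x i ≟ lookup y i)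
    (subst (λ b → 1 ≤ (if b then 1 else 𝟙 (lookup x i ≟ lookup y i))) e (∏≥1 _ h i))

  R≤1 : ∀ x y → R x y ≤ 1
  R≤1 x y = ∏≤1 _ λ i → agreement≤1 (free x i) i
    where
    agreement≤1 : ∀ b i → (if b then 1 else 𝟙 (lookup x i ≟ lookup y i)) ≤ 1
    agreement≤1 true  i = ≤-refl
    agreement≤1 false i = 𝟙≤1 (lookup x i ≟ lookup y i)

  inside outside : Vec A n → ℕ
  inside x  = ∏ (λ i → if free x i then N else 1)
  outside x = ∏ (λ i → if free x i then 1 else N)

  outside*inside : ∀ x → outside x * inside x ≡ N ^ n
  outside*inside x = trans (sym (∏-* (λ i → if free x i then 1 else N) (λ i → if free x i then N else 1))) (trans (∏-cong λ i → pointwise (free x i)) (∏-const n N))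
    where
    pointwise : ∀ b → (if b then 1 else N) * (if b then N else 1) ≡ N
    pointwise true  = +-identityʳ N
    pointwise false = *-identityʳ N

  inside≤ : ∀ y → inside y ≤ ∑ (vecs xs n) (R y)
  inside≤ y = ≤-trans (∏-mono λ i → pointwise (free y i) i) (≤-reflexive (sym (∑-vecs-∏ xs n (agreement y))))
    where
    pointwise : ∀ b i → (if b then N else 1) ≤ ∑ xs (λ a → if b then 1 else 𝟙 (lookup y i ≟ a))
    pointwise true  i = ≤-reflexive (sym (trans (∑-const xs 1) (*-identityʳ N)))
    pointwise false i = ≤-trans (≤-reflexive (sym (𝟙-yes (lookup y i ≟ lookup y i) refl)))
                                (∈⇒≤∑ (λ a → 𝟙 (lookup y i ≟ a)) (complete (lookup y i)))

  -- A double count that needs no representatives of the subcubes: y ranges over G and x over the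
  -- subcube of y. Since `outside y` times the size of this subcube is N ^ n, each y in G has total
  -- weight at least 4 ^ m N ^ n, whatever the number of its free coordinates.
  term : Vec A n → Vec A n → ℕ
  term x y = 𝟙 (G? y) * 4 ^ m * outside y * R y x

  module _ (x y : Vec A n) (g : G y) (agree : Agree x y) where

    z : ℕ
    z = ∑ xs (λ a → 𝟙 (Z? x a))

    cell : Fin n → A → ℕ
    cell i a = if free x i then 𝟙 (Z? x a) else 𝟙 (a ≟ lookup x i)

    term≤ : ∀ y′ → term x y′ ≤ 4 ^ m * outside x * ∏ (λ i → cell i (lookup y′ i))
    term≤ y′ with G? y′ | R y′ x in e | R⇒Agree y′ x | R≤1 y′ x
    ... | no _   | _     | _ | _ = z≤n
    ... | yes _  | zero  | _ | _ = ≤-trans (≤-reflexive (*-zeroʳ (1 * 4 ^ m * outside y′))) z≤n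
    ... | yes g′ | suc k | toAgree | le = *-mono-≤ (*-mono-≤ (≤-reflexive (+-identityʳ (4 ^ m))) (≤-reflexive outside-eq))
        (≤-trans le (≤-reflexive (sym (∏-one _ λ i → pointwise (free x i) i refl))))
      where
      agree′ : Agree x y′
      agree′ = Agree-sym (toAgree (s≤s z≤n))
      outside-eq : outside y′ ≡ outside x
      outside-eq = ∏-cong λ i → cong (λ b → if b then 1 else N) (stable x y′ agree′ i)
      pointwise : ∀ b i → free x i ≡ b → (if b then 𝟙 (Z? x (lookup y′ i)) else 𝟙 (lookup y′ i ≟ lookup x i)) ≡ 1
      pointwise true  i e = 𝟙-yes (Z? x (lookup y′ i)) (G⇒Z x y′ g′ agree′ i e)
      pointwise false i e = 𝟙-yes (lookup y′ i ≟ lookup x i) (sym (agree′ i e))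

    4^m≤ : 4 ^ m ≤ ∏ (λ i → if free x i then 4 else 1)
    4^m≤ = ≤-trans (^-monoʳ-≤ 4 (≤-trans (G-free y g) (≤-reflexive (∑-cong (allFin n) (λ i → cong ⟦_⟧ (stable x y agree i))))))
                   (≤-reflexive (sym (∏-if (free x) 4)))

    -- With f free coordinates the subcube holds at most (N / 4) ^ f elements of G, while
    -- `outside x` is N ^ (n - f) and 4 ^ m ≤ 4 ^ f.
    block-bound : ∑ (vecs xs n) (term x) ≤ N ^ n
    block-bound = begin
      ∑ (vecs xs n) (term x) ≤⟨ ∑-mono (vecs xs n) term≤ ⟩
      ∑ (vecs xs n) (λ y′ → 4 ^ m * outside x * ∏ (λ i → cell i (lookup y′ i))) ≡⟨ ∑-*ˡ (vecs xs n) (4 ^ m * outside x) _ ⟩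
      4 ^ m * outside x * ∑ (vecs xs n) (λ y′ → ∏ (λ i → cell i (lookup y′ i))) ≡⟨ cong (4 ^ m * outside x *_) (∑-vecs-∏ xs n cell) ⟩
      4 ^ m * outside x * ∏ (λ i → ∑ xs (cell i)) ≤⟨ *-mono-≤ (*-monoˡ-≤ (outside x) 4^m≤) (∏-mono λ i → cells (free x i) i) ⟩
      ∏ (λ i → if free x i then 4 else 1) * outside x * ∏ (λ i → if free x i then z else 1)
        ≡⟨ trans (cong (_* ∏ (λ i → if free x i then z else 1)) (sym (∏-* (λ i → if free x i then 4 else 1) (λ i → if free x i then 1 else N))))
             (sym (∏-* (λ i → (if free x i then 4 else 1) * (if free x i then 1 else N)) (λ i → if free x i then z else 1))) ⟩
      ∏ (λ i → (if free x i then 4 else 1) * (if free x i then 1 else N) * (if free x i then z else 1)) ≤⟨ ∏-mono (λ i → factor (free x i)) ⟩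
      ∏ {n} (λ _ → N) ≡⟨ ∏-const n N ⟩
      N ^ n ∎
      where
      cells : ∀ b i → ∑ xs (λ a → if b then 𝟙 (Z? x a) else 𝟙 (a ≟ lookup x i)) ≤ (if b then z else 1)
      cells true  i = ≤-refl
      cells false i = ∑-unique≤1 _≟_ unique (lookup x i)
      factor : ∀ b → (if b then 4 else 1) * (if b then 1 else N) * (if b then z else 1) ≤ N
      factor true  = Z-small x y g agree
      factor false = ≤-reflexive (trans (*-identityʳ _) (+-identityʳ N))

  column-bound : ∀ x → ∑ (vecs xs n) (term x) ≤ N ^ n
  column-bound x = ∑-bound (vecs xs n) (term x) (N ^ n) λ y h → let g , agree = meaning y h in block-bound x y g agree
    where
    meaning : ∀ y → 1 ≤ term x y → G y × Agree x y
    meaning y h with G? y | R y x in e | R⇒Agree y x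
    ... | no _  | _     | _  = contradiction h λ ()
    ... | yes _ | zero  | _  = contradiction (≤-trans h (≤-reflexive (*-zeroʳ (1 * 4 ^ m * outside y)))) λ ()
    ... | yes g | suc _ | to = g , Agree-sym (to (s≤s z≤n))

  size-bound : ∑ (vecs xs n) (λ y → 𝟙 (G? y)) * 4 ^ m ≤ N ^ n
  size-bound = *-cancelʳ-≤ _ _ (N ^ n) {{m^n≢0 N n {{>-nonZero nonempty}}}} (begin
    ∑ V (λ y → 𝟙 (G? y)) * 4 ^ m * N ^ n ≡⟨ trans (cong (_* N ^ n) (sym (∑-*ʳ V _ (4 ^ m)))) (sym (∑-*ʳ V _ (N ^ n))) ⟩
    ∑ V (λ y → 𝟙 (G? y) * 4 ^ m * N ^ n) ≤⟨ ∑-mono V pointwise ⟩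
    ∑ V (λ y → ∑ V (λ x → term x y)) ≡⟨ ∑-swap V V (λ y x → term x y) ⟩
    ∑ V (λ x → ∑ V (term x)) ≤⟨ ∑-mono V column-bound ⟩
    ∑ V (λ _ → N ^ n) ≡⟨ ∑-const V (N ^ n) ⟩
    length V * N ^ n ≡⟨ cong (_* N ^ n) (length-vecs xs n) ⟩
    N ^ n * N ^ n ∎)
    where
    V = vecs xs n
    pointwise : ∀ y → 𝟙 (G? y) * 4 ^ m * N ^ n ≤ ∑ V (λ x → term x y)
    pointwise y = begin
      𝟙 (G? y) * 4 ^ m * N ^ n ≡⟨ cong (𝟙 (G? y) * 4 ^ m *_) (sym (outside*inside y)) ⟩
      𝟙 (G? y) * 4 ^ m * (outside y * inside y) ≤⟨ *-monoʳ-≤ (𝟙 (G? y) * 4 ^ m) (*-monoʳ-≤ (outside y) (inside≤ y)) ⟩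
      𝟙 (G? y) * 4 ^ m * (outside y * ∑ V (R y)) ≡⟨ sym (*-assoc (𝟙 (G? y) * 4 ^ m) (outside y) _) ⟩
      𝟙 (G? y) * 4 ^ m * outside y * ∑ V (R y) ≡⟨ sym (∑-*ˡ V (𝟙 (G? y) * 4 ^ m * outside y) (R y)) ⟩
      ∑ V (λ x → term x y) ∎

-- Rectangles of accepted inputs

only⇒just : ∀ {r} s (F : Vec Colour r) b j → only s F b ≡ true → lookup b j ≡ true → lookup F j ≡ just s
only⇒just s (just s′ ∷ F) (true ∷ b) zero e _ = cong just (same⇒≡ s s′ (∧-left e))
  where
  ∧-left : ∀ {x y} → x ∧ y ≡ true → x ≡ true
  ∧-left {true} _ = refl
  same⇒≡ : ∀ s s′ → same s s′ ≡ true → s′ ≡ s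
  same⇒≡ true  true  _ = refl
  same⇒≡ false false _ = refl
only⇒just s (_ ∷ F)       (false ∷ b) (suc j) e h = only⇒just s F b j e h
only⇒just s (just s′ ∷ F) (true ∷ b)  (suc j) e h = only⇒just s F b j (∧-right e) h
  where
  ∧-right : ∀ {x y} → x ∧ y ≡ true → y ≡ true
  ∧-right {true} e = e

only-cong : ∀ {r} s (F : Vec Colour r) b b′ → (∀ j → lookup F j ≢ just s → lookup b j ≡ lookup b′ j) → only s F b ≡ only s F b′
only-cong s [] [] [] h = refl
only-cong s (k ∷ F) (x ∷ b) (y ∷ b′) h = head k x y (h zero)
  where
  ih = only-cong s F b b′ (h ∘ suc)
  skip : ∀ x → only s (just s ∷ F) (x ∷ b) ≡ only s F b
  skip true  = cong (_∧ only s F b) (same-refl s)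
  skip false = refl
  skip′ : ∀ x → only s (just s ∷ F) (x ∷ b′) ≡ only s F b′
  skip′ true  = cong (_∧ only s F b′) (same-refl s)
  skip′ false = refl
  head : ∀ k x y → (k ≢ just s → x ≡ y) → only s (k ∷ F) (x ∷ b) ≡ only s (k ∷ F) (y ∷ b′)
  head k x y e with Maybe.≡-dec Bool._≟_ k (just s)
  head _ x y e | yes refl = trans (skip x) (trans ih (sym (skip′ y)))
  head k x y e | no k≢ with e k≢
  head k         false _ e | no _ | refl = ih
  head nothing   true  _ e | no _ | refl = refl
  head (just s′) true  _ e | no _ | refl = cong (same s s′ ∧_) ih

-- The reason for introducing `exact`: together with `Segmentation.local` it fixes the value on a
-- subcube whose free variables are read only in segments coloured `not s`.
exact-cong : ∀ {r} s t (F : Vec Colour r) b b′ → (∀ j → lookup F j ≢ just (not s) → lookup b j ≡ lookup b′ j) →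
             exact s t F b ≡ exact s t F b′
exact-cong s t [] [] [] h = refl
exact-cong s t (k ∷ F) (x ∷ b) (y ∷ b′) h = head t k x y (h zero)
  where
  ih : ∀ t → exact s t F b ≡ exact s t F b′
  ih t = exact-cong s t F b b′ (h ∘ suc)
  skip : ∀ t x (b : Vec Bool _) → exact s t (just (not s) ∷ F) (x ∷ b) ≡ exact s t F b
  skip t       false b = refl
  skip zero    true  b = cong (λ z → not z ∧ exact s zero F b) (same-not s)
  skip (suc t) true  b = cong (λ z → if z then exact s t F b else exact s (suc t) F b) (same-not s)
  head : ∀ t k x y → (k ≢ just (not s) → x ≡ y) → exact s t (k ∷ F) (x ∷ b) ≡ exact s t (k ∷ F) (y ∷ b′)
  head t k x y e with Maybe.≡-dec Bool._≟_ k (just (not s))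
  head t _ x y e | yes refl = trans (skip t x b) (trans (ih t) (sym (skip t y b′)))
  head t k x y e | no k≢ with e k≢
  head t       k         false _ e | no _ | refl = ih t
  head t       nothing   true  _ e | no _ | refl = refl
  head zero    (just s′) true  _ e | no _ | refl = cong (not (same s s′) ∧_) (ih zero)
  head (suc t) (just s′) true  _ e | no _ | refl = cong₂ (if same s s′ then_else_) (ih t) (ih (suc t))

-- What the rectangle argument uses of a branching program once the nodes at the cuts are fixed. By
-- `splice`, an input is bidistinct if each segment fails to tell it from one of two good inputs.
record Segmentation (d n r : ℕ) : Set₁ where
  Input : Set
  Input = Vec (Fin d × Fin d) n
  field
    Good    : Input → Set
    good?   : ∀ x → Dec (Good x)
    readers : Input → Fin n → Vec Bool r
  Preserved : Input → Input → Fin r → Set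
  Preserved x y j = ∀ i → lookup (readers x i) j ≡ true → lookup x i ≡ lookup y i
  field
    local    : ∀ x y j → Preserved x y j → ∀ i → lookup (readers y i) j ≡ lookup (readers x i) j
    all-read : ∀ x → Good x → ∀ i → ∃[ j ] lookup (readers x i) j ≡ true
    splice   : ∀ x x′ z → Good x → Good x′ → (∀ j → Preserved x z j ⊎ Preserved x′ z j) →
               ∀ i k → Bidistinct (lookup z i) (lookup z k)

-- The two left sides have the product 16 (a e) (b c), where a e and b c are at most d² / 4 each; so
-- not both can exceed d².
four-times : ∀ a b c e d → a + e ≤ d → b + c ≤ d → 4 * (a * b) ≤ d * d ⊎ 4 * (c * e) ≤ d * d
four-times a b c e d h₁ h₂ with 4 * (a * b) ≤? d * d | 4 * (c * e) ≤? d * d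
... | yes p | _     = inj₁ p
... | no _  | yes p = inj₂ p
... | no p  | no p′ = contradiction impossible (<⇒≱ (*-mono-< (≰⇒> p) (≰⇒> p′)))
  where
  open ≤-Reasoning
  amgm-≤ : ∀ x y → x ≤ y → 4 * (x * y) ≤ (x + y) * (x + y)
  amgm-≤ x y x≤y with m≤n⇒∃[o]m+o≡n x≤y
  ... | k , refl = ≤-trans (m≤m+n _ (k * k)) (≤-reflexive (l x k))
    where
    l : ∀ x k → 4 * (x * (x + k)) + k * k ≡ (x + (x + k)) * (x + (x + k))
    l = solve-∀
  amgm : ∀ x y → 4 * (x * y) ≤ (x + y) * (x + y)
  amgm x y with ≤-total x y
  ... | inj₁ le = amgm-≤ x y le
  ... | inj₂ ge = subst₂ (λ u v → 4 * u ≤ v * v) (*-comm y x) (+-comm y x) (amgm-≤ y x ge)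
  impossible : 4 * (a * b) * (4 * (c * e)) ≤ d * d * (d * d)
  impossible = begin
    4 * (a * b) * (4 * (c * e)) ≡⟨ l a b c e ⟩
    4 * (a * e) * (4 * (b * c)) ≤⟨ *-mono-≤ (≤-trans (amgm a e) (*-mono-≤ h₁ h₁)) (≤-trans (amgm b c) (*-mono-≤ h₂ h₂)) ⟩
    d * d * (d * d) ∎
    where
    l : ∀ a b c e → 4 * (a * b) * (4 * (c * e)) ≡ 4 * (a * e) * (4 * (b * c))
    l = solve-∀

pairs : ∀ d → List (Fin d × Fin d)
pairs d = cartesianProduct (allFin d) (allFin d)

length-pairs : ∀ d → length (pairs d) ≡ d * d
length-pairs d = trans (length-cartesianProductWith _,_ (allFin d) (allFin d)) (cong₂ _*_ (List.length-tabulate {n = d} id) (List.length-tabulate {n = d} id))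

∈-pairs : ∀ {d} (p : Fin d × Fin d) → p ∈ pairs d
∈-pairs (a , b) = ∈-cartesianProduct⁺ (∈-allFin a) (∈-allFin b)

pairs-unique : ∀ d → Unique (pairs d)
pairs-unique d = Unique.cartesianProduct⁺ (Unique.allFin⁺ d) (Unique.allFin⁺ d)

all-inputs : ∀ d n → List (Vec (Fin d × Fin d) n)
all-inputs d n = vecs (pairs d) n

∃-input? : ∀ {d n} {P : Vec (Fin d × Fin d) n → Set} → (∀ x → Dec (P x)) → Dec (∃[ x ] P x)
∃-input? {d} {n} P? = map′ (λ a → let x , _ , p = find a in x , p) (λ (x , p) → lose (∈-vecs (pairs d) ∈-pairs x) p) (any? P? (all-inputs d n))

module Rectangles {d n r : ℕ} (S : Segmentation d n r) (F : Vec Colour r) where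

  open Segmentation S
  open ≤-Reasoning

  core : Bool → Input → Fin n → Bool
  core s x i = only s F (readers x i)

  Feet : Set
  Feet = Bool → Fin n → Bool

  Class : Feet → Input → Input → Set
  Class α x y = Good y × (∀ i → core true y i ≡ α true i) × (∀ i → core false y i ≡ α false i) ×
                (∀ i → α true i ≡ false → α false i ≡ false → lookup y i ≡ lookup x i)

  _≟ₚ_ : (a b : Fin d × Fin d) → Dec (a ≡ b)
  _≟ₚ_ = ≡-dec Fin._≟_ Fin._≟_

  class? : ∀ α x y → Dec (Class α x y)
  class? α x y = good? y ×-dec Fin.all? (λ i → core true y i Bool.≟ α true i) ×-dec Fin.all? (λ i → core false y i Bool.≟ α false i)
    ×-dec Fin.all? (λ i → (α true i Bool.≟ false) →-dec ((α false i Bool.≟ false) →-dec (lookup y i ≟ₚ lookup x i)))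

  First Second : Feet → Input → Bool → Fin d → Set
  First  α x s p = ∃[ y ] Class α x y × ∃[ i ] α s i ≡ true × proj₁ (lookup y i) ≡ p
  Second α x s p = ∃[ y ] Class α x y × ∃[ i ] α s i ≡ true × proj₂ (lookup y i) ≡ p

  first? : ∀ α x s p → Dec (First α x s p)
  first? α x s p = ∃-input? λ y → class? α x y ×-dec Fin.any? (λ i → (α s i Bool.≟ true) ×-dec (proj₁ (lookup y i) Fin.≟ p))

  second? : ∀ α x s p → Dec (Second α x s p)
  second? α x s p = ∃-input? λ y → class? α x y ×-dec Fin.any? (λ i → (α s i Bool.≟ true) ×-dec (proj₂ (lookup y i) Fin.≟ p))

  ∣First∣ ∣Second∣ : Feet → Input → Bool → ℕ
  ∣First∣  α x s = ∑ (allFin d) (λ p → 𝟙 (first? α x s p))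
  ∣Second∣ α x s = ∑ (allFin d) (λ p → 𝟙 (second? α x s p))

  class-core : ∀ α x y s → Class α x y → ∀ i → core s y i ≡ α s i
  class-core α x y true  (_ , e , _) = e
  class-core α x y false (_ , _ , e , _) = e

  class-off : ∀ α x y s → Class α x y → ∀ i → α s i ≡ false → α (not s) i ≡ false → lookup y i ≡ lookup x i
  class-off α x y true  (_ , _ , _ , e) i h h′ = e i h h′
  class-off α x y false (_ , _ , _ , e) i h h′ = e i h′ h

  just-injective-not : ∀ s → just s ≢ just (not s)
  just-injective-not true  ()
  just-injective-not false ()

  cores-disjoint : ∀ y → Good y → ∀ s i → core s y i ≡ true → core (not s) y i ≡ true → ⊥
  cores-disjoint y g s i e e′ = let j , h = all-read y g i in
    just-injective-not s (trans (sym (only⇒just s F (readers y i) j e h)) (only⇒just (not s) F (readers y i) j e′ h))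

  is-false : ∀ {b} → (b ≡ true → ⊥) → b ≡ false
  is-false {true}  h = ⊥-elim (h refl)
  is-false {false} _ = refl

  -- The input z below combines both legs of the rectangle: segments coloured
  -- just (not s) do not distinguish it from y′, the others not from y.
  legs-bidistinct : ∀ α x s y y′ → Class α x y → Class α x y′ → ∀ i k → α s i ≡ true → α (not s) k ≡ true →
                    Bidistinct (lookup y i) (lookup y′ k)
  legs-bidistinct α x s y y′ c c′ i k hi hk =
    subst₂ Bidistinct zi zk (splice y y′ z (proj₁ c) (proj₁ c′) preserved i k)
    where
    choose : Bool → Fin n → Fin d × Fin d
    choose b l = if b then lookup y′ l else lookup y l
    z : Input
    z = tabulate (λ l → choose (α (not s) l) l)
    z-at : ∀ l b → α (not s) l ≡ b → lookup z l ≡ choose b l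
    z-at l b e = trans (lookup∘tabulate _ l) (cong (λ b → choose b l) e)
    zi : lookup z i ≡ lookup y i
    zi = z-at i false (is-false λ e → cores-disjoint y (proj₁ c) s i
           (trans (class-core α x y s c i) hi) (trans (class-core α x y (not s) c i) e))
    zk : lookup z k ≡ lookup y′ k
    zk = z-at k true hk
    preserved : ∀ j → Preserved y z j ⊎ Preserved y′ z j
    preserved j with Maybe.≡-dec Bool._≟_ (lookup F j) (just (not s))
    ... | no F≢ = inj₁ λ l h → sym (z-at l false (is-false λ e →
            F≢ (only⇒just (not s) F (readers y l) j (trans (class-core α x y (not s) c l) e) h)))
    ... | yes F≡ = inj₂ λ l h → helper l h (α (not s) l) refl
      where
      helper : ∀ l → lookup (readers y′ l) j ≡ true → ∀ b → α (not s) l ≡ b → lookup y′ l ≡ lookup z l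
      helper l h true  e = sym (z-at l true e)
      helper l h false e = trans (class-off α x y′ s c′ l αs e) (trans (sym (class-off α x y s c l αs e)) (sym (z-at l false e)))
        where
        αs : α s l ≡ false
        αs = is-false λ e′ → just-injective-not s (trans
               (sym (only⇒just s F (readers y′ l) j (trans (class-core α x y′ s c′ l) e′) h)) F≡)

  first-second : ∀ α x s → ∣First∣ α x s + ∣Second∣ α x (not s) ≤ d
  first-second α x s = begin
    ∣First∣ α x s + ∣Second∣ α x (not s) ≡⟨ sym (∑-+ (allFin d) _ _) ⟩
    ∑ (allFin d) (λ p → 𝟙 (first? α x s p) + 𝟙 (second? α x (not s) p)) ≤⟨ ∑-mono (allFin d) pointwise ⟩
    ∑ (allFin d) (λ _ → 1) ≡⟨ trans (∑-const (allFin d) 1) (trans (*-identityʳ _) (List.length-tabulate {n = d} id)) ⟩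
    d ∎
    where
    pointwise : ∀ p → 𝟙 (first? α x s p) + 𝟙 (second? α x (not s) p) ≤ 1
    pointwise p with first? α x s p | second? α x (not s) p
    ... | no _  | q     = 𝟙≤1 q
    ... | yes _ | no _  = ≤-refl
    ... | yes (y , c , i , hi , refl) | yes (y′ , c′ , k , hk , e) =
      contradiction (sym e) (proj₁ (legs-bidistinct α x s y y′ c c′ i k hi hk))

  Narrow : Bool → Feet → Input → Set
  Narrow s α x = 4 * (∣First∣ α x s * ∣Second∣ α x s) ≤ d * d

  some-narrow : ∀ α x → Narrow true α x ⊎ Narrow false α x
  some-narrow α x = four-times (∣First∣ α x true) (∣Second∣ α x true) (∣First∣ α x false) (∣Second∣ α x false) d
    (first-second α x true) (≤-trans (≤-reflexive (+-comm (∣Second∣ α x true) _)) (first-second α x false))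

  module Count (s : Bool) (t : ℕ) (E : Vec Bool n) (m : ℕ) (d>0 : 1 ≤ d) where

    Extreme : Input → Set
    Extreme y = Good y × (∀ i → exceptional (not s) t F (readers y i) ≡ lookup E i) × Narrow s (λ u → core u y) y ×
                m ≤ ∑ (allFin n) (λ i → ⟦ core s y i ⟧)

    extreme? : ∀ y → Dec (Extreme y)
    extreme? y = good? y ×-dec Fin.all? (λ i → exceptional (not s) t F (readers y i) Bool.≟ lookup E i) ×-dec
      (4 * (∣First∣ (λ u → core u y) y s * ∣Second∣ (λ u → core u y) y s) ≤? d * d) ×-dec (m ≤? ∑ (allFin n) (λ i → ⟦ core s y i ⟧))

    Agree : Input → Input → Set
    Agree x y = ∀ i → core s x i ≡ false → lookup x i ≡ lookup y i

    same-readers : ∀ x y → Agree x y → ∀ i j → lookup F j ≢ just s → lookup (readers y i) j ≡ lookup (readers x i) j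
    same-readers x y agree i j F≢ = local x y j (λ l h → agree l (is-false λ e → F≢ (only⇒just s F (readers x l) j e h))) i

    stable : ∀ x y → Agree x y → ∀ i → core s y i ≡ core s x i
    stable x y agree i = only-cong s F (readers y i) (readers x i) (same-readers x y agree i)

    exact-stable : ∀ x y → Agree x y → ∀ i → exact (not s) t F (readers y i) ≡ exact (not s) t F (readers x i)
    exact-stable x y agree i = exact-cong (not s) t F (readers y i) (readers x i)
      (λ j F≢ → same-readers x y agree i j (λ e → F≢ (trans e (cong just (sym (Bool.not-involutive s))))))

    -- The feet of any extreme y of a subcube, computed from an arbitrary point x of it: the core of
    -- colour s is constant there, and the other core is recovered from `exact` and the guess E.
    feet : Input → Feet
    feet x u i = if same u s then core s x i else exact (not s) t F (readers x i) xor lookup E i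

    feet-≡ : ∀ x y → Extreme y → Agree x y → ∀ u i → feet x u i ≡ core u y i
    feet-≡ x y (_ , exc , _) agree u i = cases u s refl
      where
      recover : ∀ a b → b xor (a xor b) ≡ a
      recover true  true  = refl
      recover true  false = refl
      recover false true  = refl
      recover false false = refl
      this : core s x i ≡ core s y i
      this = sym (stable x y agree i)
      other : exact (not s) t F (readers x i) xor lookup E i ≡ core (not s) y i
      other = trans (cong₂ _xor_ (sym (exact-stable x y agree i)) (sym (exc i))) (recover (core (not s) y i) (exact (not s) t F (readers y i)))
      cases : ∀ u s′ → s′ ≡ s → (if same u s′ then core s x i else exact (not s) t F (readers x i) xor lookup E i) ≡ core u y i
      cases true  true  refl = this
      cases false false refl = this
      cases true  false refl = other
      cases false true  refl = other

    Z : Input → Fin d × Fin d → Set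
    Z x (p , p′) = First (feet x) x s p × Second (feet x) x s p′

    z? : ∀ x a → Dec (Z x a)
    z? x (p , p′) = first? (feet x) x s p ×-dec second? (feet x) x s p′

    self : ∀ x y → Extreme y → Agree x y → Class (feet x) x y
    self x y ex agree = proj₁ ex , (λ i → sym (feet-≡ x y ex agree true i)) , (λ i → sym (feet-≡ x y ex agree false i)) ,
      λ i h h′ → sym (agree i (core-false i s refl h h′))
      where
      core-false : ∀ i s′ → s′ ≡ s → feet x true i ≡ false → feet x false i ≡ false → core s x i ≡ false
      core-false i true  refl h h′ = h
      core-false i false refl h h′ = h′

    feet-s : ∀ x i → feet x s i ≡ core s x i
    feet-s x i = cong (λ b → if b then core s x i else exact (not s) t F (readers x i) xor lookup E i) (same-refl s)

    member : ∀ x y → Extreme y → Agree x y → ∀ i → core s x i ≡ true → Z x (lookup y i)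
    member x y ex agree i e = (y , self x y ex agree , i , trans (feet-s x i) e , refl) , (y , self x y ex agree , i , trans (feet-s x i) e , refl)

    -- The rectangle described from x is contained in that of y, so the narrowness of y bounds the
    -- set `Z x`.
    transport : ∀ x y → Extreme y → Agree x y → ∀ {y′} → Class (feet x) x y′ → Class (λ u → core u y) y y′
    transport x y ex agree (g , a , b , off) =
      g , (λ i → trans (a i) (feet-≡ x y ex agree true i)) , (λ i → trans (b i) (feet-≡ x y ex agree false i)) ,
      λ i h h′ → trans (off i (trans (feet-≡ x y ex agree true i) h) (trans (feet-≡ x y ex agree false i) h′))
                       (sym (proj₂ (proj₂ (proj₂ (self x y ex agree))) i (trans (feet-≡ x y ex agree true i) h) (trans (feet-≡ x y ex agree false i) h′)))

    𝟙-× : ∀ {P Q : Set} (P? : Dec P) (Q? : Dec Q) → 𝟙 (P? ×-dec Q?) ≤ 𝟙 P? * 𝟙 Q?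
    𝟙-× (yes _) (yes _) = ≤-refl
    𝟙-× (yes _) (no _)  = z≤n
    𝟙-× (no _)  _       = z≤n

    z-small : ∀ x y → Extreme y → Agree x y → 4 * ∑ (pairs d) (λ a → 𝟙 (z? x a)) ≤ length (pairs d)
    z-small x y ex agree = begin
      4 * ∑ (pairs d) (λ a → 𝟙 (z? x a)) ≤⟨ *-monoʳ-≤ 4 product-bound ⟩
      4 * (∣First∣ (feet x) x s * ∣Second∣ (feet x) x s) ≤⟨ *-monoʳ-≤ 4 (*-mono-≤
        (∑-mono (allFin d) (λ p → 𝟙-mono (first? (feet x) x s p) (first? (λ u → core u y) y s p)
          (λ (y′ , c , i , e , h) → y′ , transport x y ex agree c , i , trans (sym (feet-≡ x y ex agree s i)) e , h)))
        (∑-mono (allFin d) (λ p → 𝟙-mono (second? (feet x) x s p) (second? (λ u → core u y) y s p)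
          (λ (y′ , c , i , e , h) → y′ , transport x y ex agree c , i , trans (sym (feet-≡ x y ex agree s i)) e , h)))) ⟩
      4 * (∣First∣ (λ u → core u y) y s * ∣Second∣ (λ u → core u y) y s) ≤⟨ proj₁ (proj₂ (proj₂ ex)) ⟩
      d * d ≡⟨ sym (length-pairs d) ⟩
      length (pairs d) ∎
      where
      f g : Fin d → ℕ
      f p = 𝟙 (first? (feet x) x s p)
      g p = 𝟙 (second? (feet x) x s p)
      product-bound : ∑ (pairs d) (λ a → 𝟙 (z? x a)) ≤ ∑ (allFin d) f * ∑ (allFin d) g
      product-bound = begin
        ∑ (pairs d) (λ a → 𝟙 (z? x a)) ≡⟨ ∑-cartesianProductWith _,_ (allFin d) (allFin d) _ ⟩
        ∑ (allFin d) (λ p → ∑ (allFin d) (λ p′ → 𝟙 (z? x (p , p′))))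
          ≤⟨ ∑-mono (allFin d) (λ p → ∑-mono (allFin d) (λ p′ → 𝟙-× (first? (feet x) x s p) (second? (feet x) x s p′))) ⟩
        ∑ (allFin d) (λ p → ∑ (allFin d) (λ p′ → f p * g p′)) ≡⟨ ∑-cong (allFin d) (λ p → ∑-*ˡ (allFin d) (f p) g) ⟩
        ∑ (allFin d) (λ p → f p * ∑ (allFin d) g) ≡⟨ ∑-*ʳ (allFin d) f _ ⟩
        ∑ (allFin d) f * ∑ (allFin d) g ∎

    extreme-count : ∑ (all-inputs d n) (λ y → 𝟙 (extreme? y)) * 4 ^ m ≤ (d * d) ^ n
    extreme-count = subst (λ N → ∑ (all-inputs d n) (λ y → 𝟙 (extreme? y)) * 4 ^ m ≤ N ^ n) (length-pairs d)
      (Blocks.size-bound _≟ₚ_ (pairs d) (pairs-unique d) ∈-pairs (core s) stable Extreme extreme? Z z? m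
        member z-small (λ y ex → proj₂ (proj₂ (proj₂ ex)))
        (subst (1 ≤_) (sym (length-pairs d)) (*-mono-≤ d>0 d>0)))

-- Branching programs

⌊⌋-true : ∀ {P : Set} (P? : Dec P) → ⌊ P? ⌋ ≡ true → P
⌊⌋-true (yes p) _ = p

⌊⌋-false : ∀ {P : Set} (P? : Dec P) → ⌊ P? ⌋ ≡ false → ¬ P
⌊⌋-false (no ¬p) _ = ¬p

EB-sound : ∀ {n d} (x : Vec (Fin d × Fin d) n) → EB (lookup x) ≡ true → ∀ i j → Bidistinct (lookup x i) (lookup x j)
EB-sound x = ⌊⌋-true (Fin.all? (λ i → Fin.all? (λ j → bidistinct? (lookup x i) (lookup x j))))

-- Half of all inputs are accepted

module Collisions (d : ℕ) where

  open ≤-Reasoning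

  V : ∀ n → List (Vec (Fin d × Fin d) n)
  V = all-inputs d

  length-V : ∀ n → length (V n) ≡ (d * d) ^ n
  length-V n = trans (length-vecs (pairs d) n) (cong (_^ n) (length-pairs d))

  ∑-V-suc≤ : ∀ {n} (f : Vec (Fin d × Fin d) (suc n) → ℕ) k → (∀ a → d * ∑ (V n) (λ x → f (a ∷ x)) ≤ k) →
             d * ∑ (V (suc n)) f ≤ d * d * k
  ∑-V-suc≤ {n} f k h = begin
    d * ∑ (V (suc n)) f ≡⟨ cong (d *_) (∑-vecs-suc (pairs d) n f) ⟩
    d * ∑ (pairs d) (λ a → ∑ (V n) (λ x → f (a ∷ x))) ≡⟨ sym (∑-*ˡ (pairs d) d _) ⟩
    ∑ (pairs d) (λ a → d * ∑ (V n) (λ x → f (a ∷ x))) ≤⟨ ∑-mono (pairs d) h ⟩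
    ∑ (pairs d) (λ _ → k) ≡⟨ trans (∑-const (pairs d) k) (cong (_* k) (length-pairs d)) ⟩
    d * d * k ∎

  coordinate≤ : ∀ (f : Fin d × Fin d → ℕ) → ∑ (pairs d) f ≤ d → ∀ {n} (j : Fin n) →
                d * ∑ (V n) (λ x → f (lookup x j)) ≤ (d * d) ^ n
  coordinate≤ f h {suc n} zero = begin
    d * ∑ (V (suc n)) (λ x → f (lookup x zero)) ≡⟨ cong (d *_) (∑-vecs-suc (pairs d) n _) ⟩
    d * ∑ (pairs d) (λ a → ∑ (V n) (λ _ → f a)) ≡⟨ cong (d *_) (trans (∑-cong (pairs d) (λ a → trans (∑-const (V n) (f a)) (*-comm (length (V n)) _))) (∑-*ʳ (pairs d) f _)) ⟩
    d * (∑ (pairs d) f * length (V n)) ≤⟨ *-monoʳ-≤ d (*-mono-≤ h (≤-reflexive (length-V n))) ⟩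
    d * (d * (d * d) ^ n) ≡⟨ sym (*-assoc d d _) ⟩
    d * d * (d * d) ^ n ∎
  coordinate≤ f h {suc n} (suc j) = ∑-V-suc≤ _ _ (λ _ → coordinate≤ f h j)

  one : ∀ p → ∑ (allFin d) (λ q → 𝟙 (q Fin.≟ p)) ≤ 1
  one = ∑-unique≤1 Fin._≟_ (Unique.allFin⁺ d)

  one′ : ∀ p → ∑ (allFin d) (λ q → 𝟙 (p Fin.≟ q)) ≤ 1
  one′ p = ≤-trans (≤-reflexive (∑-cong (allFin d) (λ q → 𝟙-cong (p Fin.≟ q) (q Fin.≟ p) sym sym))) (one p)

  ∑-pairs≤ : ∀ (f : Fin d → Fin d → ℕ) → (∀ a → ∑ (allFin d) (f a) ≤ 1) → ∑ (pairs d) (λ (a , b) → f a b) ≤ d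
  ∑-pairs≤ f h = begin
    ∑ (pairs d) (λ (a , b) → f a b) ≡⟨ ∑-cartesianProductWith _,_ (allFin d) (allFin d) _ ⟩
    ∑ (allFin d) (λ a → ∑ (allFin d) (f a)) ≤⟨ ∑-mono (allFin d) h ⟩
    ∑ (allFin d) (λ _ → 1) ≡⟨ trans (∑-allFin-const d 1) (*-identityʳ d) ⟩
    d ∎

  ∑-fst≤ : ∀ p → ∑ (pairs d) (λ (a , _) → 𝟙 (a Fin.≟ p)) ≤ d
  ∑-fst≤ p = ≤-trans (≤-reflexive (trans (∑-cartesianProductWith _,_ (allFin d) (allFin d) _)
    (trans (∑-swap (allFin d) (allFin d) _) (sym (∑-cartesianProductWith _,_ (allFin d) (allFin d) (λ (_ , a) → 𝟙 (a Fin.≟ p)))))))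
    (∑-pairs≤ (λ _ a → 𝟙 (a Fin.≟ p)) (λ _ → one p))

  collision : ∀ {n} → Fin n → Fin n → Vec (Fin d × Fin d) n → ℕ
  collision i j x = 𝟙 (proj₁ (lookup x i) Fin.≟ proj₂ (lookup x j))

  -- Fixing one of the two coordinates leaves a condition that holds for d of the d² values of the
  -- other; for i = j the d pairs with equal components are counted.
  ∑-collision : ∀ {n} (i j : Fin n) → d * ∑ (V n) (collision i j) ≤ (d * d) ^ n
  ∑-collision {suc n} zero    zero    = coordinate≤ (λ (a , b) → 𝟙 (a Fin.≟ b)) (∑-pairs≤ (λ a b → 𝟙 (a Fin.≟ b)) one′) {suc n} zero
  ∑-collision {suc n} zero    (suc j) = ∑-V-suc≤ _ _ (λ (p , _) → coordinate≤ (λ (_ , b) → 𝟙 (p Fin.≟ b)) (∑-pairs≤ (λ _ b → 𝟙 (p Fin.≟ b)) (λ _ → one′ p)) j)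
  ∑-collision {suc n} (suc i) zero    = ∑-V-suc≤ _ _ (λ (_ , p) → coordinate≤ (λ (a , _) → 𝟙 (a Fin.≟ p)) (∑-fst≤ p) i)
  ∑-collision {suc n} (suc i) (suc j) = ∑-V-suc≤ _ _ (λ _ → ∑-collision i j)

  accepted rejected : ∀ n → ℕ
  accepted n = ∑ (V n) (λ x → ⟦ EB (lookup x) ⟧)
  rejected n = ∑ (V n) (λ x → ⟦ not (EB (lookup x)) ⟧)

  -- A failure at (i , j) is a collision for (i , j) or for (j , i), so one kind of collision
  -- suffices.
  not-EB : ∀ {n} (x : Vec (Fin d × Fin d) n) → ⟦ not (EB (lookup x)) ⟧ ≤ ∑ (allFin n) (λ i → ∑ (allFin n) (λ j → collision i j x))
  not-EB {n} x with EB (lookup x) in e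
  ... | true  = z≤n
  ... | false with Fin.¬∀⟶∃¬ n _ (λ i → Fin.all? (λ j → bidistinct? (lookup x i) (lookup x j))) (⌊⌋-false (Fin.all? _) e)
  ...   | i , ¬i with Fin.¬∀⟶∃¬ n _ (λ j → bidistinct? (lookup x i) (lookup x j)) ¬i
  ...     | j , ¬bi = helper (proj₁ (lookup x i) Fin.≟ proj₂ (lookup x j)) (proj₁ (lookup x j) Fin.≟ proj₂ (lookup x i))
    where
    found : ∀ i j → proj₁ (lookup x i) ≡ proj₂ (lookup x j) → 1 ≤ ∑ (allFin n) (λ i → ∑ (allFin n) (λ j → collision i j x))
    found i j e = ≤-trans (≤-reflexive (sym (𝟙-yes (proj₁ (lookup x i) Fin.≟ proj₂ (lookup x j)) e)))
      (≤-trans (∈⇒≤∑ (λ j → collision i j x) (∈-allFin j)) (∈⇒≤∑ (λ i → ∑ (allFin n) (λ j → collision i j x)) (∈-allFin i)))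
    helper : Dec _ → Dec _ → 1 ≤ ∑ (allFin n) (λ i → ∑ (allFin n) (λ j → collision i j x))
    helper (yes e) _       = found i j e
    helper (no _)  (yes e) = found j i e
    helper (no a)  (no b)  = contradiction (a , λ e → b (sym e)) ¬bi

  -- Union bound over n² collisions of probability at most 1 / d each.
  half-accepted : ∀ n → 1 ≤ n → 2 * n ^ 2 ≤ d → (d * d) ^ n ≤ 2 * accepted n
  half-accepted n n>0 d-large = +-cancelʳ-≤ (2 * rejected n) _ _ (begin
    (d * d) ^ n + 2 * rejected n ≤⟨ +-monoʳ-≤ ((d * d) ^ n) 2rejected ⟩
    (d * d) ^ n + (d * d) ^ n ≡⟨ cong ((d * d) ^ n +_) (sym (+-identityʳ _)) ⟩
    2 * (d * d) ^ n ≡⟨ cong (2 *_) (sym total) ⟩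
    2 * (accepted n + rejected n) ≡⟨ *-distribˡ-+ 2 (accepted n) (rejected n) ⟩
    2 * accepted n + 2 * rejected n ∎)
    where
    split : ∀ b → ⟦ b ⟧ + ⟦ not b ⟧ ≡ 1
    split true  = refl
    split false = refl
    total : accepted n + rejected n ≡ (d * d) ^ n
    total = trans (sym (∑-+ (V n) _ _)) (trans (∑-cong (V n) (λ x → split (EB (lookup x)))) (trans (∑-const (V n) 1) (trans (*-identityʳ _) (length-V n))))
    n² = n * n
    d-rejected : d * rejected n ≤ n² * (d * d) ^ n
    d-rejected = begin
      d * rejected n ≤⟨ *-monoʳ-≤ d (∑-mono (V n) not-EB) ⟩
      d * ∑ (V n) (λ x → ∑ (allFin n) (λ i → ∑ (allFin n) (λ j → collision i j x)))
        ≡⟨ cong (d *_) (trans (∑-swap (V n) (allFin n) _) (∑-cong (allFin n) (λ i → ∑-swap (V n) (allFin n) _))) ⟩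
      d * ∑ (allFin n) (λ i → ∑ (allFin n) (λ j → ∑ (V n) (collision i j)))
        ≡⟨ trans (sym (∑-*ˡ (allFin n) d _)) (∑-cong (allFin n) (λ i → sym (∑-*ˡ (allFin n) d _))) ⟩
      ∑ (allFin n) (λ i → ∑ (allFin n) (λ j → d * ∑ (V n) (collision i j)))
        ≤⟨ ∑-mono (allFin n) (λ i → ∑-mono (allFin n) (λ j → ∑-collision i j)) ⟩
      ∑ (allFin n) (λ i → ∑ (allFin n) (λ j → (d * d) ^ n)) ≡⟨ trans (∑-cong (allFin n) (λ _ → ∑-allFin-const n _)) (∑-allFin-const n _) ⟩
      n * (n * (d * d) ^ n) ≡⟨ sym (*-assoc n n _) ⟩
      n² * (d * d) ^ n ∎
    n²≢0 : NonZero n²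
    n²≢0 = >-nonZero (*-mono-≤ n>0 n>0)
    2rejected : 2 * rejected n ≤ (d * d) ^ n
    2rejected = *-cancelˡ-≤ n² {{n²≢0}} (begin
      n² * (2 * rejected n) ≡⟨ l n (rejected n) ⟩
      2 * (n * (n * 1)) * rejected n ≤⟨ *-monoˡ-≤ (rejected n) d-large ⟩
      d * rejected n ≤⟨ d-rejected ⟩
      n² * (d * d) ^ n ∎)
      where
      l : ∀ n x → n * n * (2 * x) ≡ 2 * (n * (n * 1)) * x
      l = solve-∀

-- Runs cut into segments

module Runs {n d : ℕ} (P : BranchingProgram n (Fin d × Fin d)) where

  open BranchingProgram P
  open ≤-Reasoning

  Input : Set
  Input = Vec (Fin d × Fin d) n

  -- A sink is its own successor. Runs then exist for every prescribed number of steps, and T need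
  -- not be a multiple of the segment length.
  follow : Node size n (Fin d × Fin d) → Fin size → Input → Fin size
  follow (sink _)       u x = u
  follow (query i next) u x = next (lookup x i)

  next : Fin size → Input → Fin size
  next u = follow (node u) u

  queries : Node size n (Fin d × Fin d) → Fin n → Bool
  queries (sink _)    i = false
  queries (query k _) i = ⌊ i Fin.≟ k ⌋

  run : ℕ → Fin size → Input → Fin size
  run zero    u x = u
  run (suc k) u x = run k (next u x) x

  reads : ℕ → Fin size → Input → Fin n → Bool
  reads zero    u x i = false
  reads (suc k) u x i = queries (node u) i ∨ reads k (next u x) x i

  run-+ : ∀ a b u x → run (a + b) u x ≡ run b (run a u x) x
  run-+ zero    b u x = refl
  run-+ (suc a) b u x = run-+ a b (next u x) x

  next-local : ∀ u x y → (∀ i → queries (node u) i ≡ true → lookup x i ≡ lookup y i) → next u y ≡ next u x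
  next-local u x y h with node u
  ... | sink _    = refl
  ... | query i f = cong f (sym (h i (⌊≟⌋ i)))
    where
    ⌊≟⌋ : ∀ {n} (i : Fin n) → ⌊ i Fin.≟ i ⌋ ≡ true
    ⌊≟⌋ i with i Fin.≟ i
    ... | yes _ = refl
    ... | no ¬p = contradiction refl ¬p

  ∨-left : ∀ {a b} → a ≡ true → a ∨ b ≡ true
  ∨-left refl = refl

  ∨-right : ∀ {a b} → b ≡ true → a ∨ b ≡ true
  ∨-right {true}  _ = refl
  ∨-right {false} e = e

  run-local : ∀ k u x y → (∀ i → reads k u x i ≡ true → lookup x i ≡ lookup y i) →
              run k u y ≡ run k u x × (∀ i → reads k u y i ≡ reads k u x i)
  run-local zero    u x y h = refl , λ _ → refl
  run-local (suc k) u x y h rewrite next-local u x y (λ i e → h i (∨-left e)) =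
    let e , e′ = run-local k (next u x) x y (λ i e → h i (∨-right {queries (node u) i} e))
    in e , λ i → cong (queries (node u) i ∨_) (e′ i)

  reads≤ : ∀ k u x → ∑ (allFin n) (λ i → ⟦ reads k u x i ⟧) ≤ k
  reads≤ zero    u x = ≤-reflexive (∑-zero (allFin n))
  reads≤ (suc k) u x = begin
    ∑ (allFin n) (λ i → ⟦ queries (node u) i ∨ reads k (next u x) x i ⟧) ≤⟨ ∑-mono (allFin n) (λ i → ∨≤ (queries (node u) i) _) ⟩
    ∑ (allFin n) (λ i → ⟦ queries (node u) i ⟧ + ⟦ reads k (next u x) x i ⟧) ≡⟨ ∑-+ (allFin n) _ _ ⟩
    ∑ (allFin n) (λ i → ⟦ queries (node u) i ⟧) + ∑ (allFin n) (λ i → ⟦ reads k (next u x) x i ⟧) ≤⟨ +-mono-≤ (one-query (node u)) (reads≤ k (next u x) x) ⟩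
    suc k ∎
    where
    ∨≤ : ∀ a b → ⟦ a ∨ b ⟧ ≤ ⟦ a ⟧ + ⟦ b ⟧
    ∨≤ true  b = s≤s z≤n
    ∨≤ false b = ≤-refl
    ⌊⌋-𝟙 : ∀ {P : Set} (P? : Dec P) → ⟦ ⌊ P? ⌋ ⟧ ≡ 𝟙 P?
    ⌊⌋-𝟙 (yes _) = refl
    ⌊⌋-𝟙 (no _)  = refl
    one-query : ∀ nd → ∑ (allFin n) (λ i → ⟦ queries nd i ⟧) ≤ 1
    one-query (sink _)    = ≤-trans (≤-reflexive (∑-zero (allFin n))) z≤n
    one-query (query k _) = ≤-trans (≤-reflexive (∑-cong (allFin n) (λ i → ⌊⌋-𝟙 (i Fin.≟ k)))) (∑-unique≤1 Fin._≟_ (Unique.allFin⁺ n) k)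

  step⇒follow : ∀ x {nd v} u → lookup x ⊢ nd ↝ v → follow nd u x ≡ v
  step⇒follow x u step = refl

  step⇒arc : ∀ {x : Fin n → Fin d × Fin d} {nd : Node size n (Fin d × Fin d)} {v} → x ⊢ nd ↝ v → nd ↝ v
  step⇒arc {x} (step {i}) = arc (x i)

  path : ∀ x {u w} → Star (λ u v → x ⊢ node u ↝ v) u w → Path u w
  path x ε        = ε
  path x (s ◅ ss) = step⇒arc s ◅ path x ss

  run-sink : ∀ b k u x → node u ≡ sink b → run k u x ≡ u
  run-sink b zero    u x e = refl
  run-sink b (suc k) u x e rewrite e = run-sink b k u x e

  run-path : ∀ x {u w b} (p : Star (λ u v → lookup x ⊢ node u ↝ v) u w) → node w ≡ sink b → ∀ k →
             BranchingProgram.length P (path (lookup x) p) ≤ k → run k u x ≡ w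
  run-path x {u} {b = b} ε        e k       h       = run-sink b k u x e
  run-path x {u} (s ◅ ss) e (suc k) (s≤s h) = trans (cong (λ v → run k v x) (step⇒follow x u s)) (run-path x ss e k h)

  module Segments (T : ℕ) (computes : Computes EB) (hasLength : HasLength T) where

    run-output : ∀ k x → T ≤ k → run k source x ≡ sinkNode (EB (lookup x))
    run-output k x T≤k = run-path x (computes (lookup x)) (sink-label _) k
      (≤-trans (proj₂ hasLength _ (path (lookup x) (computes (lookup x)))) T≤k)

    sink-injective : ∀ b b′ → sinkNode b ≡ sinkNode b′ → b ≡ b′
    sink-injective b b′ e with trans (sym (sink-label b)) (trans (cong node e) (sink-label b′))
    ... | refl = refl

    module _ (r ℓ : ℕ) (T≤ : T ≤ r * ℓ) where

      trace : Input → Vec (Fin size) (suc r)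
      trace x = tabulate (λ j → run (toℕ j * ℓ) source x)

      -- Each segment starts at the recorded node, not at the node that x reaches. Its reads are
      -- thus defined for every x and depend only on the variables read in that segment.
      readersOf : Vec (Fin size) (suc r) → Input → Fin n → Vec Bool r
      readersOf v x i = tabulate (λ j → reads ℓ (lookup v (inject₁ j)) x i)

      module _ (v : Vec (Fin size) (suc r)) where

        Accepts : Input → Set
        Accepts x = trace x ≡ v × EB (lookup x) ≡ true

        accepts? : ∀ x → Dec (Accepts x)
        accepts? x = ≡-decᵛ Fin._≟_ (trace x) v ×-dec (EB (lookup x) Bool.≟ true)

        Kept : Input → Input → Fin r → Set
        Kept x y j = ∀ i → lookup (readersOf v x i) j ≡ true → lookup x i ≡ lookup y i

        local-run : ∀ x y j → Kept x y j → let u = lookup v (inject₁ j) in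
                    run ℓ u y ≡ run ℓ u x × (∀ i → reads ℓ u y i ≡ reads ℓ u x i)
        local-run x y j h = run-local ℓ (lookup v (inject₁ j)) x y (λ i e → h i (trans (lookup∘tabulate _ j) e))

        trace-step : ∀ x → trace x ≡ v → ∀ j → run ℓ (lookup v (inject₁ j)) x ≡ lookup v (suc j)
        trace-step x refl j = trans
          (cong (λ u → run ℓ u x) (trans (lookup∘tabulate (λ j → run (toℕ j * ℓ) source x) (inject₁ j)) (cong (λ k → run (k * ℓ) source x) (Fin.toℕ-inject₁ j))))
          (trans (sym (run-+ (toℕ j * ℓ) ℓ source x)) (trans (cong (λ k → run k source x) (+-comm (toℕ j * ℓ) ℓ)) (sym (lookup∘tabulate (λ j → run (toℕ j * ℓ) source x) (suc j)))))

        last-node : ∀ x → trace x ≡ v → lookup v (last r) ≡ sinkNode (EB (lookup x))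
        last-node x refl = trans (lookup∘tabulate (λ j → run (toℕ j * ℓ) source x) (last r))
          (trans (cong (λ k → run (k * ℓ) source x) (Fin.toℕ-fromℕ r)) (run-output (r * ℓ) x T≤))

        -- By induction z passes through the recorded nodes: in each segment it follows the path of
        -- whichever of x and x′ agrees with it on the variables read there. So it reaches the
        -- accepting sink.
        spliced : ∀ x x′ z → Accepts x → Accepts x′ → (∀ j → Kept x z j ⊎ Kept x′ z j) →
                  ∀ i k → Bidistinct (lookup z i) (lookup z k)
        spliced x x′ z (tx , ax) (tx′ , _) h = EB-sound z (sink-injective _ _ (trans (sym (run-output (r * ℓ) z T≤))
          (trans (cong (λ k → run (k * ℓ) source z) (sym (Fin.toℕ-fromℕ r))) (trans (same-trace (last r)) (trans (last-node x tx) (cong sinkNode ax))))))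
          where
          stepped : ∀ j → run ℓ (lookup v (inject₁ j)) z ≡ lookup v (suc j)
          stepped j with h j
          ... | inj₁ k = trans (proj₁ (local-run x z j k)) (trace-step x tx j)
          ... | inj₂ k = trans (proj₁ (local-run x′ z j k)) (trace-step x′ tx′ j)
          begins : lookup v zero ≡ source
          begins = cong (λ v → lookup v zero) (sym tx)
          same-trace : ∀ j → run (toℕ j * ℓ) source z ≡ lookup v j
          same-trace = <-weakInduction (λ j → run (toℕ j * ℓ) source z ≡ lookup v j) (sym begins) λ j ih → trans
            (cong (λ k → run k source z) (trans (+-comm ℓ (toℕ j * ℓ)) (cong (λ k → k * ℓ + ℓ) (sym (Fin.toℕ-inject₁ j)))))
            (trans (run-+ (toℕ (inject₁ j) * ℓ) ℓ source z) (trans (cong (λ u → run ℓ u z) ih) (stepped j)))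

        -- Replacing an unread coordinate by a pair (c , c) would go unnoticed.
        every-read : ∀ x → Accepts x → ∀ i → ∃[ j ] lookup (readersOf v x i) j ≡ true
        every-read x acc i with Fin.any? (λ j → lookup (readersOf v x i) j Bool.≟ true)
        ... | yes p = p
        ... | no ¬p = contradiction (trans (cong proj₁ zi) (sym (cong proj₂ zi))) (proj₁ (spliced x x z acc acc (λ j → inj₁ (kept j)) i i))
          where
          c = proj₁ (lookup x i)
          z = x [ i ]≔ (c , c)
          zi : lookup z i ≡ (c , c)
          zi = lookup∘update i x (c , c)
          kept : ∀ j → Kept x z j
          kept j k e with k Fin.≟ i
          ... | yes refl = contradiction (j , e) ¬p
          ... | no k≢i   = sym (lookup∘update′ k≢i x (c , c))

        segmentation : Segmentation d n r
        segmentation = record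
          { Good     = Accepts
          ; good?    = accepts?
          ; readers  = readersOf v
          ; local    = λ x y j h i → trans (lookup∘tabulate _ j) (trans (proj₂ (local-run x y j h) i) (sym (lookup∘tabulate _ j)))
          ; all-read = every-read
          ; splice   = spliced
          }

-- The choice of the parameters

-- Both p and t are O(K), which makes the exponents p t and p K quadratic in K; the K² of the final
-- bound originates here. The constants 100 and 50 leave room over the 79 and 40 that come out.
module Exponents (K p t : ℕ) (K>0 : 1 ≤ K) (bound : p + 2 * t ≤ 4 * K + 3) where

  open ≤-Reasoning

  K² : ℕ
  K² = K * K

  1≤K² : 1 ≤ K²
  1≤K² = *-mono-≤ K>0 K>0

  p≤ : p ≤ 7 * K
  p≤ = begin
    p ≤⟨ ≤-trans (m≤m+n p (2 * t)) bound ⟩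
    4 * K + 3 ≤⟨ +-monoʳ-≤ (4 * K) (*-monoʳ-≤ 3 K>0) ⟩
    4 * K + 3 * K ≡⟨ *-distribʳ-+ K 4 3 ⟨
    7 * K ∎

  t≤2K+1 : t ≤ 2 * K + 1
  t≤2K+1 = ≤-pred (*-cancelˡ-< 2 t (suc (2 * K + 1)) (begin-strict
    2 * t ≤⟨ ≤-trans (m≤n+m (2 * t) p) bound ⟩
    4 * K + 3 <⟨ n<1+n _ ⟩
    suc (4 * K + 3) ≡⟨ l K ⟩
    2 * suc (2 * K + 1) ∎))
    where
    l : ∀ K → suc (4 * K + 3) ≡ 2 * suc (2 * K + 1)
    l = solve-∀

  t≤ : t ≤ 3 * K
  t≤ = begin
    t ≤⟨ t≤2K+1 ⟩
    2 * K + 1 ≤⟨ +-monoʳ-≤ (2 * K) K>0 ⟩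
    2 * K + K ≡⟨ l K ⟩
    3 * K ∎
    where
    l : ∀ K → 2 * K + K ≡ 3 * K
    l = solve-∀

  [p+1]t≤ : suc p * t ≤ 24 * K²
  [p+1]t≤ = begin
    suc p * t ≤⟨ *-mono-≤ (s≤s p≤) t≤ ⟩
    suc (7 * K) * (3 * K) ≤⟨ *-monoˡ-≤ (3 * K) (+-monoˡ-≤ (7 * K) K>0) ⟩
    (K + 7 * K) * (3 * K) ≡⟨ l K ⟩
    24 * K² ∎
    where
    l : ∀ K → (K + 7 * K) * (3 * K) ≡ 24 * (K * K)
    l = solve-∀

  p2K≤ : p * (2 * K) ≤ 14 * K²
  p2K≤ = ≤-trans (*-monoˡ-≤ (2 * K) p≤) (≤-reflexive (l K))
    where
    l : ∀ K → 7 * K * (2 * K) ≡ 14 * (K * K)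
    l = solve-∀

  exponent₁ : suc (suc p * t + suc p * t + (suc (p * (2 * K)) + suc (p * (2 * K)))) ≤ 100 * K²
  exponent₁ = begin
    suc (suc p * t + suc p * t + (suc (p * (2 * K)) + suc (p * (2 * K))))
      ≡⟨ l (suc p * t) (p * (2 * K)) ⟩
    3 * 1 + 2 * (suc p * t) + 2 * (p * (2 * K))
      ≤⟨ +-mono-≤ (+-mono-≤ (*-monoʳ-≤ 3 1≤K²) (*-monoʳ-≤ 2 [p+1]t≤)) (*-monoʳ-≤ 2 p2K≤) ⟩
    3 * K² + 2 * (24 * K²) + 2 * (14 * K²) ≡⟨ l′ K² ⟩
    79 * K² ≤⟨ *-monoˡ-≤ K² (m≤m+n 79 21) ⟩
    100 * K² ∎
    where
    l : ∀ a b → suc (a + a + (suc b + suc b)) ≡ 3 * 1 + 2 * a + 2 * b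
    l = solve-∀
    l′ : ∀ x → 3 * x + 2 * (24 * x) + 2 * (14 * x) ≡ 79 * x
    l′ = solve-∀

  exponent₂ : suc (suc p * t + suc (p * (2 * K))) ≤ 50 * K²
  exponent₂ = begin
    suc (suc p * t + suc (p * (2 * K))) ≡⟨ l (suc p * t) (p * (2 * K)) ⟩
    2 * 1 + suc p * t + p * (2 * K) ≤⟨ +-mono-≤ (+-mono-≤ (*-monoʳ-≤ 2 1≤K²) [p+1]t≤) p2K≤ ⟩
    2 * K² + 24 * K² + 14 * K² ≡⟨ l′ K² ⟩
    40 * K² ≤⟨ *-monoˡ-≤ K² (m≤m+n 40 10) ⟩
    50 * K² ∎
    where
    l : ∀ a b → suc (a + suc b) ≡ 2 * 1 + a + b
    l = solve-∀
    l′ : ∀ x → 2 * x + 24 * x + 14 * x ≡ 40 * x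
    l′ = solve-∀

module Thresholds (B : ℕ) {{B≢0 : NonZero B}} (n p t K M : ℕ)
  (large : n * B ^ (p * t) ≤ M * B ^ suc (p * (2 * K))) where

  open ≤-Reasoning

  n≤ : n ≤ M * B ^ suc (p * (2 * K))
  n≤ = ≤-trans (m≤m*n n (B ^ (p * t)) {{m^n≢0 B (p * t)}}) large

  -- There are at most r ℓ² ≤ (K n)² / r dependent pairs, and n exceeds M by at most a power of B,
  -- so a large enough power r of B makes them negligible against M².
  few-intersections : ∀ r ℓ I w R → r ≡ B ^ R → I ≤ r * (ℓ * ℓ) → r * ℓ ≤ K * n → 12 * w * (K * K) ≤ B →
    suc (suc p * t + suc p * t + (suc (p * (2 * K)) + suc (p * (2 * K)))) ≤ R →
    12 * w * (I * ((B ^ suc p) ^ t * (B ^ suc p) ^ t)) ≤ M * M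
  few-intersections r ℓ I w R refl I≤ rℓ≤ w≤ R≥ = *-cancelˡ-≤ (B ^ R) {{m^n≢0 B R}} (begin
    B ^ R * (12 * w * (I * (Q^t * Q^t))) ≤⟨ *-monoʳ-≤ (B ^ R) (*-monoʳ-≤ (12 * w) (*-monoˡ-≤ (Q^t * Q^t) I≤)) ⟩
    B ^ R * (12 * w * (B ^ R * (ℓ * ℓ) * (Q^t * Q^t))) ≡⟨ l₁ (B ^ R) w ℓ Q^t ⟩
    12 * w * (B ^ R * ℓ * (B ^ R * ℓ)) * (Q^t * Q^t) ≤⟨ *-monoˡ-≤ (Q^t * Q^t) (*-monoʳ-≤ (12 * w) (*-mono-≤ Kn Kn)) ⟩
    12 * w * (K * (M * X) * (K * (M * X))) * (Q^t * Q^t) ≡⟨ l₂ w K M X Q^t ⟩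
    12 * w * (K * K) * (Q^t * Q^t * (X * X)) * (M * M) ≤⟨ *-monoˡ-≤ (M * M) (*-monoˡ-≤ (Q^t * Q^t * (X * X)) w≤) ⟩
    B * (Q^t * Q^t * (X * X)) * (M * M) ≡⟨ cong (_* (M * M)) power ⟩
    B ^ suc (suc p * t + suc p * t + (suc (p * (2 * K)) + suc (p * (2 * K)))) * (M * M) ≤⟨ *-monoˡ-≤ (M * M) (^-monoʳ-≤ B R≥) ⟩
    B ^ R * (M * M) ∎)
    where
    Q^t X : ℕ
    Q^t = (B ^ suc p) ^ t
    X = B ^ suc (p * (2 * K))
    Kn : B ^ R * ℓ ≤ K * (M * X)
    Kn = ≤-trans rℓ≤ (*-monoʳ-≤ K n≤)
    l₁ : ∀ r w ℓ q → r * (12 * w * (r * (ℓ * ℓ) * (q * q))) ≡ 12 * w * (r * ℓ * (r * ℓ)) * (q * q)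
    l₁ = solve-∀
    l₂ : ∀ w K M X q → 12 * w * (K * (M * X) * (K * (M * X))) * (q * q) ≡ 12 * w * (K * K) * (q * q * (X * X)) * (M * M)
    l₂ = solve-∀
    power : B * (Q^t * Q^t * (X * X)) ≡ B ^ suc (suc p * t + suc p * t + (suc (p * (2 * K)) + suc (p * (2 * K))))
    power = cong (B *_) (trans
      (cong₂ _*_ (trans (cong₂ _*_ (^-*-assoc B (suc p) t) (^-*-assoc B (suc p) t)) (sym (^-distribˡ-+-* B (suc p * t) (suc p * t))))
                 (sym (^-distribˡ-+-* B (suc (p * (2 * K))) (suc (p * (2 * K))))))
      (sym (^-distribˡ-+-* B (suc p * t + suc p * t) _)))

  m₀-small : ∀ m₀ R → m₀ * B ^ R ≤ n → 8 ≤ B → suc (suc p * t + suc (p * (2 * K))) ≤ R →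
             8 * (m₀ * (B ^ suc p) ^ t) ≤ M
  m₀-small m₀ R m₀≤ 8≤B R≥ = *-cancelʳ-≤ _ _ X {{m^n≢0 B (suc (p * (2 * K)))}} (begin
    8 * (m₀ * Q^t) * X ≡⟨ l 8 m₀ Q^t X ⟩
    m₀ * (8 * (Q^t * X)) ≤⟨ *-monoʳ-≤ m₀ (*-monoˡ-≤ (Q^t * X) 8≤B) ⟩
    m₀ * (B * (Q^t * X)) ≡⟨ cong (λ x → m₀ * (B * x)) (trans (cong (_* X) (^-*-assoc B (suc p) t)) (sym (^-distribˡ-+-* B (suc p * t) (suc (p * (2 * K)))))) ⟩
    m₀ * B ^ suc (suc p * t + suc (p * (2 * K))) ≤⟨ *-monoʳ-≤ m₀ (^-monoʳ-≤ B R≥) ⟩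
    m₀ * B ^ R ≤⟨ ≤-trans m₀≤ n≤ ⟩
    M * X ∎)
    where
    Q^t X : ℕ
    Q^t = (B ^ suc p) ^ t
    X = B ^ suc (p * (2 * K))
    l : ∀ c m q x → c * (m * q) * x ≡ m * (c * (q * x))
    l = solve-∀

-- Growth of (1 + 1 / L) ^ n

bernoulli : ∀ L j → j ≤ L → suc L ^ j * (L ∸ j) ≤ L ^ suc j
bernoulli L zero    _   = ≤-reflexive (*-comm 1 L)
bernoulli L (suc j) j<L with m≤n⇒∃[o]m+o≡n j<L
... | k , refl = begin
  suc L * suc L ^ j * (suc j + k ∸ suc j) ≡⟨ cong (suc L * suc L ^ j *_) (m+n∸m≡n (suc j) k) ⟩
  suc L * suc L ^ j * k ≡⟨ l₁ (suc L) (suc L ^ j) k ⟩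
  suc L ^ j * (suc L * k) ≤⟨ *-monoʳ-≤ (suc L ^ j) (≤-trans (m≤m+n _ (suc j)) (≤-reflexive (l₂ j k))) ⟩
  suc L ^ j * (suc k * L) ≡⟨ sym (*-assoc (suc L ^ j) (suc k) L) ⟩
  suc L ^ j * suc k * L ≡⟨ cong (λ x → suc L ^ j * x * L) (sym (trans (cong (_∸ j) (sym (+-suc j k))) (m+n∸m≡n j (suc k)))) ⟩
  suc L ^ j * (L ∸ j) * L ≤⟨ *-monoˡ-≤ L (bernoulli L j (<⇒≤ j<L)) ⟩
  L ^ suc j * L ≡⟨ *-comm (L ^ suc j) L ⟩
  L ^ suc (suc j) ∎
  where
  open ≤-Reasoning
  l₁ : ∀ a b c → a * b * c ≡ b * (a * c)
  l₁ = solve-∀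
  l₂ : ∀ j k → suc (suc j + k) * k + suc j ≡ suc k * (suc j + k)
  l₂ = solve-∀

-- The Bernoulli estimate (1 + 1 / L) ^ j (1 - j / L) ≤ 1 at L = 2 h and j = h.
half-power : ∀ h → 1 ≤ h → suc (2 * h) ^ h ≤ 2 * (2 * h) ^ h
half-power h h>0 = *-cancelʳ-≤ _ _ h {{>-nonZero h>0}} (begin
  suc (2 * h) ^ h * h ≡⟨ cong (suc (2 * h) ^ h *_) (sym (trans (m+n∸m≡n h (h + 0)) (+-identityʳ h))) ⟩
  suc (2 * h) ^ h * (2 * h ∸ h) ≤⟨ bernoulli (2 * h) h (m≤m+n h (h + 0)) ⟩
  2 * h * (2 * h) ^ h ≡⟨ l h ((2 * h) ^ h) ⟩
  2 * (2 * h) ^ h * h ∎)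
  where
  open ≤-Reasoning
  l : ∀ h x → 2 * h * x ≡ 2 * x * h
  l = solve-∀

-- Each block of h factors costs at most 2. With L = 4 ^ w and m = m₀ this bounds the total weight
-- (1 + 1 / L) ^ n of all exceptional sets.
compound : ∀ h m n → 1 ≤ h → n ≤ h * m → suc (2 * h) ^ n ≤ 2 ^ m * (2 * h) ^ n
compound h m n h>0 n≤ with m≤n⇒∃[o]m+o≡n n≤
... | k , e = *-cancelʳ-≤ _ _ (L ^ k) {{m^n≢0 L k {{L≢0}}}} (begin
  suc L ^ n * L ^ k ≤⟨ *-monoʳ-≤ (suc L ^ n) (^-monoˡ-≤ k (n≤1+n L)) ⟩
  suc L ^ n * suc L ^ k ≡⟨ trans (sym (^-distribˡ-+-* (suc L) n k)) (cong (suc L ^_) e) ⟩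
  suc L ^ (h * m) ≡⟨ sym (^-*-assoc (suc L) h m) ⟩
  (suc L ^ h) ^ m ≤⟨ ^-monoˡ-≤ m (half-power h h>0) ⟩
  (2 * L ^ h) ^ m ≡⟨ distrib m ⟩
  2 ^ m * (L ^ h) ^ m ≡⟨ cong (2 ^ m *_) (trans (^-*-assoc L h m) (trans (cong (L ^_) (sym e)) (^-distribˡ-+-* L n k))) ⟩
  2 ^ m * (L ^ n * L ^ k) ≡⟨ sym (*-assoc (2 ^ m) (L ^ n) (L ^ k)) ⟩
  2 ^ m * L ^ n * L ^ k ∎)
  where
  open ≤-Reasoning
  L = 2 * h
  L≢0 : NonZero L
  L≢0 = >-nonZero (≤-trans h>0 (m≤m+n h (h + 0)))
  l : ∀ a b c → 2 * a * (b * c) ≡ 2 * b * (a * c)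
  l = solve-∀
  distrib : ∀ m → (2 * L ^ h) ^ m ≡ 2 ^ m * (L ^ h) ^ m
  distrib zero    = refl
  distrib (suc m) = trans (cong (2 * L ^ h *_) (distrib m)) (l (L ^ h) (2 ^ m) _)

-- Counting reads and common segments

count-∑ : ∀ {r} (b : Vec Bool r) → count b ≡ ∑ (allFin r) (λ j → ⟦ lookup b j ⟧)
count-∑ []              = refl
count-∑ {suc r} (true  ∷ b) = trans (cong suc (count-∑ b)) (sym (∑-allFin-suc r (λ j → ⟦ lookup (true ∷ b) j ⟧)))
count-∑ {suc r} (false ∷ b) = trans (count-∑ b) (sym (∑-allFin-suc r (λ j → ⟦ lookup (false ∷ b) j ⟧)))

count>0 : ∀ {r} (b : Vec Bool r) j → lookup b j ≡ true → 1 ≤ count b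
count>0 (true  ∷ b) j       e = s≤s z≤n
count>0 (false ∷ b) (suc j) e = count>0 b j e

meets≤ : ∀ {r} (b b′ : Vec Bool r) → ⟦ meets b b′ ⟧ ≤ ∑ (allFin r) (λ j → ⟦ lookup b j ⟧ * ⟦ lookup b′ j ⟧)
meets≤ []              []        = z≤n
meets≤ {suc r} (x ∷ b) (y ∷ b′) = ≤-trans (head x y) (≤-reflexive (sym (∑-allFin-suc r (λ j → ⟦ lookup (x ∷ b) j ⟧ * ⟦ lookup (y ∷ b′) j ⟧))))
  where
  tail : ℕ
  tail = ∑ (allFin r) (λ j → ⟦ lookup b j ⟧ * ⟦ lookup b′ j ⟧)
  head : ∀ x y → ⟦ (x ∧ y) ∨ meets b b′ ⟧ ≤ ⟦ x ⟧ * ⟦ y ⟧ + tail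
  head true  true  = s≤s z≤n
  head true  false = meets≤ b b′
  head false y     = meets≤ b b′

concat-∑≤ : ∀ {n r} (col : Fin n → Vec Bool r) ℓ → (∀ j → ∑ (allFin n) (λ i → ⟦ lookup (col i) j ⟧) ≤ ℓ) →
            ∑ (allFin n) (count ∘ col) ≤ r * ℓ
concat-∑≤ {n} {r} col ℓ h = begin
  ∑ (allFin n) (count ∘ col) ≡⟨ ∑-cong (allFin n) (count-∑ ∘ col) ⟩
  ∑ (allFin n) (λ i → ∑ (allFin r) (λ j → ⟦ lookup (col i) j ⟧)) ≡⟨ ∑-swap (allFin n) (allFin r) (λ i j → ⟦ lookup (col i) j ⟧) ⟩
  ∑ (allFin r) (λ j → ∑ (allFin n) (λ i → ⟦ lookup (col i) j ⟧)) ≤⟨ ∑-mono (allFin r) h ⟩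
  ∑ (allFin r) (λ _ → ℓ) ≡⟨ ∑-allFin-const r ℓ ⟩
  r * ℓ ∎
  where open ≤-Reasoning

-- Each pair is charged to its common segments, and a segment reading at most ℓ variables is charged
-- at most ℓ² times.
intersections≤ : ∀ {n r} (col : Fin n → Vec Bool r) ℓ → (∀ j → ∑ (allFin n) (λ i → ⟦ lookup (col i) j ⟧) ≤ ℓ) →
                 intersections col ≤ r * (ℓ * ℓ)
intersections≤ {n} {r} col ℓ h = begin
  intersections col
    ≤⟨ ∑-mono (allFin n) (λ i → ∑-mono (allFin n) (λ k → meets≤ (col i) (col k))) ⟩
  ∑ (allFin n) (λ i → ∑ (allFin n) (λ k → ∑ (allFin r) (λ j → b i j * b k j)))
    ≡⟨ ∑-cong (allFin n) (λ i → ∑-swap (allFin n) (allFin r) (λ k j → b i j * b k j)) ⟩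
  ∑ (allFin n) (λ i → ∑ (allFin r) (λ j → ∑ (allFin n) (λ k → b i j * b k j)))
    ≡⟨ ∑-swap (allFin n) (allFin r) (λ i j → ∑ (allFin n) (λ k → b i j * b k j)) ⟩
  ∑ (allFin r) (λ j → ∑ (allFin n) (λ i → ∑ (allFin n) (λ k → b i j * b k j)))
    ≡⟨ ∑-cong (allFin r) (λ j → sym (∑-∑-* (allFin n) (allFin n) (λ i → b i j) (λ k → b k j))) ⟩
  ∑ (allFin r) (λ j → ∑ (allFin n) (λ i → b i j) * ∑ (allFin n) (λ k → b k j))
    ≤⟨ ∑-mono (allFin r) (λ j → *-mono-≤ (h j) (h j)) ⟩
  ∑ (allFin r) (λ _ → ℓ * ℓ) ≡⟨ ∑-allFin-const r (ℓ * ℓ) ⟩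
  r * (ℓ * ℓ) ∎
  where
  open ≤-Reasoning
  b : Fin n → Fin r → ℕ
  b i j = ⟦ lookup (col i) j ⟧

number>0⇒≤ : ∀ {n r} (size : Fin n → ℕ) t → (∀ i → size i ≤ r) → 1 ≤ number size t → t ≤ r
number>0⇒≤ {n} {r} size t h pos with t ≤? r
... | yes le = le
... | no  gt = contradiction (subst (1 ≤_) none pos) λ ()
  where
  none : number size t ≡ 0
  none = trans (∑-cong (allFin n) (λ i → 𝟙-no (size i ≟ t) (λ e → gt (subst (_≤ r) e (h i))))) (∑-zero (allFin n))

choose-colouring : ∀ {n r} (col : Fin n → Vec Bool r) (K B w m₀ ℓ R M : ℕ) → 1 ≤ n → 1 ≤ K → 1 ≤ w →
  (∀ i → 1 ≤ count (col i)) → (∀ j → ∑ (allFin n) (λ i → ⟦ lookup (col i) j ⟧) ≤ ℓ) → r * ℓ ≤ K * n →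
  r ≡ B ^ R → 100 * (K * K) ≤ R → m₀ * B ^ M ≤ n → 50 * (K * K) ≤ M →
  (2 * K + 2) * (96 * w) ≤ B → 12 * w * (K * K) ≤ B →
  ∃[ F ] ∃[ t ] t ≤ r × (∀ s → m₀ + w * ∑ (allFin n) (λ i → ⟦ exceptional s t F (col i) ⟧) ≤ ∑ (allFin n) (λ i → ⟦ only (not s) F (col i) ⟧))
choose-colouring {n} {r} col K B w m₀ ℓ R M n>0 K>0 w>0 read row rℓ≤ r≡ R≥ m₀≤ M≥ B≥₁ B≥₂ =
  let p , t , t>0 , bound , dom , large , pos = Level.level {n} {r} size K B read (count≤ ∘ col) (≤-trans (concat-∑≤ col ℓ row) rℓ≤) K>0 n>0 B-large
      module Ex = Exponents K p t K>0 bound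
      module Th = Thresholds B {{B≢0}} n p t K (number size t) large
      -- The weight of the uncoloured state is Q - 2, as each of the two colours has weight 1.
      F , prop = Choice.choice col (B ^ suc p ∸ 2) (B ^ suc p) (sym (m+[n∸m]≡n (2≤Q p))) t B w m₀ w>0
                   (≤-trans (*-monoˡ-≤ (96 * w) (≤-trans (s≤s Ex.t≤2K+1) (≤-reflexive (l₁ K)))) B≥₁) dom
                   (Th.few-intersections r ℓ (intersections col) w R r≡ (intersections≤ col ℓ row) rℓ≤ B≥₂ (≤-trans Ex.exponent₁ R≥))
                   (Th.m₀-small m₀ M m₀≤ 8≤B (≤-trans Ex.exponent₂ M≥)) pos
  in F , t , number>0⇒≤ size t (count≤ ∘ col) pos , prop
  where
  open ≤-Reasoning
  size : Fin n → ℕ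
  size = count ∘ col
  l₁ : ∀ K → suc (2 * K + 1) ≡ 2 * K + 2
  l₁ = solve-∀
  B≥′ : (2 * K + 2) * 96 ≤ B
  B≥′ = ≤-trans (*-monoʳ-≤ (2 * K + 2) (≤-trans (≤-reflexive (sym (*-identityʳ 96))) (*-monoʳ-≤ 96 w>0))) B≥₁
  96≤B : 96 ≤ B
  96≤B = ≤-trans (*-monoˡ-≤ 96 {1} {2 * K + 2} (≤-trans (s≤s z≤n) (m≤n+m 2 (2 * K)))) B≥′
  8≤B : 8 ≤ B
  8≤B = ≤-trans (m≤m+n 8 88) 96≤B
  B≢0 : NonZero B
  B≢0 = >-nonZero (≤-trans (s≤s z≤n) 8≤B)
  B-large : 2 * (2 * K + 1) ≤ B
  B-large = ≤-trans (≤-trans (*-monoʳ-≤ 2 (+-monoʳ-≤ (2 * K) (s≤s z≤n))) (≤-trans (*-monoˡ-≤ (2 * K + 2) (m≤m+n 2 94)) (≤-reflexive (*-comm 96 (2 * K + 2))))) B≥′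
  2≤Q : ∀ p → 2 ≤ B ^ suc p
  2≤Q p = ≤-trans (≤-trans (m≤m+n 2 6) 8≤B) (m≤m*n B (B ^ p) {{m^n≢0 B p {{B≢0}}}})

-- Union bound over hints and exceptional sets

colours : List Colour
colours = nothing ∷ just false ∷ just true ∷ []

∈-colours : ∀ k → k ∈ colours
∈-colours nothing      = here refl
∈-colours (just false) = there (here refl)
∈-colours (just true)  = there (there (here refl))

bools : List Bool
bools = true ∷ false ∷ []

∈-bools : ∀ b → b ∈ bools
∈-bools true  = here refl
∈-bools false = there (here refl)

∣_∣ₑ : ∀ {n} → Vec Bool n → ℕ
∣_∣ₑ {n} E = ∑ (allFin n) (λ i → ⟦ lookup E i ⟧)

-- The binomial theorem, as a sum over subsets.
∑-complement : ∀ n L → ∑ (vecs bools n) (λ E → ∏ (λ i → if lookup E i then 1 else L)) ≡ suc L ^ n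
∑-complement n L = trans (∑-vecs-∏ bools n (λ _ b → if b then 1 else L))
  (trans (∏-cong {n} (λ _ → cong suc (+-identityʳ L))) (∏-const n (suc L)))

complement-* : ∀ {n} (E : Vec Bool n) L → L ^ ∣ E ∣ₑ * ∏ (λ i → if lookup E i then 1 else L) ≡ L ^ n
complement-* {n} E L = trans (cong (_* ∏ (λ i → if lookup E i then 1 else L)) (sym (∏-if (lookup E) L)))
  (trans (sym (∏-* (λ i → if lookup E i then L else 1) (λ i → if lookup E i then 1 else L)))
    (trans (∏-cong (λ i → pointwise (lookup E i))) (∏-const n L)))
  where
  pointwise : ∀ b → (if b then L else 1) * (if b then 1 else L) ≡ L
  pointwise true  = *-identityʳ L
  pointwise false = +-identityʳ L

union-bound : ∀ {X H E : Set} (V : List X) (hs : List H) (Es : List E) (b : X → Bool) (c : H → E → X → ℕ) k m →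
              (∀ x → b x ≡ true → ∃[ h ] ∃[ e ] h ∈ hs × e ∈ Es × c h e x ≡ 1) →
              (∀ h → ∑ Es (λ e → ∑ V (c h e)) * k ≤ m) → ∑ V (λ x → ⟦ b x ⟧) * k ≤ length hs * m
union-bound V hs Es b c k m covered bounded = begin
  ∑ V (λ x → ⟦ b x ⟧) * k ≤⟨ *-monoˡ-≤ k (∑-mono V (λ x → cover x (b x) refl)) ⟩
  ∑ V (λ x → ∑ hs (λ h → ∑ Es (λ e → c h e x))) * k
    ≡⟨ cong (_* k) (trans (∑-swap V hs (λ x h → ∑ Es (λ e → c h e x))) (∑-cong hs (λ h → ∑-swap V Es (λ x e → c h e x)))) ⟩
  ∑ hs (λ h → ∑ Es (λ e → ∑ V (c h e))) * k ≡⟨ sym (∑-*ʳ hs _ k) ⟩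
  ∑ hs (λ h → ∑ Es (λ e → ∑ V (c h e)) * k) ≤⟨ ∑-mono hs bounded ⟩
  ∑ hs (λ _ → m) ≡⟨ ∑-const hs m ⟩
  length hs * m ∎
  where
  open ≤-Reasoning
  cover : ∀ x β → b x ≡ β → ⟦ β ⟧ ≤ ∑ hs (λ h → ∑ Es (λ e → c h e x))
  cover x false _ = z≤n
  cover x true  p with covered x p
  ... | h , e , h∈ , e∈ , one = begin
    1 ≡⟨ sym one ⟩
    c h e x ≤⟨ ∈⇒≤∑ (λ e → c h e x) e∈ ⟩
    ∑ Es (λ e → c h e x) ≤⟨ ∈⇒≤∑ (λ h → ∑ Es (λ e → c h e x)) h∈ ⟩
    ∑ hs (λ h → ∑ Es (λ e → c h e x)) ∎

module Advice {n d : ℕ} (P : BranchingProgram n (Fin d × Fin d)) (T : ℕ)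
  (computes : BranchingProgram.Computes P EB) (hasLength : BranchingProgram.HasLength P T)
  (r ℓ : ℕ) (T≤ : T ≤ r * ℓ) (w m₀ : ℕ) (d>0 : 1 ≤ d)
  (colouring : ∀ (col : Fin n → Vec Bool r) → (∀ i → 1 ≤ count (col i)) → (∀ j → ∑ (allFin n) (λ i → ⟦ lookup (col i) j ⟧) ≤ ℓ) →
    ∃[ F ] ∃[ t ] t ≤ r × (∀ s → m₀ + w * ∑ (allFin n) (λ i → ⟦ exceptional s t F (col i) ⟧) ≤ ∑ (allFin n) (λ i → ⟦ only (not s) F (col i) ⟧)))
  where

  open BranchingProgram P using (size; source)
  open Runs P
  open Segments T computes hasLength
  open ≤-Reasoning

  Trace : Set
  Trace = Vec (Fin size) (suc r)

  -- Cut nodes, colouring, colour of the narrow leg, and t: these depend on the input and are simply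
  -- counted. The exceptional set is kept apart, as there are too many of them and each has to be
  -- weighted by its size.
  Hint : Set
  Hint = Trace × Vec Colour r × Bool × Fin (suc r)

  hints : List Hint
  hints = cartesianProduct (vecs (allFin size) (suc r)) (cartesianProduct (vecs colours r) (cartesianProduct bools (allFin (suc r))))

  ∈-hints : ∀ h → h ∈ hints
  ∈-hints (v , F , s , t) = ∈-cartesianProduct⁺ (∈-vecs (allFin size) ∈-allFin v)
    (∈-cartesianProduct⁺ (∈-vecs colours ∈-colours F) (∈-cartesianProduct⁺ (∈-bools s) (∈-allFin t)))

  length-hints : length hints ≡ size ^ suc r * (3 ^ r * (2 * suc r))
  length-hints = trans (length-cartesianProductWith _,_ (vecs (allFin size) (suc r)) _) (cong₂ _*_
    (trans (length-vecs (allFin size) (suc r)) (cong (_^ suc r) (List.length-tabulate {n = size} id)))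
    (trans (length-cartesianProductWith _,_ (vecs colours r) _) (cong₂ _*_ (length-vecs colours r)
      (trans (length-cartesianProductWith _,_ bools (allFin (suc r))) (cong (2 *_) (List.length-tabulate {n = suc r} id))))))

  seg : Trace → Segmentation d n r
  seg v = segmentation r ℓ T≤ v

  Caught : Hint → Vec Bool n → Input → Set
  Caught (v , F , s , t) E = Rectangles.Count.Extreme (seg v) F s (toℕ t) E (m₀ + w * ∣ E ∣ₑ) d>0

  caught? : ∀ h E x → Dec (Caught h E x)
  caught? (v , F , s , t) E = Rectangles.Count.extreme? (seg v) F s (toℕ t) E (m₀ + w * ∣ E ∣ₑ) d>0

  caught-count : ∀ h E → ∑ (all-inputs d n) (λ x → 𝟙 (caught? h E x)) * 4 ^ (m₀ + w * ∣ E ∣ₑ) ≤ (d * d) ^ n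
  caught-count (v , F , s , t) E = Rectangles.Count.extreme-count (seg v) F s (toℕ t) E (m₀ + w * ∣ E ∣ₑ) d>0

  -- Which leg is narrow is known only after the colouring is chosen, so `colouring` controls both
  -- colours; its clause for `not s` bounds the exceptional set of `not s` by the core of s.
  catch : ∀ x → EB (lookup x) ≡ true → ∃[ h ] ∃[ E ] Caught h E x
  catch x acc = [ (λ nar → caught true nar) , (λ nar → caught false nar) ]′ (Rectangles.some-narrow (seg v) F (λ u → Rectangles.core (seg v) F u x) x)
    where
    v = trace r ℓ T≤ x
    col : Fin n → Vec Bool r
    col = readersOf r ℓ T≤ v x
    accepts : Accepts r ℓ T≤ v x
    accepts = refl , acc
    col>0 : ∀ i → 1 ≤ count (col i)
    col>0 i = let j , e = every-read r ℓ T≤ v x accepts i in count>0 (col i) j e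
    row : ∀ j → ∑ (allFin n) (λ i → ⟦ lookup (col i) j ⟧) ≤ ℓ
    row j = ≤-trans (≤-reflexive (∑-cong (allFin n) (λ i → cong ⟦_⟧ (lookup∘tabulate _ j)))) (reads≤ ℓ (lookup v (inject₁ j)) x)
    coloured = colouring col col>0 row
    F = proj₁ coloured
    t = proj₁ (proj₂ coloured)
    t≤r = proj₁ (proj₂ (proj₂ coloured))
    prop = proj₂ (proj₂ (proj₂ coloured))
    τ : Fin (suc r)
    τ = fromℕ< (s≤s t≤r)
    τ≡t : toℕ τ ≡ t
    τ≡t = Fin.toℕ-fromℕ< (s≤s t≤r)
    caught : ∀ s → Rectangles.Narrow (seg v) F s (λ u → Rectangles.core (seg v) F u x) x → ∃[ h ] ∃[ E ] Caught h E x
    caught s nar = (v , F , s , τ) , E , accepts , (λ i → sym (lookup∘tabulate _ i)) , nar , (begin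
      m₀ + w * ∣ E ∣ₑ ≡⟨ cong (λ k → m₀ + w * k) (∑-cong (allFin n) (λ i → cong ⟦_⟧ (trans (lookup∘tabulate _ i) (cong (λ t → exceptional (not s) t F (col i)) τ≡t)))) ⟩
      m₀ + w * ∑ (allFin n) (λ i → ⟦ exceptional (not s) t F (col i) ⟧) ≤⟨ prop (not s) ⟩
      ∑ (allFin n) (λ i → ⟦ only (not (not s)) F (col i) ⟧) ≡⟨ cong (λ s → ∑ (allFin n) (λ i → ⟦ only s F (col i) ⟧)) (Bool.not-involutive s) ⟩
      ∑ (allFin n) (λ i → ⟦ only s F (col i) ⟧) ∎)
      where
      E : Vec Bool n
      E = tabulate (λ i → exceptional (not s) (toℕ τ) F (col i))

  L : ℕ
  L = 4 ^ w

  -- After multiplication by 4 ^ m₀ L ^ n the bound 4 ^ (-(m₀ + w ∣ E ∣)) for a single E becomes L ^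
  -- (n - ∣ E ∣), and these add up to (1 + L) ^ n.
  hint-count : ∀ h → ∑ (vecs bools n) (λ E → ∑ (all-inputs d n) (λ x → 𝟙 (caught? h E x))) * (4 ^ m₀ * L ^ n) ≤ (d * d) ^ n * suc L ^ n
  hint-count h = begin
    ∑ Es c * (4 ^ m₀ * L ^ n) ≡⟨ sym (∑-*ʳ Es c _) ⟩
    ∑ Es (λ E → c E * (4 ^ m₀ * L ^ n)) ≤⟨ ∑-mono Es pointwise ⟩
    ∑ Es (λ E → (d * d) ^ n * ∏ (λ i → if lookup E i then 1 else L)) ≡⟨ ∑-*ˡ Es ((d * d) ^ n) _ ⟩
    (d * d) ^ n * ∑ Es (λ E → ∏ (λ i → if lookup E i then 1 else L)) ≡⟨ cong ((d * d) ^ n *_) (∑-complement n L) ⟩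
    (d * d) ^ n * suc L ^ n ∎
    where
    Es = vecs bools n
    c : Vec Bool n → ℕ
    c E = ∑ (all-inputs d n) (λ x → 𝟙 (caught? h E x))
    pointwise : ∀ E → c E * (4 ^ m₀ * L ^ n) ≤ (d * d) ^ n * ∏ (λ i → if lookup E i then 1 else L)
    pointwise E = begin
      c E * (4 ^ m₀ * L ^ n) ≡⟨ cong (λ x → c E * (4 ^ m₀ * x)) (sym (complement-* E L)) ⟩
      c E * (4 ^ m₀ * (L ^ ∣ E ∣ₑ * C)) ≡⟨ l (c E) (4 ^ m₀) (L ^ ∣ E ∣ₑ) C ⟩
      c E * (4 ^ m₀ * L ^ ∣ E ∣ₑ) * C ≡⟨ cong (λ x → c E * x * C) (trans (cong (4 ^ m₀ *_) (^-*-assoc 4 w ∣ E ∣ₑ)) (sym (^-distribˡ-+-* 4 m₀ (w * ∣ E ∣ₑ)))) ⟩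
      c E * 4 ^ (m₀ + w * ∣ E ∣ₑ) * C ≤⟨ *-monoˡ-≤ C (caught-count h E) ⟩
      (d * d) ^ n * C ∎
      where
      C : ℕ
      C = ∏ (λ i → if lookup E i then 1 else L)
      l : ∀ a b x y → a * (b * (x * y)) ≡ a * (b * x) * y
      l = solve-∀

  accepted-bound : Collisions.accepted d n * (4 ^ m₀ * L ^ n) ≤ size ^ suc r * (3 ^ r * (2 * suc r)) * ((d * d) ^ n * suc L ^ n)
  accepted-bound = subst (λ k → Collisions.accepted d n * (4 ^ m₀ * L ^ n) ≤ k * ((d * d) ^ n * suc L ^ n)) length-hints
    (union-bound (all-inputs d n) hints (vecs bools n) (λ x → EB (lookup x)) (λ h E x → 𝟙 (caught? h E x)) _ _
      (λ x acc → let h , E , c = catch x acc in h , E , ∈-hints h , ∈-vecs bools ∈-bools E , 𝟙-yes (caught? h E x) c)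
      hint-count)

-- Numerical parameters and the bound on n

m<[1+m/n]*n : ∀ m n {{_ : NonZero n}} → m < suc (m / n) * n
m<[1+m/n]*n m n = begin-strict
  m ≡⟨ m≡m%n+[m/n]*n m n ⟩
  m % n + m / n * n <⟨ +-monoˡ-< (m / n * n) (m%n<n m n) ⟩
  suc (m / n) * n ∎
  where open ≤-Reasoning

^-cancelˡ-≤ : ∀ m k → 2 ^ m ≤ 2 ^ k → m ≤ k
^-cancelˡ-≤ m k le = ≮⇒≥ λ gt → <⇒≱ (^-monoʳ-< 2 ≤-refl gt) le

n<2^n : ∀ n → suc n ≤ 2 ^ n
n<2^n zero    = ≤-refl
n<2^n (suc n) = begin
  suc (suc n) ≤⟨ +-mono-≤ (m^n>0 2 n) (n<2^n n) ⟩
  2 ^ n + 2 ^ n ≡⟨ cong (2 ^ n +_) (sym (+-identityʳ (2 ^ n))) ⟩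
  2 ^ suc n ∎
  where open ≤-Reasoning

module Parameters (κ : ℕ) where

  open ≤-Reasoning

  -- K is a power of two, so that all parameters have explicit logarithms. `B≥₁` uses B ≥ 2 ^ 20 K ^
  -- 4 and `B≥₂` uses B ≥ 2 ^ 15 K ^ 5; β serves both. The choice of w makes 4 ^ w equal to 4 B ^ M.
  K K² β w : ℕ
  K  = 2 ^ κ
  K² = K * K
  β  = 5 * κ + 20
  w  = 25 * K² * β + 1

  B : ℕ
  B = 2 ^ β

  K>0 : 1 ≤ K
  K>0 = m^n>0 2 κ

  K²>0 : 1 ≤ K²
  K²>0 = *-mono-≤ K>0 K>0

  w>0 : 1 ≤ w
  w>0 = m≤n+m 1 (25 * K² * β)

  w≤ : w ≤ 26 * (K² * β)
  w≤ = begin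
    25 * K² * β + 1 ≤⟨ +-monoʳ-≤ (25 * K² * β) (*-mono-≤ K²>0 (≤-trans (s≤s z≤n) (m≤n+m 20 (5 * κ)))) ⟩
    25 * K² * β + K² * β ≡⟨ l K² β ⟩
    26 * (K² * β) ∎
    where
    l : ∀ a b → 25 * a * b + a * b ≡ 26 * (a * b)
    l = solve-∀

  -- B must exceed a multiple of w, and w contains β = log₂ B as a factor; this crude bound breaks
  -- the circle.
  β≤ : β ≤ 2 ^ (6 + κ)
  β≤ = begin
    5 * κ + 20 ≤⟨ +-mono-≤ (*-monoˡ-≤ κ (m≤m+n 5 59)) (m≤m+n 20 44) ⟩
    64 * κ + 64 ≡⟨ l κ ⟩
    64 * suc κ ≤⟨ *-monoʳ-≤ 64 (n<2^n κ) ⟩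
    64 * K ≡⟨ sym (^-distribˡ-+-* 2 6 κ) ⟩
    2 ^ (6 + κ) ∎
    where
    l : ∀ k → 64 * k + 64 ≡ 64 * suc k
    l = solve-∀

  powers-≤ : ∀ {x y} a b → x ≤ 2 ^ a → y ≤ 2 ^ b → x * y ≤ 2 ^ (a + b)
  powers-≤ a b x≤ y≤ = ≤-trans (*-mono-≤ x≤ y≤) (≤-reflexive (sym (^-distribˡ-+-* 2 a b)))

  K²≤ : K² ≤ 2 ^ (κ + κ)
  K²≤ = powers-≤ κ κ ≤-refl ≤-refl

  w≤2^ : w ≤ 2 ^ (5 + (κ + κ + (6 + κ)))
  w≤2^ = ≤-trans w≤ (powers-≤ 5 (κ + κ + (6 + κ)) (m≤m+n 26 6) (powers-≤ (κ + κ) (6 + κ) K²≤ β≤))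

  2K+2≤ : 2 * K + 2 ≤ 2 ^ (2 + κ)
  2K+2≤ = begin
    2 * K + 2 ≤⟨ +-monoʳ-≤ (2 * K) (*-monoʳ-≤ 2 K>0) ⟩
    2 * K + 2 * K ≡⟨ l K ⟩
    2 ^ (2 + κ) ∎
    where
    l : ∀ k → 2 * k + 2 * k ≡ 2 * (2 * k)
    l = solve-∀

  B≥₁ : (2 * K + 2) * (96 * w) ≤ B
  B≥₁ = begin
    (2 * K + 2) * (96 * w) ≤⟨ powers-≤ (2 + κ) (7 + (5 + (κ + κ + (6 + κ)))) 2K+2≤ (powers-≤ 7 (5 + (κ + κ + (6 + κ))) (m≤m+n 96 32) w≤2^) ⟩
    2 ^ (2 + κ + (7 + (5 + (κ + κ + (6 + κ))))) ≡⟨ cong (2 ^_) (l κ) ⟩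
    2 ^ (4 * κ + 20) ≤⟨ ^-monoʳ-≤ 2 (+-monoˡ-≤ 20 (*-monoˡ-≤ κ (n≤1+n 4))) ⟩
    B ∎
    where
    l : ∀ κ → 2 + κ + (7 + (5 + (κ + κ + (6 + κ)))) ≡ 4 * κ + 20
    l = solve-∀

  B≥₂ : 12 * w * K² ≤ B
  B≥₂ = begin
    12 * w * K² ≤⟨ powers-≤ (4 + (5 + (κ + κ + (6 + κ)))) (κ + κ) (powers-≤ 4 (5 + (κ + κ + (6 + κ))) (m≤m+n 12 4) w≤2^) K²≤ ⟩
    2 ^ (4 + (5 + (κ + κ + (6 + κ))) + (κ + κ)) ≡⟨ cong (2 ^_) (l κ) ⟩
    2 ^ (5 * κ + 15) ≤⟨ ^-monoʳ-≤ 2 (+-monoʳ-≤ (5 * κ) (m≤m+n 15 5)) ⟩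
    B ∎
    where
    l : ∀ κ → 4 + (5 + (κ + κ + (6 + κ))) + (κ + κ) ≡ 5 * κ + 15
    l = solve-∀

  R M r : ℕ
  R = 100 * K²
  M = 50 * K²
  r = B ^ R

  instance
    B≢0 : NonZero B
    B≢0 = m^n≢0 2 β
    B^M≢0 : NonZero (B ^ M)
    B^M≢0 = m^n≢0 B M
    r≢0 : NonZero r
    r≢0 = m^n≢0 B R

  4^w≡ : 4 ^ w ≡ 2 * (2 * B ^ M)
  4^w≡ = begin-equality
    4 ^ (25 * K² * β + 1) ≡⟨ cong (4 ^_) (+-comm (25 * K² * β) 1) ⟩
    4 * 4 ^ (25 * K² * β) ≡⟨ cong (4 *_) (trans (^-*-assoc 2 2 (25 * K² * β)) (trans (cong (2 ^_) (l K² β)) (sym (^-*-assoc 2 β M)))) ⟩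
    4 * B ^ M ≡⟨ *-assoc 2 2 (B ^ M) ⟩
    2 * (2 * B ^ M) ∎
    where
    l : ∀ a b → 2 * (25 * a * b) ≡ b * (50 * a)
    l = solve-∀

  -- 151 = 100 + 50 + 1 are the exponents of r, B ^ M and one spare B in units of K², and 755 = 5 ·
  -- 151 because β = 5 (κ + 4).
  power-bound : ∀ e → e ≤ 151 * K² → B ^ e ≤ 2 ^ (755 * (K² * (κ + 4)))
  power-bound e e≤ = begin
    B ^ e ≤⟨ ^-monoʳ-≤ B e≤ ⟩
    B ^ (151 * K²) ≡⟨ ^-*-assoc 2 β (151 * K²) ⟩
    2 ^ (β * (151 * K²)) ≡⟨ cong (2 ^_) (l κ K²) ⟩
    2 ^ (755 * (K² * (κ + 4))) ∎
    where
    l : ∀ κ a → (5 * κ + 20) * (151 * a) ≡ 755 * (a * (κ + 4))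
    l = solve-∀

-- Of 4 ^ m₀ = 2 ^ m₀ · 2 ^ m₀, one factor pays for the exceptional sets and the other remains as a
-- lower bound on the number of hints.
free-bound : ∀ N acc hints m₀ L^n 1+L^n → 1 ≤ N → 1 ≤ L^n → N ≤ 2 * acc → acc * (4 ^ m₀ * L^n) ≤ hints * (N * 1+L^n) →
          1+L^n ≤ 2 ^ m₀ * L^n → 2 ^ m₀ ≤ 2 * hints
free-bound N acc hints m₀ L^n 1+L^n N>0 L>0 half bound comp =
  *-cancelʳ-≤ _ _ (2 ^ m₀ * L^n * N) {{>-nonZero (*-mono-≤ (*-mono-≤ (m^n>0 2 m₀) L>0) N>0)}} (begin
    2 ^ m₀ * (2 ^ m₀ * L^n * N) ≡⟨ l₁ (2 ^ m₀) L^n N ⟩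
    N * (2 ^ m₀ * 2 ^ m₀ * L^n) ≡⟨ cong (λ x → N * (x * L^n)) (sym (^-distribʳ-* m₀ 2 2)) ⟩
    N * (4 ^ m₀ * L^n) ≤⟨ *-monoˡ-≤ (4 ^ m₀ * L^n) half ⟩
    2 * acc * (4 ^ m₀ * L^n) ≡⟨ *-assoc 2 acc _ ⟩
    2 * (acc * (4 ^ m₀ * L^n)) ≤⟨ *-monoʳ-≤ 2 bound ⟩
    2 * (hints * (N * 1+L^n)) ≤⟨ *-monoʳ-≤ 2 (*-monoʳ-≤ hints (*-monoʳ-≤ N comp)) ⟩
    2 * (hints * (N * (2 ^ m₀ * L^n))) ≡⟨ l₂ hints N (2 ^ m₀ * L^n) ⟩
    2 * hints * (2 ^ m₀ * L^n * N) ∎)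
  where
  open ≤-Reasoning
  l₁ : ∀ a b c → a * (a * b * c) ≡ c * (a * a * b)
  l₁ = solve-∀
  l₂ : ∀ a b c → 2 * (a * (b * c)) ≡ 2 * a * (c * b)
  l₂ = solve-∀

hints≤ : ∀ size σ r → size ≤ 2 ^ σ → 2 * (size ^ suc r * (3 ^ r * (2 * suc r))) ≤ 2 ^ (σ * suc r + (3 * r + 2))
hints≤ size σ r size≤ = begin
  2 * (size ^ suc r * (3 ^ r * (2 * suc r)))
    ≤⟨ *-monoʳ-≤ 2 (*-mono-≤ (≤-trans (^-monoˡ-≤ (suc r) size≤) (≤-reflexive (^-*-assoc 2 σ (suc r))))
         (*-mono-≤ (≤-trans (^-monoˡ-≤ r (n≤1+n 3)) (≤-reflexive (^-*-assoc 2 2 r))) (*-monoʳ-≤ 2 (n<2^n r)))) ⟩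
  2 * (2 ^ (σ * suc r) * (2 ^ (2 * r) * (2 * 2 ^ r))) ≡⟨ l (2 ^ (σ * suc r)) (2 ^ (2 * r)) (2 ^ r) ⟩
  2 ^ (σ * suc r) * (2 ^ (2 * r) * 2 ^ r * 4) ≡⟨ cong (λ x → 2 ^ (σ * suc r) * (x * 4)) (trans (sym (^-distribˡ-+-* 2 (2 * r) r)) (cong (2 ^_) (l′ r))) ⟩
  2 ^ (σ * suc r) * (2 ^ (3 * r) * 4) ≡⟨ cong (2 ^ (σ * suc r) *_) (sym (^-distribˡ-+-* 2 (3 * r) 2)) ⟩
  2 ^ (σ * suc r) * 2 ^ (3 * r + 2) ≡⟨ sym (^-distribˡ-+-* 2 (σ * suc r) (3 * r + 2)) ⟩
  2 ^ (σ * suc r + (3 * r + 2)) ∎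
  where
  open ≤-Reasoning
  l : ∀ a b c → 2 * (a * (b * (2 * c))) ≡ a * (b * c * 4)
  l = solve-∀
  l′ : ∀ r → 2 * r + r ≡ 3 * r
  l′ = solve-∀

module Main {n d : ℕ} (P : BranchingProgram n (Fin d × Fin d)) (T : ℕ)
  (computes : BranchingProgram.Computes P EB) (hasLength : BranchingProgram.HasLength P T)
  (n>0 : 1 ≤ n) (d-large : 2 * n ^ 2 ≤ d) (κ σ : ℕ) (T≤ : T + n ≤ 2 ^ κ * n) (σ>0 : 1 ≤ σ)
  (size≤ : BranchingProgram.size P ≤ 2 ^ σ) where

  open Parameters κ
  open ≤-Reasoning

  d>0 : 1 ≤ d
  d>0 = ≤-trans (*-mono-≤ (s≤s (z≤n {1})) (*-mono-≤ n>0 (*-mono-≤ n>0 (≤-refl {1})))) d-large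

  module Large (r≤n : r ≤ n) where

    ℓ m₀ : ℕ
    -- Rounding up adds at most r ≤ n to the total r ℓ, which is why `T≤` bounds T + n.
    ℓ  = suc (T / r)
    m₀ = n / B ^ M

    T≤rℓ : T ≤ r * ℓ
    T≤rℓ = ≤-trans (<⇒≤ (m<[1+m/n]*n T r)) (≤-reflexive (*-comm ℓ r))

    rℓ≤Kn : r * ℓ ≤ K * n
    rℓ≤Kn = begin
      r * suc (T / r) ≡⟨ *-suc r (T / r) ⟩
      r + r * (T / r) ≤⟨ +-mono-≤ r≤n (≤-trans (≤-reflexive (*-comm r (T / r))) (m/n*n≤m T r)) ⟩
      n + T ≡⟨ +-comm n T ⟩
      T + n ≤⟨ T≤ ⟩
      K * n ∎

    m₀B^M≤n : m₀ * B ^ M ≤ n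
    m₀B^M≤n = m/n*n≤m n (B ^ M)

    n≤2m₀B^M : n ≤ 2 * B ^ M * m₀
    n≤2m₀B^M = begin
      n ≤⟨ <⇒≤ (m<[1+m/n]*n n (B ^ M)) ⟩
      suc m₀ * B ^ M ≤⟨ *-monoˡ-≤ (B ^ M) (+-monoˡ-≤ m₀ m₀>0) ⟩
      (m₀ + m₀) * B ^ M ≡⟨ l m₀ (B ^ M) ⟩
      2 * B ^ M * m₀ ∎
      where
      l : ∀ a b → (a + a) * b ≡ 2 * b * a
      l = solve-∀
      B^M≤n : B ^ M ≤ n
      B^M≤n = ≤-trans (^-monoʳ-≤ B (*-monoˡ-≤ K² (m≤m+n 50 50))) r≤n
      m₀>0 : 1 ≤ m₀
      m₀>0 = ≮⇒≥ λ m₀<1 → <⇒≱ (m<[1+m/n]*n n (B ^ M))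
        (≤-trans (≤-reflexive (trans (cong (λ m → suc m * B ^ M) (n<1⇒n≡0 m₀<1)) (+-identityʳ (B ^ M)))) B^M≤n)

    acceptance : Collisions.accepted d n * (4 ^ m₀ * (4 ^ w) ^ n) ≤
                 BranchingProgram.size P ^ suc r * (3 ^ r * (2 * suc r)) * ((d * d) ^ n * suc (4 ^ w) ^ n)
    acceptance = Advice.accepted-bound P T computes hasLength r ℓ T≤rℓ w m₀ d>0
      (λ col read row → choose-colouring col K B w m₀ ℓ R M n>0 K>0 w>0 read row rℓ≤Kn refl ≤-refl m₀B^M≤n ≤-refl B≥₁ B≥₂)

    m₀≤ : m₀ ≤ σ * suc r + (3 * r + 2)
    m₀≤ = ^-cancelˡ-≤ m₀ (σ * suc r + (3 * r + 2)) (≤-trans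
      (free-bound ((d * d) ^ n) (Collisions.accepted d n) (BranchingProgram.size P ^ suc r * (3 ^ r * (2 * suc r))) m₀ ((4 ^ w) ^ n) (suc (4 ^ w) ^ n)
        (m^n>0 (d * d) {{>-nonZero (*-mono-≤ d>0 d>0)}} n) (m^n>0 (4 ^ w) {{m^n≢0 4 w}} n)
        (Collisions.half-accepted d n n>0 d-large) acceptance
        (subst (λ L → suc L ^ n ≤ 2 ^ m₀ * L ^ n) (sym 4^w≡) (compound (2 * B ^ M) m₀ n (≤-trans (m^n>0 B M) (m≤n*m (B ^ M) 2)) n≤2m₀B^M)))
      (hints≤ (BranchingProgram.size P) σ r size≤))

    n≤ : n ≤ σ * 2 ^ (755 * (K² * (κ + 4)))
    n≤ = begin
      n ≤⟨ <⇒≤ (m<[1+m/n]*n n (B ^ M)) ⟩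
      suc m₀ * B ^ M ≤⟨ *-monoˡ-≤ (B ^ M) (s≤s m₀≤) ⟩
      suc (σ * suc r + (3 * r + 2)) * B ^ M ≡⟨ cong (_* B ^ M) (l₁ σ r) ⟩
      -- Each summand is raised to a multiple of σ r; the coefficients 1 + 1 + 3 + 3 = 8 are
      -- absorbed by the spare factor B.
      (σ * r + σ * 1 + 1 * (3 * r) + 3 * (1 * 1)) * B ^ M
        ≤⟨ *-monoˡ-≤ (B ^ M) (+-mono-≤ (+-mono-≤ (+-monoʳ-≤ (σ * r) (*-monoʳ-≤ σ r>0)) (*-monoˡ-≤ (3 * r) σ>0)) (*-monoʳ-≤ 3 (*-mono-≤ σ>0 r>0))) ⟩
      (σ * r + σ * r + σ * (3 * r) + 3 * (σ * r)) * B ^ M ≡⟨ l₂ σ r (B ^ M) ⟩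
      σ * (8 * (r * B ^ M)) ≤⟨ *-monoʳ-≤ σ (*-monoˡ-≤ (r * B ^ M) 8≤B) ⟩
      σ * (B * (r * B ^ M)) ≡⟨ cong (λ x → σ * (B * x)) (sym (^-distribˡ-+-* B R M)) ⟩
      σ * B ^ suc (R + M) ≤⟨ *-monoʳ-≤ σ (power-bound (suc (R + M)) exponent) ⟩
      σ * 2 ^ (755 * (K² * (κ + 4))) ∎
      where
      r>0 : 1 ≤ r
      r>0 = m^n>0 B R
      8≤B : 8 ≤ B
      8≤B = ^-monoʳ-≤ 2 {3} (≤-trans (m≤m+n 3 17) (m≤n+m 20 (5 * κ)))
      l₁ : ∀ σ r → suc (σ * suc r + (3 * r + 2)) ≡ σ * r + σ * 1 + 1 * (3 * r) + 3 * (1 * 1)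
      l₁ = solve-∀
      l₂ : ∀ σ r x → (σ * r + σ * r + σ * (3 * r) + 3 * (σ * r)) * x ≡ σ * (8 * (r * x))
      l₂ = solve-∀
      exponent : suc (R + M) ≤ 151 * K²
      exponent = ≤-trans (+-monoˡ-≤ (R + M) K²>0) (≤-reflexive (l K²))
        where
        l : ∀ x → x + (100 * x + 50 * x) ≡ 151 * x
        l = solve-∀

  n-bound : n ≤ σ * 2 ^ (755 * (K² * (κ + 4)))
  n-bound with r ≤? n
  ... | yes r≤n = Large.n≤ r≤n
  ... | no  r≰n = begin
    n ≤⟨ <⇒≤ (≰⇒> r≰n) ⟩
    B ^ R ≤⟨ power-bound R (*-monoˡ-≤ K² (m≤m+n 100 51)) ⟩
    2 ^ (755 * (K² * (κ + 4))) ≤⟨ m≤n*m _ σ {{>-nonZero σ>0}} ⟩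
    σ * 2 ^ (755 * (K² * (κ + 4))) ∎

-- `every-read` applied to an accepted input, with the whole run as a single segment. Through this
-- bound T + n can later be replaced by 2 T.
length≥n : ∀ {n d} (P : BranchingProgram n (Fin d × Fin d)) T → BranchingProgram.Computes P EB → BranchingProgram.HasLength P T →
           1 ≤ n → 2 * n ^ 2 ≤ d → n ≤ T
length≥n {n} {d} P T computes hasLength n>0 d-large =
  [ (λ e → contradiction (≤-trans (≤-trans inputs>0 (Collisions.half-accepted d n n>0 d-large)) (≤-reflexive (cong (2 *_) e))) (λ ()))
  , (λ (x , p) → reads-all x (EB (lookup x)) refl p) ]′ (∑-zero⊎positive (all-inputs d n) (λ x → ⟦ EB (lookup x) ⟧))
  where
  open ≤-Reasoning
  open Runs P
  open Segments T computes hasLength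
  d>0 : 1 ≤ d
  d>0 = ≤-trans (*-mono-≤ (s≤s (z≤n {1})) (*-mono-≤ n>0 (*-mono-≤ n>0 (≤-refl {1})))) d-large
  inputs>0 : 1 ≤ (d * d) ^ n
  inputs>0 = m^n>0 (d * d) {{>-nonZero (*-mono-≤ d>0 d>0)}} n
  reads-all : ∀ x b → EB (lookup x) ≡ b → 1 ≤ ⟦ b ⟧ → n ≤ T
  reads-all x true acc _ = begin
    n ≡⟨ sym (trans (∑-allFin-const n 1) (*-identityʳ n)) ⟩
    ∑ (allFin n) (λ _ → 1) ≤⟨ ∑-mono (allFin n) read ⟩
    ∑ (allFin n) (λ i → ⟦ reads T (lookup v zero) x i ⟧) ≤⟨ reads≤ T (lookup v zero) x ⟩
    T ∎
    where
    T≤ : T ≤ 1 * T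
    T≤ = ≤-reflexive (sym (+-identityʳ T))
    v = trace 1 T T≤ x
    read : ∀ i → 1 ≤ ⟦ reads T (lookup v zero) x i ⟧
    read i with every-read 1 T T≤ v x (refl , acc) i
    ... | zero , e = ≤-reflexive (cong ⟦_⟧ (sym e))

-- Rational arithmetic and logarithms

module ℚ^ = Exp (CommutativeRing.semiring ℚ.+-*-commutativeRing)

ι : ℕ → ℚ
ι n = int n ℚ./ 1

toℚᵘ-ι : ∀ n → toℚᵘ (ι n) ℚᵘ.≃ mkℚᵘ (int n) 0
toℚᵘ-ι n = ℚ.toℚᵘ-fromℚᵘ (mkℚᵘ (int n) 0)

ι-mono-≤ : ∀ {m n} → m ≤ n → ι m ℚ.≤ ι n
ι-mono-≤ {m} {n} m≤n = ℚ.toℚᵘ-cancel-≤ (begin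
  toℚᵘ (ι m) ≃⟨ toℚᵘ-ι m ⟩
  mkℚᵘ (int m) 0 ≤⟨ *≤* (ℤ.*-monoʳ-≤-nonNeg (int 1) (ℤ.+≤+ m≤n)) ⟩
  mkℚᵘ (int n) 0 ≃⟨ ℚᵘ.≃-sym (toℚᵘ-ι n) ⟩
  toℚᵘ (ι n) ∎)
  where open ℚᵘ.≤-Reasoning

ι-mono-< : ∀ {m n} → m < n → ι m ℚ.< ι n
ι-mono-< {m} {n} m<n = ℚ.toℚᵘ-cancel-< (begin-strict
  toℚᵘ (ι m) ≃⟨ toℚᵘ-ι m ⟩
  mkℚᵘ (int m) 0 <⟨ *<* (ℤ.*-monoʳ-<-pos (int 1) (ℤ.+<+ m<n)) ⟩
  mkℚᵘ (int n) 0 ≃⟨ ℚᵘ.≃-sym (toℚᵘ-ι n) ⟩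
  toℚᵘ (ι n) ∎)
  where open ℚᵘ.≤-Reasoning

≤⇒≮ : ∀ {p q} → p ℚ.≤ q → q ℚ.< p → ⊥
≤⇒≮ p≤q q<p = ℚ.<-irrefl refl (ℚ.≤-<-trans p≤q q<p)

ι-cancel-< : ∀ {m n} → ι m ℚ.< ι n → m < n
ι-cancel-< lt = ≰⇒> λ n≤m → ≤⇒≮ (ι-mono-≤ n≤m) lt

ι-* : ∀ m n → ι (m * n) ≡ ι m ℚ.* ι n
ι-* m n = ℚ.toℚᵘ-injective (begin-equality
  toℚᵘ (ι (m * n)) ≃⟨ toℚᵘ-ι (m * n) ⟩
  mkℚᵘ (int (m * n)) 0 ≃⟨ *≡* (cong (ℤ._* int 1) (ℤ.pos-* m n)) ⟩
  mkℚᵘ (int m) 0 ℚᵘ.* mkℚᵘ (int n) 0 ≃⟨ ℚᵘ.*-cong (toℚᵘ-ι m) (toℚᵘ-ι n) ⟨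
  toℚᵘ (ι m) ℚᵘ.* toℚᵘ (ι n) ≃⟨ ℚ.toℚᵘ-homo-* (ι m) (ι n) ⟨
  toℚᵘ (ι m ℚ.* ι n) ∎)
  where open ℚᵘ.≤-Reasoning

*-denominator : ∀ b p → ↥ b ≡ int p → b ℚ.* ι (↧ₙ b) ≡ ι p
*-denominator b@(mkℚ _ d-1 _) p refl = ℚ.toℚᵘ-injective (begin-equality
  toℚᵘ (b ℚ.* ι (suc d-1)) ≃⟨ ℚ.toℚᵘ-homo-* b (ι (suc d-1)) ⟩
  toℚᵘ b ℚᵘ.* toℚᵘ (ι (suc d-1)) ≃⟨ ℚᵘ.*-cong {toℚᵘ b} ℚᵘ.≃-refl (toℚᵘ-ι (suc d-1)) ⟩
  mkℚᵘ (int p) d-1 ℚᵘ.* mkℚᵘ (int (suc d-1)) 0 ≃⟨ *≡* (trans (ℤ.*-identityʳ _) (cong (int p ℤ.*_) (cong int (sym (*-identityʳ (suc d-1)))))) ⟩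
  mkℚᵘ (int p) 0 ≃⟨ toℚᵘ-ι p ⟨
  toℚᵘ (ι p) ∎)
  where open ℚᵘ.≤-Reasoning

*-mono-<ʳ : ∀ {p q} r → 0ℚ ℚ.< r → p ℚ.< q → p ℚ.* r ℚ.< q ℚ.* r
*-mono-<ʳ r 0<r = ℚ.*-monoˡ-<-pos r {{ℚ.positive 0<r}}

*-mono-<ˡ : ∀ {p q} r → 0ℚ ℚ.< r → p ℚ.< q → r ℚ.* p ℚ.< r ℚ.* q
*-mono-<ˡ r 0<r = ℚ.*-monoʳ-<-pos r {{ℚ.positive 0<r}}

*-mono-≤ʳ : ∀ {p q} r → 0ℚ ℚ.≤ r → p ℚ.≤ q → p ℚ.* r ℚ.≤ q ℚ.* r
*-mono-≤ʳ r 0≤r = ℚ.*-monoʳ-≤-nonNeg r {{ℚ.nonNegative 0≤r}}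

*-mono-≤ˡ : ∀ {p q} r → 0ℚ ℚ.≤ r → p ℚ.≤ q → r ℚ.* p ℚ.≤ r ℚ.* q
*-mono-≤ˡ r 0≤r = ℚ.*-monoˡ-≤-nonNeg r {{ℚ.nonNegative 0≤r}}

*-cancel-<ʳ : ∀ {p q} r → 0ℚ ℚ.≤ r → p ℚ.* r ℚ.< q ℚ.* r → p ℚ.< q
*-cancel-<ʳ r 0≤r = ℚ.*-cancelʳ-<-nonNeg r {{ℚ.nonNegative 0≤r}}

*-cancel-≤ʳ : ∀ {p q} r → 0ℚ ℚ.< r → p ℚ.* r ℚ.≤ q ℚ.* r → p ℚ.≤ q
*-cancel-≤ʳ r 0<r = ℚ.*-cancelʳ-≤-pos r {{ℚ.positive 0<r}}

0≤ι : ∀ n → 0ℚ ℚ.≤ ι n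
0≤ι n = ι-mono-≤ {0} {n} z≤n

0<ι : ∀ {n} → 1 ≤ n → 0ℚ ℚ.< ι n
0<ι {n} 1≤n = ι-mono-< {0} {n} 1≤n

^-pos : ∀ {x} k → 0ℚ ℚ.< x → 0ℚ ℚ.< x ^ℚ k
^-pos     zero    0<x = ι-mono-< {0} {1} (s≤s z≤n)
^-pos {x} (suc k) 0<x = subst (ℚ._< x ℚ.* x ^ℚ k) (ℚ.*-zeroʳ x) (*-mono-<ˡ x 0<x (^-pos k 0<x))

^-mono-≤ : ∀ {x y} k → 0ℚ ℚ.< x → x ℚ.≤ y → x ^ℚ k ℚ.≤ y ^ℚ k
^-mono-≤         zero    0<x x≤y = ℚ.≤-refl
^-mono-≤ {x} {y} (suc k) 0<x x≤y = ℚ.≤-trans (*-mono-≤ˡ x (ℚ.<⇒≤ 0<x) (^-mono-≤ k 0<x x≤y))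
  (*-mono-≤ʳ (y ^ℚ k) (ℚ.<⇒≤ (^-pos k (ℚ.<-≤-trans 0<x x≤y))) x≤y)

^-mono-< : ∀ {x y} k → 0ℚ ℚ.< x → x ℚ.< y → x ^ℚ suc k ℚ.< y ^ℚ suc k
^-mono-< {x} {y} k 0<x x<y = ℚ.≤-<-trans (*-mono-≤ˡ x (ℚ.<⇒≤ 0<x) (^-mono-≤ k 0<x (ℚ.<⇒≤ x<y)))
  (*-mono-<ʳ (y ^ℚ k) (^-pos k (ℚ.<-trans 0<x x<y)) x<y)

2^≡ : ∀ k → 2^ (int k) ≡ ι (2 ^ k)
2^≡ zero    = refl
2^≡ (suc k) = trans (cong (ι 2 ℚ.*_) (2^≡ k)) (sym (ι-* 2 (2 ^ k)))

ι-^ : ∀ m k → ι m ^ℚ k ≡ ι (m ^ k)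
ι-^ m zero    = refl
ι-^ m (suc k) = trans (cong (ι m ℚ.*_) (ι-^ m k)) (sym (ι-* m (m ^ k)))

-- Raising both inequalities to the common exponent q q′ turns a comparison of fractions into one of
-- natural exponents.
power-chain : ∀ {s s′} p q p′ q′ → 0ℚ ℚ.< s → 2^ (int p) ℚ.≤ s ^ℚ q → s′ ^ℚ q′ ℚ.≤ 2^ (int p′) → s ℚ.≤ s′ →
              ι (2 ^ (p * q′)) ℚ.≤ s ^ℚ (q * q′) × s′ ^ℚ (q * q′) ℚ.≤ ι (2 ^ (p′ * q))
power-chain {s} {s′} p q p′ q′ 0<s lower upper s≤s′ = (begin
  ι (2 ^ (p * q′)) ≡⟨ trans (cong ι (sym (^-*-assoc 2 p q′))) (sym (ι-^ (2 ^ p) q′)) ⟩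
  ι (2 ^ p) ^ℚ q′ ≤⟨ ^-mono-≤ q′ (0<ι (m^n>0 2 p)) (subst (ℚ._≤ s ^ℚ q) (2^≡ p) lower) ⟩
  (s ^ℚ q) ^ℚ q′ ≡⟨ ℚ^.^-assocʳ s q q′ ⟩
  s ^ℚ (q * q′) ∎) , (begin
  s′ ^ℚ (q * q′) ≡⟨ trans (cong (s′ ^ℚ_) (*-comm q q′)) (sym (ℚ^.^-assocʳ s′ q′ q)) ⟩
  (s′ ^ℚ q′) ^ℚ q ≤⟨ ^-mono-≤ q (^-pos q′ (ℚ.<-≤-trans 0<s s≤s′)) (subst (s′ ^ℚ q′ ℚ.≤_) (2^≡ p′) upper) ⟩
  ι (2 ^ p′) ^ℚ q ≡⟨ trans (ι-^ (2 ^ p′) q) (cong ι (^-*-assoc 2 p′ q)) ⟩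
  ι (2 ^ (p′ * q)) ∎)
  where open ℚ.≤-Reasoning

^-cancel-< : ∀ m k → 2 ^ m < 2 ^ k → m < k
^-cancel-< m k lt = ≰⇒> λ k≤m → <⇒≱ lt (^-monoʳ-≤ 2 k≤m)

-- If p / q ≤ log₂ s, s < s′ and log₂ s′ ≤ p′ / q′, then p / q < p′ / q′.

log-< : ∀ {s s′} p q p′ q′ .{{_ : NonZero q}} .{{_ : NonZero q′}} → 0ℚ ℚ.< s → 2^ (int p) ℚ.≤ s ^ℚ q →
        s′ ^ℚ q′ ℚ.≤ 2^ (int p′) → s ℚ.< s′ → p * q′ < p′ * q
log-< p q@(suc q-1) p′ q′@(suc q′-1) 0<s lower upper s<s′ =
  let l , u = power-chain p q p′ q′ 0<s lower upper (ℚ.<⇒≤ s<s′)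
  in ^-cancel-< (p * q′) (p′ * q) (ι-cancel-< (ℚ.≤-<-trans l (ℚ.<-≤-trans (^-mono-< (q′-1 + q-1 * q′) 0<s s<s′) u)))

log-≤ : ∀ {s s′} p q p′ q′ → 0ℚ ℚ.< s → 2^ (int p) ℚ.≤ s ^ℚ q →
        s′ ^ℚ q′ ℚ.≤ 2^ (int p′) → s ℚ.≤ s′ → p * q′ ≤ p′ * q
log-≤ p q p′ q′ 0<s lower upper s≤s′ =
  let l , u = power-chain p q p′ q′ 0<s lower upper s≤s′
  in ≮⇒≥ λ lt → ≤⇒≮ (ℚ.≤-trans l (ℚ.≤-trans (^-mono-≤ (q * q′) 0<s s≤s′) u)) (ι-mono-< (^-monoʳ-< 2 ≤-refl lt))

½^<1 : ∀ k → ½ ^ℚ suc k ℚ.< 1ℚ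
½^<1 k = subst (½ ^ℚ suc k ℚ.<_) (1^ (suc k)) (^-mono-< {½} {1ℚ} k (ℚ.positive⁻¹ ½) (ℚ.*<* (ℤ.+<+ (s≤s (s≤s z≤n)))))
  where
  1^ : ∀ k → 1ℚ ^ℚ k ≡ 1ℚ
  1^ zero    = refl
  1^ (suc k) = trans (ℚ.*-identityˡ (1ℚ ^ℚ k)) (1^ k)

-- A negative numerator would make the right side a positive power of ½, which is below 1.
log-nonneg : ∀ {s} q z → 1ℚ ℚ.≤ s → s ^ℚ q ℚ.≤ 2^ z → ∃[ p ] z ≡ int p
log-nonneg     q (int p)   _   _  = p , refl
log-nonneg {s} q -[1+ k ] 1≤s le = ⊥-elim (≤⇒≮ (ℚ.≤-trans (1≤^ q) le) (½^<1 k))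
  where
  1≤^ : ∀ q → 1ℚ ℚ.≤ s ^ℚ q
  1≤^ zero    = ℚ.≤-refl
  1≤^ (suc q) = ℚ.≤-trans 1≤s (ℚ.≤-trans (ℚ.≤-reflexive (sym (ℚ.*-identityʳ s)))
    (*-mono-≤ˡ s (ℚ.≤-trans (ι-mono-≤ {0} {1} z≤n) 1≤s) (1≤^ q)))

positive-numerator : ∀ a → 0ℚ ℚ.< a → ∃[ p ] ↥ a ≡ int p
positive-numerator (mkℚ (int p) _ _)    _ = p , refl
positive-numerator (mkℚ -[1+ _ ] _ _) (ℚ.*<* ())

denominator>0 : ∀ a → 1 ≤ ↧ₙ a
denominator>0 a@record{} = s≤s z≤n

below-ι : ∀ a p m → ↥ a ≡ int p → p < m * ↧ₙ a → a ℚ.< ι m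
below-ι a p m e lt = *-cancel-<ʳ (ι (↧ₙ a)) (0≤ι (↧ₙ a))
  (subst₂ ℚ._<_ (sym (*-denominator a p e)) (ι-* m (↧ₙ a)) (ι-mono-< lt))

above-ι : ∀ a p m → ↥ a ≡ int p → m * ↧ₙ a ≤ p → ι m ℚ.≤ a
above-ι a p m e le = *-cancel-≤ʳ (ι (↧ₙ a)) (0<ι (denominator>0 a))
  (subst₂ ℚ._≤_ (ι-* m (↧ₙ a)) (sym (*-denominator a p e)) (ι-mono-≤ le))

compare-fractions : ∀ a b p p′ → ↥ a ≡ int p → ↥ b ≡ int p′ → p * ↧ₙ b < p′ * ↧ₙ a → a ℚ.< b
compare-fractions a b p p′ e e′ lt = *-cancel-<ʳ (ι (↧ₙ a) ℚ.* ι (↧ₙ b)) (subst (0ℚ ℚ.≤_) (ι-* (↧ₙ a) (↧ₙ b)) (0≤ι (↧ₙ a * ↧ₙ b))) (begin-strict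
  a ℚ.* (ι (↧ₙ a) ℚ.* ι (↧ₙ b)) ≡⟨ sym (ℚ.*-assoc a _ _) ⟩
  a ℚ.* ι (↧ₙ a) ℚ.* ι (↧ₙ b) ≡⟨ trans (cong (ℚ._* ι (↧ₙ b)) (*-denominator a p e)) (sym (ι-* p (↧ₙ b))) ⟩
  ι (p * ↧ₙ b) <⟨ ι-mono-< lt ⟩
  ι (p′ * ↧ₙ a) ≡⟨ trans (ι-* p′ (↧ₙ a)) (cong (ℚ._* ι (↧ₙ a)) (sym (*-denominator b p′ e′))) ⟩
  b ℚ.* ι (↧ₙ b) ℚ.* ι (↧ₙ a) ≡⟨ trans (ℚ.*-assoc b _ _) (cong (b ℚ.*_) (ℚ.*-comm (ι (↧ₙ b)) (ι (↧ₙ a)))) ⟩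
  b ℚ.* (ι (↧ₙ a) ℚ.* ι (↧ₙ b)) ∎)
  where open ℚ.≤-Reasoning

denominator≢0 : ∀ a → NonZero (↧ₙ a)
denominator≢0 a = >-nonZero (denominator>0 a)

2^1≤ι2 : 2^ (int 1) ℚ.≤ ι 2 ^ℚ 1
2^1≤ι2 = ℚ.≤-refl

2^k≤ι2^k : ∀ k → 2^ (int k) ℚ.≤ ι (2 ^ k) ^ℚ 1
2^k≤ι2^k k = ℚ.≤-reflexive (trans (2^≡ k) (sym (ℚ.*-identityʳ (ι (2 ^ k)))))

scale : ∀ σ q p k → σ * q ≤ 2 * p → σ * k * q ≤ 2 * k * p
scale σ q p k le = ≤-trans (≤-reflexive (l₁ σ k q)) (≤-trans (*-monoˡ-≤ k le) (≤-reflexive (l₂ p k)))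
  where
  l₁ : ∀ a b c → a * b * c ≡ a * c * b
  l₁ = solve-∀
  l₂ : ∀ a b → 2 * a * b ≡ 2 * b * a
  l₂ = solve-∀

-- The cuts of S and n / S and their logarithms

module Quotient (n s : ℕ) (s≥2 : 2 ≤ s) where

  open ℚ.≤-Reasoning

  S n/S : Cut
  S   = log₂ (fromℕ s)
  n/S = fromℕ n ⊘ S

  1≤above : ∀ {z} → ι s ℚ.< z → 1ℚ ℚ.≤ z
  1≤above lt = ℚ.≤-trans (ι-mono-≤ {1} {s} (≤-trans (s≤s z≤n) s≥2)) (ℚ.<⇒≤ lt)

  S-numerator : ∀ b → Above S b → ∃[ p ] ↥ b ≡ int p
  S-numerator b (z , _ , s<z , le) = log-nonneg (↧ₙ b) (↥ b) (1≤above s<z) le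

  -- Cuts carry no laws, so the order between lower and upper bounds has to be derived for each cut
  -- in turn: here, and for n / S and its logarithm below.
  S-separated : ∀ b b′ → 0ℚ ℚ.< b → Below S b → Above S b′ → b ℚ.< b′
  S-separated b b′ 0<b (y , 0<y , y<s , lo) above@(z , 0<z , s<z , hi) =
    let p , e = positive-numerator b 0<b
        p′ , e′ = S-numerator b′ above
    in compare-fractions b b′ p p′ e e′ (log-< p (↧ₙ b) p′ (↧ₙ b′) {{denominator≢0 b}} {{denominator≢0 b′}} 0<y
         (subst (λ i → 2^ i ℚ.≤ y ^ℚ ↧ₙ b) e lo) (subst (λ i → z ^ℚ ↧ₙ b′ ℚ.≤ 2^ i) e′ hi) (ℚ.<-trans y<s s<z))

  n/S-separated : ∀ ρ z → 0ℚ ℚ.< z → Below n/S ρ → Above n/S z → ρ ℚ.< z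
  n/S-separated ρ z 0<z (a , b , 0<a , a<n , bS , ρb≤a) (a′ , b′ , n<a′ , 0<b′ , b′S , a′≤zb′) =
    *-cancel-<ʳ b (ℚ.<⇒≤ (ℚ.<-trans 0<b′ b′<b)) (begin-strict
      ρ ℚ.* b ≤⟨ ρb≤a ⟩
      a <⟨ ℚ.<-trans a<n n<a′ ⟩
      a′ ≤⟨ a′≤zb′ ⟩
      z ℚ.* b′ <⟨ *-mono-<ˡ z 0<z b′<b ⟩
      z ℚ.* b ∎)
    where
    b′<b = S-separated b′ b 0<b′ b′S bS

  -- σ is the least integer above b = p / q. As b is an upper bound of log₂ s, this gives s ≤ 2 ^ σ;
  -- as b > 1 by s ≥ 2, the rounding at most doubles b.
  σ-bound : ∀ b → Above S b → ∃[ σ ] 1 ≤ σ × s ≤ 2 ^ σ × ∃[ p ] ↥ b ≡ int p × 1 ≤ p × σ * ↧ₙ b ≤ 2 * p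
  σ-bound b above@(z , 0<z , s<z , hi) = suc (p / q) , s≤s z≤n , s≤2^σ , p , e , ≤-trans (s≤s z≤n) q<p , σq≤2p
    where
    p = proj₁ (S-numerator b above)
    e = proj₂ (S-numerator b above)
    q = ↧ₙ b
    instance
      q≢0 : NonZero q
      q≢0 = denominator≢0 b
    hi′ : z ^ℚ q ℚ.≤ 2^ (int p)
    hi′ = subst (λ i → z ^ℚ q ℚ.≤ 2^ i) e hi
    q<p : q < p
    q<p = subst₂ _<_ (*-identityˡ q) (*-identityʳ p)
      (log-< {ι 2} {z} 1 1 p q (0<ι {2} (s≤s z≤n)) 2^1≤ι2 hi′ (ℚ.≤-<-trans (ι-mono-≤ {2} {s} s≥2) s<z))
    s≤2^σ : s ≤ 2 ^ suc (p / q)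
    s≤2^σ = ≮⇒≥ λ lt → <-irrefl refl (<-trans (m<[1+m/n]*n p q) (subst (suc (p / q) * q <_) (*-identityʳ p)
      (log-< {ι (2 ^ suc (p / q))} {z} (suc (p / q)) 1 p q (0<ι {2 ^ suc (p / q)} (m^n>0 2 (suc (p / q)))) (2^k≤ι2^k (suc (p / q))) hi′ (ℚ.<-trans (ι-mono-< {2 ^ suc (p / q)} {s} lt) s<z))))
    σq≤2p : suc (p / q) * q ≤ 2 * p
    σq≤2p = ≤-trans (+-mono-≤ (<⇒≤ q<p) (m/n*n≤m p q)) (≤-reflexive (cong (p +_) (sym (+-identityʳ p))))

  n/S-bound : ∀ Λ → (∀ σ → 1 ≤ σ → s ≤ 2 ^ σ → n ≤ σ * 2 ^ Λ) → ∀ ρ → Below n/S ρ → ρ ℚ.< ι (2 ^ suc Λ)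
  n/S-bound Λ bound ρ (a , b , 0<a , a<n , bS , ρb≤a) = *-cancel-<ʳ (ι p) (0≤ι p) (begin-strict
    ρ ℚ.* ι p ≡⟨ cong (ρ ℚ.*_) (sym (*-denominator b p e)) ⟩
    ρ ℚ.* (b ℚ.* ι q) ≡⟨ sym (ℚ.*-assoc ρ b (ι q)) ⟩
    ρ ℚ.* b ℚ.* ι q ≤⟨ *-mono-≤ʳ (ι q) (0≤ι q) ρb≤a ⟩
    a ℚ.* ι q <⟨ *-mono-<ʳ (ι q) (0<ι (denominator>0 b)) a<n ⟩
    ι n ℚ.* ι q ≡⟨ sym (ι-* n q) ⟩
    ι (n * q) ≤⟨ ι-mono-≤ {n * q} {2 ^ suc Λ * p} nq≤ ⟩
    ι (2 ^ suc Λ * p) ≡⟨ ι-* (2 ^ suc Λ) p ⟩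
    ι (2 ^ suc Λ) ℚ.* ι p ∎)
    where
    bits = σ-bound b bS
    σ = proj₁ bits
    p = proj₁ (proj₂ (proj₂ (proj₂ bits)))
    e = proj₁ (proj₂ (proj₂ (proj₂ (proj₂ bits))))
    σq≤2p = proj₂ (proj₂ (proj₂ (proj₂ (proj₂ (proj₂ bits)))))
    q = ↧ₙ b
    nq≤ : n * q ≤ 2 ^ suc Λ * p
    nq≤ = ≤-trans (*-monoˡ-≤ q (bound σ (proj₁ (proj₂ bits)) (proj₁ (proj₂ (proj₂ bits))))) (scale σ q p (2 ^ Λ) σq≤2p)

  n>0 : fromℕ 4 ≼ n/S → 1 ≤ n
  n>0 4≼ = let _ , _ , 0<a , a<n , _ = 4≼ (ι 3) (ι-mono-< {3} {4} ≤-refl) in ι-cancel-< {0} {n} (ℚ.<-trans 0<a a<n)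

  module _ (4≼ : fromℕ 4 ≼ n/S) where

    4≤above : ∀ z → 0ℚ ℚ.< z → Above n/S z → ι 4 ℚ.≤ z
    4≤above z 0<z above = ℚ.≮⇒≥ λ z<4 → ℚ.<-irrefl refl (n/S-separated z z 0<z (4≼ z z<4) above)

    -- The threshold 4 makes log (n / S) at least 2, and hence the denominator log log (n / S) at
    -- least 1.
    log-above : ∀ u → Above (log₂ n/S) u → ι 2 ℚ.≤ u
    log-above u (z , 0<z , above , hi) =
      let p , e = log-nonneg (↧ₙ u) (↥ u) (ℚ.≤-trans (ι-mono-≤ {1} {4} (s≤s z≤n)) (4≤above z 0<z above)) hi
      in above-ι u p 2 e (subst (2 * ↧ₙ u ≤_) (*-identityʳ p)
           (log-≤ {ι 4} {z} 2 1 p (↧ₙ u) (0<ι {4} (s≤s z≤n)) (2^k≤ι2^k 2) (subst (λ i → z ^ℚ ↧ₙ u ℚ.≤ 2^ i) e hi) (4≤above z 0<z above)))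

    log-separated : ∀ a u → 0ℚ ℚ.< a → Below (log₂ n/S) a → Above (log₂ n/S) u → a ℚ.< u
    log-separated a u 0<a (y , 0<y , below , lo) (z , 0<z , above , hi) =
      let p , e = positive-numerator a 0<a
          p′ , e′ = log-nonneg (↧ₙ u) (↥ u) (ℚ.≤-trans (ι-mono-≤ {1} {4} (s≤s z≤n)) (4≤above z 0<z above)) hi
      in compare-fractions a u p p′ e e′ (log-< p (↧ₙ a) p′ (↧ₙ u) {{denominator≢0 a}} {{denominator≢0 u}} 0<y
           (subst (λ i → 2^ i ℚ.≤ y ^ℚ ↧ₙ a) e lo) (subst (λ i → z ^ℚ ↧ₙ u ℚ.≤ 2^ i) e′ hi) (n/S-separated y z 0<z below above))

    log-bound : ∀ Λ → (∀ ρ → Below n/S ρ → ρ ℚ.< ι (2 ^ Λ)) → ∀ a → 0ℚ ℚ.< a → Below (log₂ n/S) a → a ℚ.< ι Λ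
    log-bound Λ bound a 0<a (y , 0<y , below , lo) =
      let p , e = positive-numerator a 0<a
      in below-ι a p Λ e (subst (_< Λ * ↧ₙ a) (*-identityʳ p)
           (log-< {y} {ι (2 ^ Λ)} p (↧ₙ a) Λ 1 {{denominator≢0 a}} 0<y (subst (λ i → 2^ i ℚ.≤ y ^ℚ ↧ₙ a) e lo)
             (ℚ.≤-reflexive (trans (ℚ.*-identityʳ (ι (2 ^ Λ))) (sym (2^≡ Λ)))) (bound y below)))

    -- For y = log (n / S) ≤ C (κ + 1): if log y ≥ κ + 1 then y / log y ≤ C, and
    -- otherwise y / log y ≤ y ≤ 2 ^ (κ + 1).
    ratio-bound : ∀ κ C → 2 ^ suc κ ≤ C → (∀ a → 0ℚ ℚ.< a → Below (log₂ n/S) a → a ℚ.< ι (C * suc κ)) →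
                  ∀ ρ → Below (log₂ n/S ⊘ log₂ (log₂ n/S)) ρ → ρ ℚ.≤ ι C
    ratio-bound κ C 2^≤C bound ρ (a , b , 0<a , below , (u , 0<u , above , hi) , ρb≤a) =
      *-cancel-≤ʳ b 0<b (ℚ.≤-trans ρb≤a (cases (suc κ * ↧ₙ b ≤? p)))
      where
      2≤u = log-above u above
      num = log-nonneg (↧ₙ b) (↥ b) (ℚ.≤-trans (ι-mono-≤ {1} {2} (s≤s z≤n)) 2≤u) hi
      p = proj₁ num
      e = proj₂ num
      hi′ : u ^ℚ ↧ₙ b ℚ.≤ 2^ (int p)
      hi′ = subst (λ i → u ^ℚ ↧ₙ b ℚ.≤ 2^ i) e hi
      1≤b : ι 1 ℚ.≤ b
      1≤b = above-ι b p 1 e (subst (1 * ↧ₙ b ≤_) (*-identityʳ p)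
        (log-≤ {ι 2} {u} 1 1 p (↧ₙ b) (0<ι {2} (s≤s z≤n)) 2^1≤ι2 hi′ 2≤u))
      0<b : 0ℚ ℚ.< b
      0<b = ℚ.<-≤-trans (0<ι {1} (s≤s z≤n)) 1≤b
      cases : Dec (suc κ * ↧ₙ b ≤ p) → a ℚ.≤ ι C ℚ.* b
      cases (yes le) = begin
        a ≤⟨ ℚ.<⇒≤ (bound a 0<a below) ⟩
        ι (C * suc κ) ≡⟨ ι-* C (suc κ) ⟩
        ι C ℚ.* ι (suc κ) ≤⟨ *-mono-≤ˡ (ι C) (0≤ι C) (above-ι b p (suc κ) e le) ⟩
        ι C ℚ.* b ∎
      cases (no gt) = begin
        a ≤⟨ ℚ.<⇒≤ (log-separated a u 0<a below above) ⟩
        u ≤⟨ ℚ.≮⇒≥ (λ lt → <-asym (≰⇒> gt) (subst (suc κ * ↧ₙ b <_) (*-identityʳ p)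
                                      (log-< {ι (2 ^ suc κ)} {u} (suc κ) 1 p (↧ₙ b) {{_}} {{denominator≢0 b}} (0<ι {2 ^ suc κ} (m^n>0 2 (suc κ))) (2^k≤ι2^k (suc κ)) hi′ lt))) ⟩
        ι (2 ^ suc κ) ≤⟨ ι-mono-≤ {2 ^ suc κ} {C} 2^≤C ⟩
        ι C ≡⟨ sym (ℚ.*-identityʳ (ι C)) ⟩
        ι C ℚ.* ι 1 ≤⟨ *-mono-≤ˡ (ι C) (0≤ι C) 1≤b ⟩
        ι C ℚ.* b ∎

-- From the bound on n / S to the bound on T

square-cancel-≤ : ∀ b m → 0ℚ ℚ.< b → b ℚ.* b ℚ.≤ ι (m * m) → b ℚ.≤ ι m
square-cancel-≤ b m 0<b le = ℚ.≮⇒≥ λ m<b → ≤⇒≮ le (begin-strict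
  ι (m * m) ≡⟨ ι-* m m ⟩
  ι m ℚ.* ι m ≤⟨ *-mono-≤ˡ (ι m) (0≤ι m) (ℚ.<⇒≤ m<b) ⟩
  ι m ℚ.* b <⟨ *-mono-<ʳ b 0<b m<b ⟩
  b ℚ.* b ∎)
  where open ℚ.≤-Reasoning

-- Rounds X / n up to a power of two at the cost of a factor 2. When the fuel runs out, X ≤ κ + 1 ≤
-- 2 ^ κ.
binary-ceiling : ∀ X n → 1 ≤ n → n ≤ X → ∃[ κ ] X ≤ 2 ^ κ * n × 2 ^ κ * n ≤ 2 * X
binary-ceiling X n n>0 n≤X = search X 0 (≤-trans (≤-reflexive (+-identityʳ n)) (≤-trans n≤X (m≤m+n X (X + 0)))) (≤-trans (m≤n+m X 1) (≤-reflexive (+-comm 1 X)))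
  where
  search : ∀ fuel κ → 2 ^ κ * n ≤ 2 * X → X ≤ fuel + suc κ → ∃[ κ ] X ≤ 2 ^ κ * n × 2 ^ κ * n ≤ 2 * X
  search fuel κ le enough with X ≤? 2 ^ κ * n
  ... | yes X≤ = κ , X≤ , le
  search zero       κ le enough | no X≰ = contradiction (≤-trans enough (≤-trans (n<2^n κ) (m≤m*n (2 ^ κ) n {{>-nonZero n>0}}))) X≰
  search (suc fuel) κ le enough | no X≰ = search fuel (suc κ)
    (≤-trans (≤-reflexive (*-assoc 2 (2 ^ κ) n)) (*-monoʳ-≤ 2 (<⇒≤ (≰⇒> X≰)))) (≤-trans enough (≤-reflexive (sym (+-suc fuel (suc κ)))))

size≥2 : ∀ {n} {A : Set} (P : BranchingProgram n A) → 2 ≤ BranchingProgram.size P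
size≥2 P = two-elements (sinkNode true) (sinkNode false) λ e → different (trans (sym (sink-label true)) (trans (cong node e) (sink-label false)))
  where
  open BranchingProgram P
  different : sink true ≢ sink false
  different ()
  two-elements : ∀ {m} (i j : Fin m) → i ≢ j → 2 ≤ m
  two-elements {suc zero}    zero zero i≢j = contradiction refl i≢j
  two-elements {suc (suc m)} _    _    _   = s≤s (s≤s z≤n)

-- 220 = 4 · 55: the square root is at most 55 K, and K n ≤ 2 (T + n) ≤ 4 T.
c : ℚ
c = int 1 ℚ./ 220

c*220 : c ℚ.* ι 220 ≡ 1ℚ
c*220 = refl

-- Since κ + 4 ≤ 4 (κ + 1), the coefficient 4 · 755 + 1 = 3021 suffices, and 55² = 3025 is the next
-- square.
exponent-bound : ∀ k κ → 1 ≤ k → suc (755 * (k * k * (κ + 4))) ≤ 55 * k * (55 * k) * suc κ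
exponent-bound k κ k>0 = begin
  suc (755 * (k * k * (κ + 4))) ≤⟨ s≤s (*-monoʳ-≤ 755 (*-monoʳ-≤ (k * k) κ+4≤)) ⟩
  suc (755 * (k * k * (4 * suc κ))) ≤⟨ +-monoˡ-≤ (755 * (k * k * (4 * suc κ))) (*-mono-≤ (*-mono-≤ k>0 k>0) (s≤s (z≤n {κ}))) ⟩
  k * k * suc κ + 755 * (k * k * (4 * suc κ)) ≤⟨ m≤m+n _ (4 * (k * k * suc κ)) ⟩
  k * k * suc κ + 755 * (k * k * (4 * suc κ)) + 4 * (k * k * suc κ) ≡⟨ l k (suc κ) ⟩
  55 * k * (55 * k) * suc κ ∎
  where
  open ≤-Reasoning
  κ+4≤ : κ + 4 ≤ 4 * suc κ
  κ+4≤ = ≤-trans (+-monoˡ-≤ 4 (m≤n*m κ 4)) (≤-reflexive (l₀ κ))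
    where
    l₀ : ∀ κ → 4 * κ + 4 ≡ 4 * suc κ
    l₀ = solve-∀
  l : ∀ k j → k * k * j + 755 * (k * k * (4 * j)) + 4 * (k * k * j) ≡ 55 * k * (55 * k) * j
  l = solve-∀

length-bound : ∀ n T k → n ≤ T → k * n ≤ 2 * (T + n) → n * (55 * k) ≤ 220 * T
length-bound n T k n≤T kn≤ = begin
  n * (55 * k) ≡⟨ l₁ n k ⟩
  55 * (k * n) ≤⟨ *-monoʳ-≤ 55 (≤-trans kn≤ (*-monoʳ-≤ 2 (+-monoʳ-≤ T n≤T))) ⟩
  55 * (2 * (T + T)) ≡⟨ l₂ T ⟩
  220 * T ∎
  where
  open ≤-Reasoning
  l₁ : ∀ n k → n * (55 * k) ≡ 55 * (k * n)
  l₁ = solve-∀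
  l₂ : ∀ T → 55 * (2 * (T + T)) ≡ 220 * T
  l₂ = solve-∀

-- The program's own length determines K = 2 ^ κ; the resulting upper bound on n / S limits the
-- square root to 55 K, and 55 K n ≤ 220 T.
lower-bound : ∀ (n d : ℕ) → 2 * n ^ 2 ≤ d → ∀ (P : BranchingProgram n (Fin d × Fin d)) (T : ℕ) →
  let open BranchingProgram P
      S   = log₂ (fromℕ size)
      n/S = fromℕ n ⊘ S
  in Computes EB → HasLength T → fromℕ 4 ≼ n/S →
     fromℚ c ⊗ fromℕ n ⊗ √ (log₂ n/S ⊘ log₂ (log₂ n/S)) ≼ fromℕ T
lower-bound n d d-large P T computes hasLength 4≼ r
  (a , b , 0<a , (a₀ , n₀ , 0<a₀ , a₀<c , 0<n₀ , n₀<n , a≤) , 0<b , below√ , r≤ab) = begin-strict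
    r ≤⟨ r≤ab ⟩
    a ℚ.* b ≤⟨ *-mono-≤ʳ b (ℚ.<⇒≤ 0<b) a≤ ⟩
    a₀ ℚ.* n₀ ℚ.* b <⟨ *-mono-<ʳ b 0<b (ℚ.<-trans (*-mono-<ˡ a₀ 0<a₀ n₀<n) (*-mono-<ʳ (ι n) (0<ι {n} n≥1) a₀<c)) ⟩
    c ℚ.* ι n ℚ.* b ≤⟨ *-mono-≤ˡ (c ℚ.* ι n) 0≤cn b≤ ⟩
    c ℚ.* ι n ℚ.* ι m ≡⟨ trans (ℚ.*-assoc c (ι n) (ι m)) (cong (c ℚ.*_) (sym (ι-* n m))) ⟩
    c ℚ.* ι (n * m) ≤⟨ *-mono-≤ˡ c 0≤c (ι-mono-≤ {n * m} {220 * T} nm≤) ⟩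
    c ℚ.* ι (220 * T) ≡⟨ trans (cong (c ℚ.*_) (ι-* 220 T)) (trans (sym (ℚ.*-assoc c (ι 220) (ι T))) (trans (cong (ℚ._* ι T) c*220) (ℚ.*-identityˡ (ι T)))) ⟩
    ι T ∎
  where
  open ℚ.≤-Reasoning
  open BranchingProgram P using (size)
  open Quotient n size (size≥2 P)
  n≥1 : 1 ≤ n
  n≥1 = n>0 4≼
  n≤T : n ≤ T
  n≤T = length≥n P T computes hasLength n≥1 d-large
  ceiling = binary-ceiling (T + n) n n≥1 (m≤n+m n T)
  κ = proj₁ ceiling
  m = 55 * 2 ^ κ
  K² = 2 ^ κ * 2 ^ κ
  Λ = 755 * (K² * (κ + 4))
  0≤c : 0ℚ ℚ.≤ c
  0≤c = ℚ.<⇒≤ (ℚ.positive⁻¹ c)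
  0≤cn : 0ℚ ℚ.≤ c ℚ.* ι n
  0≤cn = ℚ.≤-trans (ℚ.≤-reflexive (sym (ℚ.*-zeroʳ c))) (*-mono-≤ˡ c 0≤c (0≤ι n))
  nm≤ : n * m ≤ 220 * T
  nm≤ = length-bound n T (2 ^ κ) n≤T (proj₂ (proj₂ ceiling))
  C : ℕ
  C = m * m
  Λ< : suc Λ ≤ C * suc κ
  Λ< = exponent-bound (2 ^ κ) κ (m^n>0 2 κ)
  2^≤C : 2 ^ suc κ ≤ C
  2^≤C = *-mono-≤ {2} {m} {2 ^ κ} {m} (≤-trans (m≤m+n 2 53) (m≤m*n 55 (2 ^ κ) {{m^n≢0 2 κ}})) (m≤n*m (2 ^ κ) 55)
  n/S< : ∀ ρ → Below n/S ρ → ρ ℚ.< ι (2 ^ (C * suc κ))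
  n/S< ρ below = ℚ.<-≤-trans (n/S-bound Λ (λ σ σ>0 size≤ → Main.n-bound P T computes hasLength n≥1 d-large κ σ (proj₁ (proj₂ ceiling)) σ>0 size≤) ρ below)
    (ι-mono-≤ {2 ^ suc Λ} {2 ^ (C * suc κ)} (^-monoʳ-≤ 2 Λ<))
  b≤ : b ℚ.≤ ι m
  b≤ = [ (λ b<0 → ⊥-elim (ℚ.<-irrefl refl (ℚ.<-trans 0<b b<0)))
       , (λ (ρ , below , bb≤ρ) → square-cancel-≤ b m 0<b (ℚ.≤-trans bb≤ρ
           (ratio-bound 4≼ κ C 2^≤C (log-bound 4≼ (C * suc κ) n/S<) ρ below))) ]′ below√

theorem4 :
  ∃[ c ] (0ℚ <ℚ c) ×
    (∀ (n d : ℕ) → 2 * n ^ℕ 2 ≤ d →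
     ∀ (P : BranchingProgram n (Fin d × Fin d)) (T : ℕ) →
     let open BranchingProgram P
         S   = log₂ (fromℕ size)
         n/S = fromℕ n ⊘ S
     in
     Computes EB →
     HasLength T →
     fromℕ 4 ≼ n/S →
     fromℚ c ⊗ fromℕ n ⊗ √ (log₂ n/S ⊘ log₂ (log₂ n/S)) ≼ fromℕ T)
theorem4 = c , ℚ.positive⁻¹ c , lower-bound
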